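{- Let $k$ be a field with $\mathrm{char}\,k\ne3$, let $M\supset k$ be an infinite field, and let $\mathbf a,\mathbf b\in M^3$ with $D_{\mathbf a}D_{\mathbf b}\ne0$. Put $L_{\mathbf a}=\mathrm{Spl}_Mf_3(\mathbf a;X)$, $L_{\mathbf b}=\mathrm{Spl}_Mf_3(\mathbf b;X)$, $G_{\mathbf a}=\mathrm{Gal}(L_{\mathbf a}/M)$, $G_{\mathbf b}=\mathrm{Gal}(L_{\mathbf b}/M)$, and suppose $\#G_{\mathbf a}\ge\#G_{\mathbf b}$. Assume that $f_3(\mathbf a;X)$ is irreducible over $M$, $A_{\mathbf a}A_{\mathbf b}\neq0$ and $A_{\mathbf a}^3B_{\mathbf b}^2-27A_{\mathbf b}^3D_{\mathbf a}\ne0$. Then the list of degrees of the irreducible factors over $M$ of the sextic $F_2(\mathbf a,\mathbf b;X)$ is as follows. Case $G_{\mathbf a}\cong\mathfrak S_3$: - $G_{\mathbf b}\cong\mathfrak S_3$: $(6)$ if $L_{\mathbf a}\cap L_{\mathbf b}=M$; $(3)(3)$ if $[L_{\mathbf a}\cap L_{\mathbf b}:M]=2$; $(1)(2)(3)$ if $L_{\mathbf a}=L_{\mathbf b}$; - $G_{\mathbf b}\cong C_3$ (then $L_{\mathbf a}\cap L_{\mathbf b}=M$): $(6)$; - $G_{\mathbf b}\cong C_2$: $(6)$ if $L_{\mathbf a}\not\supset L_{\mathbf b}$; $(3)(3)$ if $L_{\mathbf a}\supset L_{\mathbf b}$; - $G_{\mathbf b}=\{1\}$: $(6)$. Case $G_{\mathbf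 a}\cong C_3$: - $G_{\mathbf b}\cong C_3$: $(3)(3)$ if $L_{\mathbf a}\ne L_{\mathbf b}$; $(1)(1)(1)(3)$ if $L_{\mathbf a}=L_{\mathbf b}$; - $G_{\mathbf b}\cong C_2$ (then $L_{\mathbf a}\cap L_{\mathbf b}=M$): $(6)$; - $G_{\mathbf b}=\{1\}$: $(3)(3)$. Moreover, for each irreducible factor $h_\mu(X)$ of $F_2(\mathbf a,\mathbf b;X)$ over $M$, a root field $M_\mu$ of $h_\mu(X)$ (the field generated over $M$ by one root of $h_\mu$) satisfies $\mathrm{Spl}_{M_\mu}f_3(\mathbf a;X)=\mathrm{Spl}_{M_\mu}f_3(\mathbf b;X)$.
   Context: For $\mathbf a=(a_1,a_2,a_3)$ put $f_3(\mathbf a;X)=X^3-a_1X^2+a_2X-a_3$, $A_{\mathbf a}=a_1^2-3a_2$, $B_{\mathbf a}=2a_1^3-9a_1a_2+27a_3$, and let $D_{\mathbf a}=a_1^2a_2^2-4a_2^3-4a_1^3a_3+18a_1a_2a_3-27a_3^2$ be the discriminant of $f_3(\mathbf a;X)$; similarly for $\mathbf b$. All fields are taken in a fixed algebraic closure of $M$; $\mathrm{Spl}_N f$ is the splitting field of $f$ over $N$. Define $$F_2(\mathbf a,\mathbf b;X)=X^6-\frac{2A_{\mathbf a}A_{\mathbf b}}{D_{\mathbf a}}X^4+\frac{B_{\mathbf b}}{D_{\mathbf a}}X^3+\frac{A_{\mathbf a}^2A_{\mathbf b}^2}{D_{\mathbf a}^2}X^2-\frac{A_{\mathbf a}A_{\mathbf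 b}B_{\mathbf b}}{D_{\mathbf a}^2}X+\frac{A_{\mathbf b}^3D_{\mathbf a}-A_{\mathbf a}^3D_{\mathbf b}}{D_{\mathbf a}^3}.$$ The notation $(d_1)(d_2)\cdots$ means that the irreducible factors have degrees $d_1,d_2,\ldots$. -}

module Defs where

open import Level using (Level; _⊔_; suc; 0ℓ)
open import Algebra.Apartness.Bundles using (HeytingField; HeytingCommutativeRing)
open import Algebra.Bundles using (CommutativeRing; Group; RawRing; RawSemiring)
import Algebra.Apartness.Properties.HeytingCommutativeRing as HeytingProperties
import Algebra.Definitions.RawSemiring as SemiringDefinitions
import Algebra.Morphism.Construct.Composition as Composition
import Algebra.Morphism.Construct.Identity as Identity
open import Algebra.Morphism.Structures
  using (IsGroupIsomorphism; IsRingMonomorphism; IsRingIsomorphism)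
open import Data.Fin.Base using (Fin)
import Data.Fin.Permutation as Perm
open import Data.Integer.Base as ℤ using (ℤ; +_)
import Data.Integer.Divisibility.Signed as ℤ∣
import Data.Integer.Properties as ℤₚ
import Data.Integer.Solver as ℤSolver
open import Data.List.Base as List using (List; []; _∷_; length; lookup)
open import Data.Nat.Base as ℕ using (ℕ; zero)
import Data.Nat.Divisibility as ℕ∣
open import Data.Product.Base using (Σ; ∃; ∃₂; _×_; _,_; proj₁; proj₂)
open import Data.Sum.Base using (inj₁; inj₂)
open import Data.Vec.Functional using (Vector)
open import Function.Bundles using (Bijection; Injection; Inverse; _⇔_)
open import Relation.Binary.Bundles using (Setoid)
open import Relation.Binary.PropositionalEquality as ≡ using (_≡_)
open import Relation.Nullary.Negation using (¬_)
open import Relation.Unary using (Pred; _∪_)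
import Relation.Binary.Reasoning.Setoid as SetoidReasoning

private variable
  c ℓ₁ ℓ₂ ℓ₃ : Level

------------------------------------------------------------------------
-- Sets and groups

Infinite : Setoid c ℓ₁ → Set (c ⊔ ℓ₁)
Infinite S = ∀ n → ¬ Bijection (≡.setoid (Fin n)) S

infix 4 _≅_ _#≥#_

_≅_ : Group c ℓ₁ → Group ℓ₂ ℓ₃ → Set (c ⊔ ℓ₁ ⊔ ℓ₂ ⊔ ℓ₃)
G ≅ H = ∃ (IsGroupIsomorphism (Group.rawGroup G) (Group.rawGroup H))

-- Comparison of cardinalities: the order of H is at most that of G.
_#≥#_ : Group c ℓ₁ → Group ℓ₂ ℓ₃ → Set (c ⊔ ℓ₁ ⊔ ℓ₂ ⊔ ℓ₃)
G #≥# H = Injection (Group.setoid H) (Group.setoid G)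

Trivial : Group c ℓ₁ → Set (c ⊔ ℓ₁)
Trivial G = ∀ g → g ≈ ε where open Group G

-- The product is composition in diagrammatic order.
𝔖 : ℕ → Group 0ℓ 0ℓ
𝔖 n = record
  { Carrier = Perm.Permutation′ n
  ; _≈_     = Perm._≈_
  ; _∙_     = Perm._∘ₚ_
  ; ε       = Perm.id
  ; _⁻¹     = Perm.flip
  ; isGroup = record
    { isMonoid = record
      { isSemigroup = record
        { isMagma = record
          { isEquivalence = record
            { refl  = λ _ → ≡.refl
            ; sym   = λ p i → ≡.sym (p i)
            ; trans = λ p q i → ≡.trans (p i) (q i)
            }
          ; ∙-cong = λ {_} {π′} {ρ} p q i →
              ≡.trans (≡.cong (ρ Perm.⟨$⟩ʳ_) (p i)) (q (π′ Perm.⟨$⟩ʳ i))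
          }
        ; assoc = λ _ _ _ _ → ≡.refl
        }
      ; identity = (λ _ _ → ≡.refl) , (λ _ _ → ≡.refl)
      }
    ; inverse = (λ π _ → Perm.inverseʳ π) , (λ π _ → Perm.inverseˡ π)
    ; ⁻¹-cong = λ {π} {ρ} p i → ≡.trans
        (≡.sym (Perm.inverseˡ ρ))
        (≡.trans (≡.cong (ρ Perm.⟨$⟩ˡ_) (≡.sym (p (π Perm.⟨$⟩ˡ i))))
                 (≡.cong (ρ Perm.⟨$⟩ˡ_) (Perm.inverseʳ π)))
    }
  }

-- The cyclic group of order n, as ℤ modulo n.
C : ℕ → Group 0ℓ 0ℓ
C n = record
  { Carrier = ℤ
  ; _≈_     = _≋_
  ; _∙_     = ℤ._+_
  ; ε       = + 0
  ; _⁻¹     = ℤ.-_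
  ; isGroup = record
    { isMonoid = record
      { isSemigroup = record
        { isMagma = record
          { isEquivalence = record
            { refl  = λ {i} → reflexive (≡.refl {x = i})
            ; sym   = λ {i} {j} p → ≡.subst (+ n ∣_) (neg i j) (ℤ∣.∣m⇒∣-m p)
            ; trans = λ {i} {j} {k} p q → ≡.subst (+ n ∣_) (tel i j k) (ℤ∣.∣m∣n⇒∣m+n p q)
            }
          ; ∙-cong = λ {i} {j} {k} {l} p q →
              ≡.subst (+ n ∣_) (add i j k l) (ℤ∣.∣m∣n⇒∣m+n p q)
          }
        ; assoc = λ i j k → reflexive (ℤₚ.+-assoc i j k)
        }
      ; identity = (λ i → reflexive (ℤₚ.+-identityˡ i))
                 , (λ i → reflexive (ℤₚ.+-identityʳ i))
      }
    ; inverse = (λ i → reflexive (ℤₚ.+-inverseˡ i))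
              , (λ i → reflexive (ℤₚ.+-inverseʳ i))
    ; ⁻¹-cong = λ {i} {j} p → ≡.subst (+ n ∣_) (neg′ i j) (ℤ∣.∣m⇒∣-m p)
    }
  }
  where
  open ℤ∣ using (_∣_; divides)
  open ℤSolver.+-*-Solver

  _≋_ : ℤ → ℤ → Set
  i ≋ j = + n ∣ i ℤ.- j

  reflexive : ∀ {i j} → i ≡ j → i ≋ j
  reflexive {i} ≡.refl = ≡.subst (+ n ∣_) (≡.sym (ℤₚ.+-inverseʳ i)) (divides (+ 0) ≡.refl)

  neg : ∀ i j → ℤ.- (i ℤ.- j) ≡ j ℤ.- i
  neg = solve 2 (λ i j → :- (i :- j) := j :- i) ≡.refl

  neg′ : ∀ i j → ℤ.- (i ℤ.- j) ≡ ℤ.- i ℤ.- ℤ.- j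
  neg′ = solve 2 (λ i j → :- (i :- j) := :- i :- :- j) ≡.refl

  tel : ∀ i j k → (i ℤ.- j) ℤ.+ (j ℤ.- k) ≡ i ℤ.- k
  tel = solve 3 (λ i j k → (i :- j) :+ (j :- k) := i :- k) ≡.refl

  add : ∀ i j k l → (i ℤ.- j) ℤ.+ (k ℤ.- l) ≡ (i ℤ.+ k) ℤ.- (j ℤ.+ l)
  add = solve 4 (λ i j k l → (i :- j) :+ (k :- l) := (i :+ k) :- (j :+ l)) ≡.refl

------------------------------------------------------------------------
-- Fields: under excluded middle a Heyting field is a field in the usual
-- sense, and tightness makes x # y the same as x ≉ y.

module FieldDefinitions (K : HeytingField c ℓ₁ ℓ₂) where
  open HeytingField K
  open HeytingCommutativeRing heytingCommutativeRing using (commutativeRing)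
  open CommutativeRing commutativeRing public using (rawRing)
  open HeytingProperties heytingCommutativeRing
    using (x-0≈x; invertibleʳ⇒#)
  open SemiringDefinitions (RawRing.rawSemiring rawRing) public
    using (_^_; sum) renaming (_×_ to _·_)

  Characteristic : ℕ → Set ℓ₁
  Characteristic p = ∀ n → n · 1# ≈ 0# ⇔ p ℕ∣.∣ n

  recip : ∀ {x} → x # 0# → Carrier
  recip x#0 = proj₁ (#⇒invertible x#0)

  recip-inverseʳ : ∀ {x} (x#0 : x # 0#) → x * recip x#0 ≈ 1#
  recip-inverseʳ {x} x#0 =
    trans (*-congʳ (sym (x-0≈x x))) (proj₂ (proj₂ (#⇒invertible x#0)))

  xy#0→x#0 : ∀ {x y} → x * y # 0# → x # 0#
  xy#0→x#0 {x} {y} xy#0 = invertibleʳ⇒# (y * recip xy#0 , (begin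
    (x - 0#) * (y * recip xy#0) ≈⟨ *-congʳ (x-0≈x x) ⟩
    x * (y * recip xy#0)        ≈⟨ *-assoc x y (recip xy#0) ⟨
    x * y * recip xy#0          ≈⟨ recip-inverseʳ xy#0 ⟩
    1#                          ∎))
    where open SetoidReasoning setoid

  -- Coefficients in ascending order; trailing zeros are allowed.
  Poly : Set c
  Poly = List Carrier

  coeff : Poly → ℕ → Carrier
  coeff []      _         = 0#
  coeff (x ∷ _) zero      = x
  coeff (_ ∷ p) (ℕ.suc n) = coeff p n

  infix  4 _≈ₚ_
  infixl 6 _+ₚ_
  infixl 7 _*ₚ_

  _≈ₚ_ : Poly → Poly → Set ℓ₁
  p ≈ₚ q = ∀ n → coeff p n ≈ coeff q n

  _+ₚ_ : Poly → Poly → Poly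
  []      +ₚ q       = q
  (x ∷ p) +ₚ []      = x ∷ p
  (x ∷ p) +ₚ (y ∷ q) = x + y ∷ p +ₚ q

  _*ₚ_ : Poly → Poly → Poly
  []      *ₚ q = []
  (x ∷ p) *ₚ q = List.map (x *_) q +ₚ (0# ∷ p *ₚ q)

  polyRawSemiring : RawSemiring c ℓ₁
  polyRawSemiring = record
    { Carrier = Poly
    ; _≈_     = _≈ₚ_
    ; _+_     = _+ₚ_
    ; _*_     = _*ₚ_
    ; 0#      = []
    ; 1#      = 1# ∷ []
    }

  open SemiringDefinitions polyRawSemiring public
    using (Irreducible; product) renaming (_∣_ to _∣ₚ_)

  eval : Poly → Carrier → Carrier
  eval []      t = 0#
  eval (x ∷ p) t = x + t * eval p t

  HasDegree : Poly → ℕ → Set (ℓ₁ ⊔ ℓ₂)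
  HasDegree p d = coeff p d # 0# × (∀ n → d ℕ.< n → coeff p n ≈ 0#)

  -- A unit in front of the product would be redundant when ds is
  -- non-empty: it can be absorbed into one of the factors.
  IrreducibleFactorDegrees : Poly → List ℕ → Set (c ⊔ ℓ₁ ⊔ ℓ₂)
  IrreducibleFactorDegrees p ds = Σ (Vector Poly (length ds)) λ h →
    (∀ i → Irreducible (h i) × HasDegree (h i) (lookup ds i)) × product h ≈ₚ p

  Triple : Set c
  Triple = Carrier × Carrier × Carrier

  f₃ : Triple → Poly
  f₃ (a₁ , a₂ , a₃) = - a₃ ∷ a₂ ∷ - a₁ ∷ 1# ∷ []

  A B D : Triple → Carrier
  A (a₁ , a₂ , a₃) = a₁ ^ 2 - 3 · a₂
  B (a₁ , a₂ , a₃) = 2 · a₁ ^ 3 - 9 · (a₁ * a₂) + 27 · a₃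
  D (a₁ , a₂ , a₃) =
    a₁ ^ 2 * a₂ ^ 2 - 4 · a₂ ^ 3 - 4 · (a₁ ^ 3 * a₃) + 18 · (a₁ * a₂ * a₃) - 27 · a₃ ^ 2

  F₂ : (a b : Triple) → D a # 0# → Poly
  F₂ a b Da#0
    = (A b ^ 3 * D a - A a ^ 3 * D b) * d ^ 3
    ∷ - (A a * A b * B b * d ^ 2)
    ∷ A a ^ 2 * A b ^ 2 * d ^ 2
    ∷ B b * d
    ∷ - (2 · (A a * A b) * d)
    ∷ 0#
    ∷ 1#
    ∷ []
    where
    d : Carrier
    d = recip Da#0

------------------------------------------------------------------------
-- Extensions

IsExtension : (k : HeytingField c ℓ₁ ℓ₂) (K : HeytingField c ℓ₁ ℓ₂) →
              (HeytingField.Carrier k → HeytingField.Carrier K) → Set (c ⊔ ℓ₁)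
IsExtension k K = IsRingMonomorphism (FieldDefinitions.rawRing k) (FieldDefinitions.rawRing K)

record AlgebraicClosure (M : HeytingField c ℓ₁ ℓ₂) : Set (suc (c ⊔ ℓ₁ ⊔ ℓ₂)) where
  private module M = FieldDefinitions M
  field
    Ω : HeytingField c ℓ₁ ℓ₂
  open HeytingField Ω using (_≈_; 0#)
  private module Ω = FieldDefinitions Ω
  field
    ι                   : HeytingField.Carrier M → HeytingField.Carrier Ω
    isExtension         : IsExtension M Ω ι
    algebraicallyClosed : ∀ p n → Ω.HasDegree p (ℕ.suc n) → ∃ λ x → Ω.eval p x ≈ 0#
    algebraic           : ∀ x → ∃₂ λ p n → M.HasDegree p n × Ω.eval (List.map ι p) x ≈ 0#

-- All fields between M and its algebraic closure are subfields of the latter.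
module InClosure (M : HeytingField c ℓ₁ ℓ₂) (closure : AlgebraicClosure M) where
  open AlgebraicClosure closure
  open HeytingField Ω
  private
    module M = HeytingField M
    module Mᵈ = FieldDefinitions M
    module Ωᵈ = FieldDefinitions Ω

  Subset : Set (suc (c ⊔ ℓ₁))
  Subset = Pred Carrier (c ⊔ ℓ₁)

  record Subfield : Set (suc (c ⊔ ℓ₁)) where
    field
      Member   : Subset
      resp     : ∀ {x y} → x ≈ y → Member x → Member y
      0-closed : Member 0#
      1-closed : Member 1#
      +-closed : ∀ {x y} → Member x → Member y → Member (x + y)
      *-closed : ∀ {x y} → Member x → Member y → Member (x * y)
      -‿closed : ∀ {x} → Member x → Member (- x)
      inverse-closed : ∀ {x y} → Member x → x * y ≈ 1# → Member y

    rawRing : RawRing (c ⊔ ℓ₁) ℓ₁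
    rawRing = record
      { Carrier = ∃ Member
      ; _≈_     = λ x y → proj₁ x ≈ proj₁ y
      ; _+_     = λ x y → proj₁ x + proj₁ y , +-closed (proj₂ x) (proj₂ y)
      ; _*_     = λ x y → proj₁ x * proj₁ y , *-closed (proj₂ x) (proj₂ y)
      ; -_      = λ x → - proj₁ x , -‿closed (proj₂ x)
      ; 0#      = 0# , 0-closed
      ; 1#      = 1# , 1-closed
      }

  open Subfield public using (Member)

  data Generated (S : Subset) : Subset where
    generator : ∀ {x} → S x → Generated S x
    resp      : ∀ {x y} → x ≈ y → Generated S x → Generated S y
    0-closed  : Generated S 0#
    1-closed  : Generated S 1#
    +-closed  : ∀ {x y} → Generated S x → Generated S y → Generated S (x + y)
    *-closed  : ∀ {x y} → Generated S x → Generated S y → Generated S (x * y)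
    -‿closed  : ∀ {x} → Generated S x → Generated S (- x)
    inverse-closed : ∀ {x y} → Generated S x → x * y ≈ 1# → Generated S y

  generatedBy : Subset → Subfield
  generatedBy S = record
    { Member         = Generated S
    ; resp           = resp
    ; 0-closed       = 0-closed
    ; 1-closed       = 1-closed
    ; +-closed       = +-closed
    ; *-closed       = *-closed
    ; -‿closed       = -‿closed
    ; inverse-closed = inverse-closed
    }

  base : Subset
  base x = ∃ λ m → ι m ≈ x

  Root : Mᵈ.Poly → Pred Carrier ℓ₁
  Root f x = Ωᵈ.eval (List.map ι f) x ≈ 0#

  Spl : Subset → Mᵈ.Poly → Subfield
  Spl N f = generatedBy (N ∪ Root f)

  base⟨_⟩ : Carrier → Subfield
  base⟨ θ ⟩ = generatedBy (base ∪ (_≈ θ))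

  -- [ K : M ] = n, for a subset K of the closure.
  HasDegreeOverBase : Subset → ℕ → Set (c ⊔ ℓ₁)
  HasDegreeOverBase K n = Σ (Vector Carrier n) λ e →
      (∀ i → K (e i))
    × (∀ x → K x → ∃ λ m → x ≈ combination m e)
    × (∀ m → combination m e ≈ 0# → ∀ i → m i M.≈ M.0#)
    where
    combination : Vector M.Carrier n → Vector Carrier n → Carrier
    combination m e = Ωᵈ.sum (λ i → ι (m i) * e i)

  module _ (K : Subfield) where
    open RawRing (Subfield.rawRing K) using () renaming (Carrier to ∣K∣; _≈_ to _≈ᴷ_)

    record Automorphism : Set (c ⊔ ℓ₁) where
      field
        to                : ∣K∣ → ∣K∣
        isRingIsomorphism : IsRingIsomorphism (Subfield.rawRing K) (Subfield.rawRing K) to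
        fixesBase         : ∀ x → base (proj₁ x) → to x ≈ᴷ x
      open IsRingIsomorphism isRingIsomorphism public

    open Automorphism

    private
      from : Automorphism → ∣K∣ → ∣K∣
      from σ y = proj₁ (surjective σ y)

      to∘from : ∀ σ y → to σ (from σ y) ≈ᴷ y
      to∘from σ y = proj₂ (surjective σ y) refl

      from-unique : ∀ σ {x y} → to σ x ≈ᴷ y → from σ y ≈ᴷ x
      from-unique σ {x} {y} p = injective σ (trans (to∘from σ y) (sym p))

      inverseAutomorphism : Automorphism → Automorphism
      inverseAutomorphism σ = record
        { to = from σ
        ; isRingIsomorphism = record
          { isRingMonomorphism = record
            { isRingHomomorphism = record
              { isSemiringHomomorphism = record
                { isNearSemiringHomomorphism = record
                  { +-isMonoidHomomorphism = record
                    { isMagmaHomomorphism = record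
                      { isRelHomomorphism = record
                        { cong = λ {x} {y} p →
                            from-unique σ (trans (to∘from σ y) (sym p)) }
                      ; homo = λ x y → from-unique σ
                          (trans (+-homo σ (from σ x) (from σ y))
                                 (+-cong (to∘from σ x) (to∘from σ y)))
                      }
                    ; ε-homo = from-unique σ (0#-homo σ)
                    }
                  ; *-homo = λ x y → from-unique σ
                      (trans (*-homo σ (from σ x) (from σ y))
                             (*-cong (to∘from σ x) (to∘from σ y)))
                  }
                ; 1#-homo = from-unique σ (1#-homo σ)
                }
              ; -‿homo = λ x → from-unique σ
                  (trans (-‿homo σ (from σ x)) (-‿cong (to∘from σ x)))
              }
            ; injective = λ {x} {y} p →
                trans (sym (to∘from σ x)) (trans (⟦⟧-cong σ p) (to∘from σ y))
            }
          ; surjective = λ y → to σ y , λ p → from-unique σ (sym p)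
          }
        ; fixesBase = λ x x∈M → from-unique σ (fixesBase σ x x∈M)
        }

    -- Field automorphisms of K fixing every element of M.
    Gal : Group (c ⊔ ℓ₁) (c ⊔ ℓ₁)
    Gal = record
      { Carrier = Automorphism
      ; _≈_     = λ σ τ → ∀ x → to σ x ≈ᴷ to τ x
      ; _∙_     = λ σ τ → record
        { to                = λ x → to σ (to τ x)
        ; isRingIsomorphism = Composition.isRingIsomorphism trans
            (isRingIsomorphism τ) (isRingIsomorphism σ)
        ; fixesBase         = λ x x∈M →
            trans (⟦⟧-cong σ (fixesBase τ x x∈M)) (fixesBase σ x x∈M)
        }
      ; ε       = record
        { to                = λ x → x
        ; isRingIsomorphism = Identity.isRingIsomorphism (Subfield.rawRing K) refl
        ; fixesBase         = λ _ _ → refl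
        }
      ; _⁻¹     = inverseAutomorphism
      ; isGroup = record
        { isMonoid = record
          { isSemigroup = record
            { isMagma = record
              { isEquivalence = record
                { refl  = λ _ → refl
                ; sym   = λ p x → sym (p x)
                ; trans = λ p q x → trans (p x) (q x)
                }
              ; ∙-cong = λ {σ} {σ′} {τ} {τ′} p q x →
                  trans (⟦⟧-cong σ (q x)) (p (to τ′ x))
              }
            ; assoc = λ _ _ _ _ → refl
            }
          ; identity = (λ _ _ → refl) , (λ _ _ → refl)
          }
        ; inverse = (λ σ x → from-unique σ refl) , to∘from
        ; ⁻¹-cong = λ {σ} {τ} p x →
            from-unique σ (trans (p (from τ x)) (to∘from τ x))
        }
      }

-- Put x = 3α - a₁ and y = 3β - b₁ for the roots α, β of the two cubics, which
-- become X³ - 3AX - B and X³ - 3CX - G.  A bijection between the two triples of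
-- roots is a substitution y = vx + w(x² - 2A), and θ = 3w runs through the roots
-- of F₂; v is a rational function of w, so over a field containing θ the two
-- cubics have the same splitting field.
--
-- F₂ is a quadratic polynomial in Y = X³ + pX, so it is a product of two cubics
-- X³ + pX - Y over the field generated by a root Y of that quadratic.  As a cubic
-- without roots acquires none in a quadratic extension, F₂ is irreducible unless
-- Y lies in M.  If it does, the factors are governed by the roots of F₂ in M,
-- which correspond to the roots of the second cubic in M(x₁).
--
-- With ω = (x₁²x₂ + x₂²x₃ + x₃²x₁) / 3, up to the order of the roots, Y lies in
-- M exactly when ω is rational for both cubics, or for neither and generates the
-- same quadratic extension for both.  The Galois groups only serve to decide
-- whether ω and the roots are rational: an automorphism has order dividing 3 if
-- ω is rational and order dividing 2 if a root is, and in the other cases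
-- suitable automorphisms are written down.

module Submission where

open import Defs
open import Level using (Level; _⊔_; Lift; lift; lower)
open import Algebra.Apartness.Bundles using (HeytingField; HeytingCommutativeRing)
import Algebra.Apartness.Properties.HeytingCommutativeRing as HeytingProperties
open import Algebra.Bundles using (CommutativeRing; Group; RawRing)
import Algebra.Definitions.RawMagma as RawMagma
import Algebra.Definitions.RawSemiring as SemiringDefinitions
open import Algebra.Morphism.Structures
  using (IsGroupHomomorphism; IsGroupIsomorphism; IsRingHomomorphism; IsRingMonomorphism)
import Algebra.Properties.Ring as RingProperties
import Algebra.Properties.Semiring.Mult as SemiringMult
open import Axiom.ExcludedMiddle using (ExcludedMiddle)
open import Data.Bool.Base as Bool using (Bool; true; _∧_)
open import Data.Empty using (⊥; ⊥-elim)
open import Data.Fin.Base using (zero; suc)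
open import Data.Fin.Patterns using (0F; 1F; 2F; 3F)
import Data.Fin.Permutation as Perm
open import Data.Integer.Base as ℤ using (+_)
import Data.Integer.Divisibility.Signed as ℤ∣
import Data.Integer.Properties as ℤₚ
import Data.Integer.Solver as ℤSolver
open import Data.List.Base as List using (List; []; _∷_)
open import Data.List.Relation.Unary.All as All using (All; []; _∷_)
open import Data.Nat.Base as ℕ using (ℕ; zero; suc; s≤s; z≤n; _≡ᵇ_)
import Data.Nat.Divisibility as ℕ∣
import Data.Nat.Properties as ℕₚ
open import Data.Product.Base using (Σ; ∃; ∃₂; _×_; _,_; proj₁; proj₂)
open import Data.Sum.Base as Sum using (_⊎_; inj₁; inj₂; [_,_]′)
open import Data.Vec.Base as Vec using (Vec; []; _∷_)
open import Data.Vec.N-ary using (N-ary; ∀ⁿ; curryⁿ; _$ⁿ_)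
open import Data.Vec.Relation.Binary.Pointwise.Inductive using (Pointwise; []; _∷_)
import Data.Vec.Relation.Unary.All as VecAll
open import Function.Base using (_∘_; id)
open import Function.Bundles using (mk⇔)
open import Relation.Binary.PropositionalEquality as ≡ using (_≡_)
import Relation.Binary.Reasoning.Setoid as SetoidReasoning
open import Relation.Nullary.Decidable as Dec using (Dec; yes; no; toWitnessFalse; decidable-stable)
open import Relation.Nullary.Negation using (¬_; contradiction)
open import Relation.Unary using (_∩_; _≐_; _⊆_)

-- A quadratic polynomial interpolates any map from the `xᵢ` to the `yⱼ`; as the `yⱼ` sum to 0 and
-- the `xᵢ²` to `6A`, its constant term is `- 2Aw`. It acts on `ω` by an affine map `ω ↦ δ ω + μ`,
-- and the images of `ω` and of its mirror image `ω′` fix `δ` and `μ`. Hence the six bijections give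
-- only two values of `μ = D Y`, one for each orientation: this is why F₂ is quadratic in Y. The
-- hypothesis `A³G² - 27C³D ≠ 0` keeps `3θ² + p` away from zero at the roots. Up to nonzero factors
-- this is also the coefficient of v in the equation left by elimination, so the roots of each cubic
-- are simple and v is a function of w. Characteristic 2 is allowed, where a square root of the
-- discriminant cannot tell the orientations apart; `ω` can, because `ω - ω′ = - 9 Δ`. For the same
-- reason no square is completed: quadratic elements are given by `t² = st + n`. No degree formula
-- for towers is used. Independence of 1, x, x² over a field is read off from the absence of roots
-- there, and coefficients are compared over a larger field.

-- Polynomial identities in commutative rings, decided by normal forms

infixl 6 _⊕_ _⊖_
infixl 7 _⊗_
infixr 8 _⊙_ _↑_
infix  9 ⊝_

data Expr : Set where
  var     : ℕ → Expr
  𝟘 𝟙     : Expr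
  _⊕_ _⊗_ : Expr → Expr → Expr
  ⊝_      : Expr → Expr
  _⊙_     : ℕ → Expr → Expr
  _↑_     : Expr → ℕ → Expr

_⊖_ : Expr → Expr → Expr
e ⊖ f = e ⊕ (⊝ f)

-- Integers are pairs of naturals (their difference); a polynomial in
-- n + 1 variables is its list of coefficients in the first of them.
Normal : ℕ → Set
Normal zero    = ℕ × ℕ
Normal (suc n) = List (Normal n)

module _ where
  infixl 6 _⊞_
  infixl 7 _⊠_

  0ₙ : ∀ {n} → Normal n
  0ₙ {zero}  = 0 , 0
  0ₙ {suc n} = []

  1ₙ : ∀ {n} → Normal n
  1ₙ {zero}  = 1 , 0
  1ₙ {suc n} = 1ₙ ∷ []

  varₙ : ∀ {n} → ℕ → Normal n
  varₙ {zero}  i       = 0ₙ {zero}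
  varₙ {suc n} zero    = 0ₙ ∷ 1ₙ ∷ []
  varₙ {suc n} (suc i) = varₙ i ∷ []

  negateₙ : ∀ {n} → Normal n → Normal n
  negateₙ {zero}  (a , b) = b , a
  negateₙ {suc n} []      = []
  negateₙ {suc n} (p ∷ P) = negateₙ p ∷ negateₙ {suc n} P

  _⊞_ : ∀ {n} → Normal n → Normal n → Normal n
  _⊞_ {zero}  (a , b) (c , d) = a ℕ.+ c , b ℕ.+ d
  _⊞_ {suc n} []      Q       = Q
  _⊞_ {suc n} (p ∷ P) []      = p ∷ P
  _⊞_ {suc n} (p ∷ P) (q ∷ Q) = (p ⊞ q) ∷ _⊞_ {suc n} P Q

  mutual
    _⊠_ : ∀ {n} → Normal n → Normal n → Normal n
    _⊠_ {zero}  (a , b) (c , d) = a ℕ.* c ℕ.+ b ℕ.* d , a ℕ.* d ℕ.+ b ℕ.* c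
    _⊠_ {suc n} []      Q       = []
    _⊠_ {suc n} (p ∷ P) Q       = _⊞_ {suc n} (scaleₙ p Q) (0ₙ ∷ _⊠_ {suc n} P Q)

    scaleₙ : ∀ {n} → Normal n → List (Normal n) → List (Normal n)
    scaleₙ p []      = []
    scaleₙ p (q ∷ Q) = (p ⊠ q) ∷ scaleₙ p Q

  timesₙ : ∀ {n} → ℕ → Normal n → Normal n
  timesₙ {zero}  k (a , b) = k ℕ.* a , k ℕ.* b
  timesₙ {suc n} k []      = []
  timesₙ {suc n} k (p ∷ P) = timesₙ k p ∷ timesₙ {suc n} k P

  powerₙ : ∀ {n} → Normal n → ℕ → Normal n
  powerₙ P zero    = 1ₙ
  powerₙ P (suc k) = P ⊠ powerₙ P k

  normalise : ∀ {n} → Expr → Normal n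
  normalise (var i) = varₙ i
  normalise 𝟘       = 0ₙ
  normalise 𝟙       = 1ₙ
  normalise (e ⊕ f) = normalise e ⊞ normalise f
  normalise (e ⊗ f) = normalise e ⊠ normalise f
  normalise (⊝ e)   = negateₙ (normalise e)
  normalise (k ⊙ e) = timesₙ k (normalise e)
  normalise (e ↑ k) = powerₙ (normalise e) k

  -- Normal forms are neither trimmed nor reduced, so they are not canonical. An identity is
  -- therefore tested on the difference of its sides, which has to vanish coefficient by
  -- coefficient, a pair of naturals being zero when its entries agree.
  isZero : ∀ {n} → Normal n → Bool
  isZero {zero}  (a , b) = a ≡ᵇ b
  isZero {suc n} []      = true
  isZero {suc n} (p ∷ P) = isZero p ∧ isZero {suc n} P

infix 9 _‼_
_‼_ : ∀ {n} → Vec Expr n → ℕ → Expr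
[]      ‼ i     = 𝟘
(e ∷ σ) ‼ zero  = e
(e ∷ σ) ‼ suc i = σ ‼ i

substitute : ∀ {n} → Vec Expr n → Expr → Expr
substitute σ (var i) = σ ‼ i
substitute σ 𝟘       = 𝟘
substitute σ 𝟙       = 𝟙
substitute σ (e ⊕ f) = substitute σ e ⊕ substitute σ f
substitute σ (e ⊗ f) = substitute σ e ⊗ substitute σ f
substitute σ (⊝ e)   = ⊝ substitute σ e
substitute σ (k ⊙ e) = k ⊙ substitute σ e
substitute σ (e ↑ k) = substitute σ e ↑ k

varsFrom : ℕ → ∀ n → Vec Expr n
varsFrom i zero    = []
varsFrom i (suc n) = var i ∷ varsFrom (suc i) n

vars : ∀ n → Vec Expr n
vars = varsFrom 0

module RingSolver {c ℓ} (R : CommutativeRing c ℓ) where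
  open CommutativeRing R hiding (zero)
  open SemiringDefinitions (RawRing.rawSemiring rawRing) using (_^_) renaming (_×_ to _·_)
  open SemiringMult semiring using (×-homo-+; ×1-homo-*; ×-assocˡ; ×-congʳ; ×-assoc-*)
  open RingProperties ring
  open SetoidReasoning setoid

  -- Variables outside the environment are read as zero.
  _!_ : ∀ {n} → Vec Carrier n → ℕ → Carrier
  []      ! i     = 0#
  (x ∷ ρ) ! zero  = x
  (x ∷ ρ) ! suc i = ρ ! i

  ⟦_⟧ : ∀ {n} → Expr → Vec Carrier n → Carrier
  ⟦ var i ⟧ ρ = ρ ! i
  ⟦ 𝟘 ⟧     ρ = 0#
  ⟦ 𝟙 ⟧     ρ = 1#
  ⟦ e ⊕ f ⟧ ρ = ⟦ e ⟧ ρ + ⟦ f ⟧ ρ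
  ⟦ e ⊗ f ⟧ ρ = ⟦ e ⟧ ρ * ⟦ f ⟧ ρ
  ⟦ ⊝ e ⟧   ρ = - ⟦ e ⟧ ρ
  ⟦ k ⊙ e ⟧ ρ = k · ⟦ e ⟧ ρ
  ⟦ e ↑ k ⟧ ρ = ⟦ e ⟧ ρ ^ k

  value : ∀ {n} → Normal n → Vec Carrier n → Carrier
  value {zero}  (a , b) []      = a · 1# - b · 1#
  value {suc n} []      ρ       = 0#
  value {suc n} (p ∷ P) (x ∷ ρ) = value p ρ + x * value {suc n} P (x ∷ ρ)

  private
    interchange : ∀ a b c d → (a + b) + (c + d) ≈ (a + c) + (b + d)
    interchange a b c d = begin
      (a + b) + (c + d) ≈⟨ +-assoc a b _ ⟩
      a + (b + (c + d)) ≈⟨ +-congˡ (+-assoc b c d) ⟨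
      a + ((b + c) + d) ≈⟨ +-congˡ (+-congʳ (+-comm b c)) ⟩
      a + ((c + b) + d) ≈⟨ +-congˡ (+-assoc c b d) ⟩
      a + (c + (b + d)) ≈⟨ +-assoc a c _ ⟨
      (a + c) + (b + d) ∎

    swap* : ∀ a b c → a * (b * c) ≈ b * (a * c)
    swap* a b c = trans (sym (*-assoc a b c)) (trans (*-congʳ (*-comm a b)) (*-assoc b a c))

    neg-+ : ∀ x y → - (x + y) ≈ - x + - y
    neg-+ x y = sym (-‿+-comm x y)

  0ₙ-value : ∀ {n} (ρ : Vec Carrier n) → value (0ₙ {n}) ρ ≈ 0#
  0ₙ-value {zero}  []      = -‿inverseʳ 0#
  0ₙ-value {suc n} (x ∷ ρ) = refl

  1ₙ-value : ∀ {n} (ρ : Vec Carrier n) → value (1ₙ {n}) ρ ≈ 1#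
  1ₙ-value {zero}  []      = begin
    (1# + 0#) - 0# ≈⟨ +-cong (+-identityʳ 1#) -0#≈0# ⟩
    1# + 0#        ≈⟨ +-identityʳ 1# ⟩
    1#             ∎
  1ₙ-value {suc n} (x ∷ ρ) = begin
    value (1ₙ {n}) ρ + x * 0# ≈⟨ +-cong (1ₙ-value ρ) (zeroʳ x) ⟩
    1# + 0#               ≈⟨ +-identityʳ 1# ⟩
    1#                    ∎

  varₙ-value : ∀ {n} i (ρ : Vec Carrier n) → value {n} (varₙ i) ρ ≈ ρ ! i
  varₙ-value {zero}  i       []      = 0ₙ-value []
  varₙ-value {suc n} zero    (x ∷ ρ) = begin
    value (0ₙ {n}) ρ + x * (value (1ₙ {suc n}) (x ∷ ρ)) ≈⟨ +-cong (0ₙ-value ρ) (*-congˡ (1ₙ-value (x ∷ ρ))) ⟩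
    0# + x * 1#                         ≈⟨ +-identityˡ _ ⟩
    x * 1#                              ≈⟨ *-identityʳ x ⟩
    x                                   ∎
  varₙ-value {suc n} (suc i) (x ∷ ρ) = begin
    value {n} (varₙ i) ρ + x * 0# ≈⟨ +-cong (varₙ-value i ρ) (zeroʳ x) ⟩
    ρ ! i + 0#                    ≈⟨ +-identityʳ _ ⟩
    ρ ! i                         ∎

  negateₙ-value : ∀ {n} (P : Normal n) ρ → value (negateₙ P) ρ ≈ - value P ρ
  negateₙ-value {zero} (a , b) [] = begin
    b · 1# - a · 1#         ≈⟨ +-comm _ _ ⟩
    - (a · 1#) + b · 1#     ≈⟨ +-congˡ (-‿involutive _) ⟨
    - (a · 1#) - - (b · 1#) ≈⟨ neg-+ _ _ ⟨
    - (a · 1# - b · 1#)     ∎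
  negateₙ-value {suc n} []      (x ∷ ρ) = sym -0#≈0#
  negateₙ-value {suc n} (p ∷ P) (x ∷ ρ) = begin
    value (negateₙ p) ρ + x * value {suc n} (negateₙ {suc n} P) (x ∷ ρ)
      ≈⟨ +-cong (negateₙ-value p ρ) (*-congˡ (negateₙ-value {suc n} P (x ∷ ρ))) ⟩
    - value p ρ + x * - value {suc n} P (x ∷ ρ)
      ≈⟨ +-congˡ (-‿distribʳ-* x _) ⟨
    - value p ρ - x * value {suc n} P (x ∷ ρ)
      ≈⟨ neg-+ _ _ ⟨
    - (value p ρ + x * value {suc n} P (x ∷ ρ)) ∎

  ⊞-value : ∀ {n} (P Q : Normal n) ρ → value (P ⊞ Q) ρ ≈ value P ρ + value Q ρ
  ⊞-value {zero} (a , b) (c , d) [] = begin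
    (a ℕ.+ c) · 1# - (b ℕ.+ d) · 1#
      ≈⟨ +-cong (×-homo-+ 1# a c) (trans (-‿cong (×-homo-+ 1# b d)) (neg-+ _ _)) ⟩
    (a · 1# + c · 1#) + (- (b · 1#) + - (d · 1#))
      ≈⟨ interchange _ _ _ _ ⟩
    (a · 1# - b · 1#) + (c · 1# - d · 1#) ∎
  ⊞-value {suc n} []      Q       (x ∷ ρ) = sym (+-identityˡ _)
  ⊞-value {suc n} (p ∷ P) []      (x ∷ ρ) = sym (+-identityʳ _)
  ⊞-value {suc n} (p ∷ P) (q ∷ Q) (x ∷ ρ) = begin
    value (p ⊞ q) ρ + x * value {suc n} (_⊞_ {suc n} P Q) (x ∷ ρ)
      ≈⟨ +-cong (⊞-value p q ρ) (*-congˡ (⊞-value {suc n} P Q (x ∷ ρ))) ⟩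
    (value p ρ + value q ρ) + x * (value {suc n} P (x ∷ ρ) + value {suc n} Q (x ∷ ρ))
      ≈⟨ +-congˡ (distribˡ x _ _) ⟩
    (value p ρ + value q ρ) + (x * value {suc n} P (x ∷ ρ) + x * value {suc n} Q (x ∷ ρ))
      ≈⟨ interchange _ _ _ _ ⟩
    value {suc n} (p ∷ P) (x ∷ ρ) + value {suc n} (q ∷ Q) (x ∷ ρ) ∎

  private
    [u-v][s-t] : ∀ u v s t → (u - v) * (s - t) ≈ (u * s + v * t) - (u * t + v * s)
    [u-v][s-t] u v s t = begin
      (u - v) * (s - t)
        ≈⟨ distribʳ _ _ _ ⟩
      u * (s - t) + - v * (s - t)
        ≈⟨ +-cong (distribˡ _ _ _) (distribˡ _ _ _) ⟩
      (u * s + u * - t) + (- v * s + - v * - t)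
        ≈⟨ +-cong (+-congˡ (sym (-‿distribʳ-* u t)))
             (+-cong (sym (-‿distribˡ-* v s))
                     (trans (sym (-‿distribˡ-* v (- t)))
                       (trans (-‿cong (sym (-‿distribʳ-* v t))) (-‿involutive _)))) ⟩
      (u * s - u * t) + (- (v * s) + v * t)
        ≈⟨ +-congˡ (+-comm _ _) ⟩
      (u * s - u * t) + (v * t - v * s)
        ≈⟨ interchange _ _ _ _ ⟩
      (u * s + v * t) + (- (u * t) - v * s)
        ≈⟨ +-congˡ (neg-+ _ _) ⟨
      (u * s + v * t) - (u * t + v * s) ∎

    homo-*+* : ∀ a b c d → (a ℕ.* b ℕ.+ c ℕ.* d) · 1# ≈ a · 1# * (b · 1#) + c · 1# * (d · 1#)
    homo-*+* a b c d = trans (×-homo-+ 1# (a ℕ.* b) (c ℕ.* d)) (+-cong (×1-homo-* a b) (×1-homo-* c d))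

  mutual
    ⊠-value : ∀ {n} (P Q : Normal n) ρ → value (P ⊠ Q) ρ ≈ value P ρ * value Q ρ
    ⊠-value {zero} (a , b) (c , d) [] = begin
      (a ℕ.* c ℕ.+ b ℕ.* d) · 1# - (a ℕ.* d ℕ.+ b ℕ.* c) · 1#
        ≈⟨ +-cong (homo-*+* a c b d) (-‿cong (homo-*+* a d b c)) ⟩
      (a · 1# * (c · 1#) + b · 1# * (d · 1#)) - (a · 1# * (d · 1#) + b · 1# * (c · 1#))
        ≈⟨ [u-v][s-t] _ _ _ _ ⟨
      (a · 1# - b · 1#) * (c · 1# - d · 1#) ∎
    ⊠-value {suc n} []      Q (x ∷ ρ) = sym (zeroˡ _)
    ⊠-value {suc n} (p ∷ P) Q (x ∷ ρ) = begin
      value {suc n} (_⊞_ {suc n} (scaleₙ p Q) (0ₙ ∷ _⊠_ {suc n} P Q)) (x ∷ ρ)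
        ≈⟨ ⊞-value {suc n} (scaleₙ p Q) (0ₙ ∷ _⊠_ {suc n} P Q) (x ∷ ρ) ⟩
      value {suc n} (scaleₙ p Q) (x ∷ ρ) + (value (0ₙ {n}) ρ + x * value {suc n} (_⊠_ {suc n} P Q) (x ∷ ρ))
        ≈⟨ +-cong (scaleₙ-value p Q x ρ) (trans (+-congʳ (0ₙ-value ρ)) (+-identityˡ _)) ⟩
      value p ρ * value {suc n} Q (x ∷ ρ) + x * value {suc n} (_⊠_ {suc n} P Q) (x ∷ ρ)
        ≈⟨ +-congˡ (trans (*-congˡ (⊠-value {suc n} P Q (x ∷ ρ))) (sym (*-assoc x _ _))) ⟩
      value p ρ * value {suc n} Q (x ∷ ρ) + x * value {suc n} P (x ∷ ρ) * value {suc n} Q (x ∷ ρ)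
        ≈⟨ distribʳ _ _ _ ⟨
      value {suc n} (p ∷ P) (x ∷ ρ) * value {suc n} Q (x ∷ ρ) ∎

    scaleₙ-value : ∀ {n} (p : Normal n) Q x ρ →
      value {suc n} (scaleₙ p Q) (x ∷ ρ) ≈ value p ρ * value {suc n} Q (x ∷ ρ)
    scaleₙ-value p []      x ρ = sym (zeroʳ _)
    scaleₙ-value {n} p (q ∷ Q) x ρ = begin
      value (p ⊠ q) ρ + x * value {suc n} (scaleₙ p Q) (x ∷ ρ)
        ≈⟨ +-cong (⊠-value p q ρ) (*-congˡ (scaleₙ-value p Q x ρ)) ⟩
      value p ρ * value q ρ + x * (value p ρ * value {suc n} Q (x ∷ ρ))
        ≈⟨ +-congˡ (swap* _ _ _) ⟩
      value p ρ * value q ρ + value p ρ * (x * value {suc n} Q (x ∷ ρ))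
        ≈⟨ distribˡ _ _ _ ⟨
      value p ρ * value {suc n} (q ∷ Q) (x ∷ ρ) ∎

  private
    ·≈*  : ∀ k x → k · x ≈ k · 1# * x
    ·≈* k x = sym (trans (×-assoc-* k 1# x) (×-congʳ k (*-identityˡ x)))

  timesₙ-value : ∀ {n} k (P : Normal n) ρ → value (timesₙ k P) ρ ≈ k · value P ρ
  timesₙ-value {zero} k (a , b) [] = begin
    (k ℕ.* a) · 1# - (k ℕ.* b) · 1#
      ≈⟨ +-cong (×1-homo-* k a) (trans (-‿cong (×1-homo-* k b)) (-‿distribʳ-* _ _)) ⟩
    k · 1# * (a · 1#) + k · 1# * - (b · 1#)
      ≈⟨ distribˡ _ _ _ ⟨
    k · 1# * (a · 1# - b · 1#)
      ≈⟨ ·≈* k _ ⟨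
    k · (a · 1# - b · 1#) ∎
  timesₙ-value {suc n} k []      (x ∷ ρ) = sym (trans (·≈* k 0#) (zeroʳ _))
  timesₙ-value {suc n} k (p ∷ P) (x ∷ ρ) = begin
    value (timesₙ k p) ρ + x * value {suc n} (timesₙ {suc n} k P) (x ∷ ρ)
      ≈⟨ +-cong (trans (timesₙ-value k p ρ) (·≈* k _))
                (*-congˡ (trans (timesₙ-value {suc n} k P (x ∷ ρ)) (·≈* k _))) ⟩
    k · 1# * value p ρ + x * (k · 1# * value {suc n} P (x ∷ ρ))
      ≈⟨ +-congˡ (swap* _ _ _) ⟩
    k · 1# * value p ρ + k · 1# * (x * value {suc n} P (x ∷ ρ))
      ≈⟨ distribˡ _ _ _ ⟨
    k · 1# * value {suc n} (p ∷ P) (x ∷ ρ)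
      ≈⟨ ·≈* k _ ⟨
    k · value {suc n} (p ∷ P) (x ∷ ρ) ∎

  powerₙ-value : ∀ {n} (P : Normal n) k ρ → value (powerₙ P k) ρ ≈ value P ρ ^ k
  powerₙ-value P zero    ρ = 1ₙ-value ρ
  powerₙ-value P (suc k) ρ = trans (⊠-value P (powerₙ P k) ρ) (*-congˡ (powerₙ-value P k ρ))

  ^-cong : ∀ k {x y} → x ≈ y → x ^ k ≈ y ^ k
  ^-cong zero    x≈y = refl
  ^-cong (suc k) x≈y = *-cong x≈y (^-cong k x≈y)

  normalise-value : ∀ {n} e (ρ : Vec Carrier n) → value {n} (normalise e) ρ ≈ ⟦ e ⟧ ρ
  normalise-value {n} (var i) ρ = varₙ-value i ρ
  normalise-value {n} 𝟘 ρ = 0ₙ-value ρ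
  normalise-value {n} 𝟙 ρ = 1ₙ-value ρ
  normalise-value {n} (e ⊕ f) ρ =
    trans (⊞-value {n} (normalise e) (normalise f) ρ) (+-cong (normalise-value e ρ) (normalise-value f ρ))
  normalise-value {n} (e ⊗ f) ρ =
    trans (⊠-value {n} (normalise e) (normalise f) ρ) (*-cong (normalise-value e ρ) (normalise-value f ρ))
  normalise-value {n} (⊝ e)   ρ =
    trans (negateₙ-value {n} (normalise e) ρ) (-‿cong (normalise-value e ρ))
  normalise-value {n} (k ⊙ e) ρ =
    trans (timesₙ-value {n} k (normalise e) ρ) (×-congʳ k (normalise-value e ρ))
  normalise-value {n} (e ↑ k) ρ =
    trans (powerₙ-value {n} (normalise e) k ρ) (^-cong k (normalise-value e ρ))

  private
    T-∧ : ∀ {a b} → Bool.T (a ∧ b) → Bool.T a × Bool.T b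
    T-∧ {true} {true} _ = _ , _

  isZero-value : ∀ {n} (P : Normal n) → Bool.T (isZero P) → ∀ ρ → value P ρ ≈ 0#
  isZero-value {zero} (a , b) a≡b [] =
    trans (+-congʳ (reflexive (≡.cong (_· 1#) (ℕₚ.≡ᵇ⇒≡ a b a≡b)))) (-‿inverseʳ _)
  isZero-value {suc n} []      _  (x ∷ ρ) = refl
  isZero-value {suc n} (p ∷ P) p0 (x ∷ ρ) = begin
    value p ρ + x * value {suc n} P (x ∷ ρ)
      ≈⟨ +-cong (isZero-value p (proj₁ (T-∧ p0)) ρ)
                (*-congˡ (isZero-value {suc n} P (proj₂ (T-∧ {isZero p} p0)) (x ∷ ρ))) ⟩
    0# + x * 0# ≈⟨ +-identityˡ _ ⟩
    x * 0#      ≈⟨ zeroʳ x ⟩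
    0#          ∎

  opaque
    identity : ∀ {n} e f → Bool.T (isZero {n} (normalise (e ⊖ f))) → (ρ : Vec Carrier n) → ⟦ e ⟧ ρ ≈ ⟦ f ⟧ ρ
    identity {n} e f e≡f ρ = x∙y⁻¹≈ε⇒x≈y _ _
      (trans (sym (normalise-value (e ⊖ f) ρ)) (isZero-value {n} (normalise (e ⊖ f)) e≡f ρ))

  private
    ∀ⁿ-curry : ∀ n {P : Vec Carrier n → Set ℓ} → (∀ ρ → P ρ) → ∀ⁿ n (curryⁿ P)
    ∀ⁿ-curry zero    f = f []
    ∀ⁿ-curry (suc n) f x = ∀ⁿ-curry n (λ ρ → f (x ∷ ρ))

  infix 4 _⊜_
  _⊜_ : Expr → Expr → Expr × Expr
  _⊜_ = _,_

  solve : ∀ n (f : N-ary n Expr (Expr × Expr)) →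
    let e₁ = proj₁ (f $ⁿ vars n); e₂ = proj₂ (f $ⁿ vars n) in
    {Bool.T (isZero {n} (normalise (e₁ ⊖ e₂)))} →
    ∀ⁿ n (curryⁿ {n = n} λ ρ → ⟦ e₁ ⟧ ρ ≈ ⟦ e₂ ⟧ ρ)
  solve n f {p} = ∀ⁿ-curry n (identity (proj₁ (f $ⁿ vars n)) (proj₂ (f $ⁿ vars n)) p)

  ⟦⟧-cong : ∀ {n} e {ρ ρ′ : Vec Carrier n} → (∀ i → ρ ! i ≈ ρ′ ! i) → ⟦ e ⟧ ρ ≈ ⟦ e ⟧ ρ′
  ⟦⟧-cong (var i) ρ≈ρ′ = ρ≈ρ′ i
  ⟦⟧-cong 𝟘       ρ≈ρ′ = refl
  ⟦⟧-cong 𝟙       ρ≈ρ′ = refl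
  ⟦⟧-cong (e ⊕ f) ρ≈ρ′ = +-cong (⟦⟧-cong e ρ≈ρ′) (⟦⟧-cong f ρ≈ρ′)
  ⟦⟧-cong (e ⊗ f) ρ≈ρ′ = *-cong (⟦⟧-cong e ρ≈ρ′) (⟦⟧-cong f ρ≈ρ′)
  ⟦⟧-cong (⊝ e)   ρ≈ρ′ = -‿cong (⟦⟧-cong e ρ≈ρ′)
  ⟦⟧-cong (k ⊙ e) ρ≈ρ′ = ×-congʳ k (⟦⟧-cong e ρ≈ρ′)
  ⟦⟧-cong (e ↑ k) ρ≈ρ′ = ^-cong k (⟦⟧-cong e ρ≈ρ′)

  ⟦⟧-congᵥ : ∀ {n} e {ρ ρ′ : Vec Carrier n} → Pointwise _≈_ ρ ρ′ → ⟦ e ⟧ ρ ≈ ⟦ e ⟧ ρ′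
  ⟦⟧-congᵥ e ρ≈ρ′ = ⟦⟧-cong e (entry ρ≈ρ′)
    where
    entry : ∀ {n} {ρ ρ′ : Vec Carrier n} → Pointwise _≈_ ρ ρ′ → ∀ i → ρ ! i ≈ ρ′ ! i
    entry []        i       = refl
    entry (x≈ ∷ _)  zero    = x≈
    entry (_ ∷ ρ≈)  (suc i) = entry ρ≈ i

  private
    substitute-value : ∀ {m n} (σ : Vec Expr n) e {ρ : Vec Carrier n} {ρ′ : Vec Carrier m} →
      (∀ i → ρ ! i ≈ ⟦ σ ‼ i ⟧ ρ′) → ⟦ e ⟧ ρ ≈ ⟦ substitute σ e ⟧ ρ′
    substitute-value σ (var i) ρ≈ = ρ≈ i
    substitute-value σ 𝟘       ρ≈ = refl
    substitute-value σ 𝟙       ρ≈ = refl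
    substitute-value σ (e ⊕ f) ρ≈ = +-cong (substitute-value σ e ρ≈) (substitute-value σ f ρ≈)
    substitute-value σ (e ⊗ f) ρ≈ = *-cong (substitute-value σ e ρ≈) (substitute-value σ f ρ≈)
    substitute-value σ (⊝ e)   ρ≈ = -‿cong (substitute-value σ e ρ≈)
    substitute-value σ (k ⊙ e) ρ≈ = ×-congʳ k (substitute-value σ e ρ≈)
    substitute-value σ (e ↑ k) ρ≈ = ^-cong k (substitute-value σ e ρ≈)

    lookup-++ : ∀ {m n j} {ρ′ : Vec Carrier m} (ρ : Vec Carrier n) k {defs : Vec Expr j} {values : Vec Carrier j} →
      (∀ i → ρ ! i ≈ ⟦ varsFrom k n ‼ i ⟧ ρ′) → Pointwise (λ x e → x ≈ ⟦ e ⟧ ρ′) values defs →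
      ∀ i → (ρ Vec.++ values) ! i ≈ ⟦ (varsFrom k n Vec.++ defs) ‼ i ⟧ ρ′
    lookup-++ []      k ρ≈ []        i       = refl
    lookup-++ []      k ρ≈ (x≈ ∷ _)  zero    = x≈
    lookup-++ []      k ρ≈ (_ ∷ xs≈) (suc i) = lookup-++ [] k (λ _ → refl) xs≈ i
    lookup-++ (x ∷ ρ) k ρ≈ xs≈       zero    = ρ≈ zero
    lookup-++ (x ∷ ρ) k ρ≈ xs≈       (suc i) = lookup-++ ρ (suc k) (λ i → ρ≈ (suc i)) xs≈ i

    lookup-vars : ∀ {n m} (ρ : Vec Carrier n) k (ρ′ : Vec Carrier m) → (∀ i → ρ ! i ≈ ρ′ ! (k ℕ.+ i)) →
      ∀ i → ρ ! i ≈ ⟦ varsFrom k n ‼ i ⟧ ρ′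
    lookup-vars []      k ρ′ eq i       = refl
    lookup-vars (x ∷ ρ) k ρ′ eq zero    = trans (eq 0) (reflexive (≡.cong (ρ′ !_) (ℕₚ.+-identityʳ k)))
    lookup-vars (x ∷ ρ) k ρ′ eq (suc i) = lookup-vars ρ (suc k) ρ′
      (λ i → trans (eq (suc i)) (reflexive (≡.cong (ρ′ !_) (ℕₚ.+-suc k i)))) i

  opaque
    -- An identity that holds once the last j variables are replaced by the
    -- expressions defs in the first n.
    identity-given : ∀ n {j} (defs : Vec Expr j) e f → let σ = vars n Vec.++ defs in
      Bool.T (isZero {n} (normalise (substitute σ e ⊖ substitute σ f))) →
      (ρ : Vec Carrier n) {values : Vec Carrier j} → Pointwise (λ x e → x ≈ ⟦ e ⟧ ρ) values defs →
      ⟦ e ⟧ (ρ Vec.++ values) ≈ ⟦ f ⟧ (ρ Vec.++ values)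
    identity-given n {j} defs e f e≡f ρ {values} values≈ = trans (substitute-value σ e ρ≈)
      (trans (identity (substitute σ e) (substitute σ f) e≡f ρ) (sym (substitute-value σ f ρ≈)))
      where
      σ : Vec Expr (n ℕ.+ j)
      σ = vars n Vec.++ defs

      ρ≈ : ∀ i → (ρ Vec.++ values) ! i ≈ ⟦ σ ‼ i ⟧ ρ
      ρ≈ = lookup-++ ρ 0 (lookup-vars ρ 0 ρ (λ _ → refl)) values≈

  solve-given : ∀ n {j} (defs : Vec Expr j) (f : N-ary (n ℕ.+ j) Expr (Expr × Expr)) →
    let e₁ = proj₁ (f $ⁿ vars (n ℕ.+ j)); e₂ = proj₂ (f $ⁿ vars (n ℕ.+ j)); σ = vars n Vec.++ defs in
    {Bool.T (isZero {n} (normalise (substitute σ e₁ ⊖ substitute σ e₂)))} →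
    (ρ : Vec Carrier n) {values : Vec Carrier j} → Pointwise (λ x e → x ≈ ⟦ e ⟧ ρ) values defs →
    ⟦ e₁ ⟧ (ρ Vec.++ values) ≈ ⟦ e₂ ⟧ (ρ Vec.++ values)
  solve-given n {j} defs f {p} =
    identity-given n defs (proj₁ (f $ⁿ vars (n ℕ.+ j))) (proj₂ (f $ⁿ vars (n ℕ.+ j))) p

-- Classical field arithmetic

-- Excluded middle is given at one level only; a proposition of lower level is lifted to it.
decide : ∀ {a b} → ExcludedMiddle (a ⊔ b) → (P : Set a) → Dec P
decide {a} {b} em P = Dec.map′ lower lift (em {Lift (a ⊔ b) P})

module FieldProperties {c ℓ₁ ℓ₂ : Level} (em : ExcludedMiddle (c ⊔ ℓ₁ ⊔ ℓ₂)) (K : HeytingField c ℓ₁ ℓ₂) where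
  open HeytingField K hiding (zero)
  open HeytingCommutativeRing heytingCommutativeRing using (commutativeRing) public
  open CommutativeRing commutativeRing using (ring)
  open RingProperties ring using (-0#≈0#)
  open HeytingProperties heytingCommutativeRing using (x-0≈x; 1#0; #-congʳ)
  open FieldDefinitions K
  open RingSolver commutativeRing public

  1≉0 : ¬ 1# ≈ 0#
  1≉0 1≈0 = #-irrefl 1≈0 1#0

  ≉⇒# : ∀ {x y} → ¬ x ≈ y → x # y
  ≉⇒# {x} {y} x≉y with decide {b = c ⊔ ℓ₁} em (x # y)
  ... | yes x#y = x#y
  ... | no ¬x#y = contradiction (proj₁ (tight x y) ¬x#y) x≉y

  #⇒≉ : ∀ {x y} → x # y → ¬ x ≈ y
  #⇒≉ x#y x≈y = #-irrefl x≈y x#y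

  opaque
    zero? : ∀ x → Dec (x ≈ 0#)
    zero? x = decide {b = c ⊔ ℓ₂} em (x ≈ 0#)

    inverse : ∀ {x} → ¬ x ≈ 0# → ∃ λ y → x * y ≈ 1#
    inverse x≉0 = recip (≉⇒# x≉0) , recip-inverseʳ (≉⇒# x≉0)

    -- Certificates for equations under hypotheses: to obtain `l ≈ r` from `x ≈ y`, the solver
    -- checks the identity `l ≈ r + k * (x - y)` for a multiplier k found beforehand, and this lemma
    -- removes the last term.
    absorb : ∀ {r k x y} → x ≈ y → r + k * (x - y) ≈ r
    absorb {r} {k} x≈y =
      trans (+-congˡ (trans (*-congˡ (trans (+-congʳ x≈y) (-‿inverseʳ _))) (zeroʳ k))) (+-identityʳ r)

    absorb₂ : ∀ {r k k′ x y x′ y′} → x ≈ y → x′ ≈ y′ → r + k * (x - y) + k′ * (x′ - y′) ≈ r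
    absorb₂ p q = trans (absorb q) (absorb p)

    absorb₃ : ∀ {r k k′ k″ x y x′ y′ x″ y″} → x ≈ y → x′ ≈ y′ → x″ ≈ y″ →
              r + k * (x - y) + k′ * (x′ - y′) + k″ * (x″ - y″) ≈ r
    absorb₃ p q s = trans (absorb s) (absorb₂ p q)

    *-cancel : ∀ {k x y} → ¬ k ≈ 0# → k * x ≈ k * y → x ≈ y
    *-cancel {k} {x} {y} k≉0 kx≈ky with inverse k≉0
    ... | k⁻¹ , kk⁻¹≈1 = trans
      (solve 4 (λ k k⁻¹ x y → x ⊜ y ⊕ k⁻¹ ⊗ (k ⊗ x ⊖ k ⊗ y) ⊕ (⊝ (x ⊖ y)) ⊗ (k ⊗ k⁻¹ ⊖ 𝟙)) k k⁻¹ x y)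
      (absorb₂ kx≈ky kk⁻¹≈1)

    zero-product : ∀ {x y} → x * y ≈ 0# → ¬ x ≈ 0# → y ≈ 0#
    zero-product {x} xy≈0 x≉0 = *-cancel x≉0 (trans xy≈0 (sym (zeroʳ x)))

    nonzero-* : ∀ {x y} → ¬ x ≈ 0# → ¬ y ≈ 0# → ¬ x * y ≈ 0#
    nonzero-* x≉0 y≉0 xy≈0 = y≉0 (zero-product xy≈0 x≉0)

    zero-square : ∀ {x} → x ^ 2 ≈ 0# → x ≈ 0#
    zero-square {x} x²≈0 with zero? x
    ... | yes x≈0 = x≈0
    ... | no  x≉0 = contradiction
      (trans (solve 1 (λ x → x ⊗ x ⊜ x ↑ 2) x) x²≈0) (nonzero-* x≉0 x≉0)

    divide : ∀ {d} → ¬ d ≈ 0# → ∀ n → ∃ λ x → d * x ≈ n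
    divide {d} d≉0 n with inverse d≉0
    ... | d⁻¹ , dd⁻¹≈1 = d⁻¹ * n ,
      trans (solve 3 (λ d d⁻¹ n → d ⊗ (d⁻¹ ⊗ n) ⊜ n ⊕ n ⊗ (d ⊗ d⁻¹ ⊖ 𝟙)) d d⁻¹ n) (absorb dd⁻¹≈1)

    difference-zero : ∀ {x y} → x - y ≈ 0# → x ≈ y
    difference-zero {x} {y} p = trans (solve 2 (λ x y → x ⊜ y ⊕ 𝟙 ⊗ ((x ⊖ y) ⊖ 𝟘)) x y) (absorb p)

    difference-nonzero : ∀ {x y} → ¬ x ≈ y → ¬ x - y ≈ 0#
    difference-nonzero x≉y p = x≉y (difference-zero p)

    coeff-beyond : ∀ p n → List.length p ℕ.≤ n → coeff p n ≈ 0#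
    coeff-beyond []      n       _         = refl
    coeff-beyond (x ∷ p) (suc n) (ℕ.s≤s p≤n) = coeff-beyond p n p≤n

    eval-+ₚ : ∀ p q t → eval (p +ₚ q) t ≈ eval p t + eval q t
    eval-+ₚ []      q       t = sym (+-identityˡ _)
    eval-+ₚ (x ∷ p) []      t = sym (+-identityʳ _)
    eval-+ₚ (x ∷ p) (y ∷ q) t = trans (+-congˡ (*-congˡ (eval-+ₚ p q t)))
      (solve 5 (λ x y t u v → (x ⊕ y) ⊕ t ⊗ (u ⊕ v) ⊜ (x ⊕ t ⊗ u) ⊕ (y ⊕ t ⊗ v)) x y t (eval p t) (eval q t))

    eval-scale : ∀ k q t → eval (List.map (k *_) q) t ≈ k * eval q t
    eval-scale k []      t = sym (zeroʳ k)
    eval-scale k (x ∷ q) t = trans (+-congˡ (*-congˡ (eval-scale k q t)))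
      (solve 4 (λ k x t u → k ⊗ x ⊕ t ⊗ (k ⊗ u) ⊜ k ⊗ (x ⊕ t ⊗ u)) k x t (eval q t))

    eval-*ₚ : ∀ p q t → eval (p *ₚ q) t ≈ eval p t * eval q t
    eval-*ₚ []      q t = sym (zeroˡ _)
    eval-*ₚ (x ∷ p) q t = trans (eval-+ₚ (List.map (x *_) q) (0# ∷ p *ₚ q) t)
      (trans (+-cong (eval-scale x q t) (+-congˡ (*-congˡ (eval-*ₚ p q t))))
        (solve 4 (λ x u v t → x ⊗ v ⊕ (𝟘 ⊕ t ⊗ (u ⊗ v)) ⊜ (x ⊕ t ⊗ u) ⊗ v) x (eval p t) (eval q t) t))

    eval-neg : ∀ p t → eval (List.map -_ p) t ≈ - eval p t
    eval-neg []      t = sym -0#≈0#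
    eval-neg (x ∷ p) t = trans (+-congˡ (*-congˡ (eval-neg p t)))
      (solve 3 (λ x t u → ⊝ x ⊕ t ⊗ ⊝ u ⊜ ⊝ (x ⊕ t ⊗ u)) x t (eval p t))

-- Evaluation under homomorphisms, and arithmetic of coefficient lists

module Homomorphism {c ℓ₁ ℓ₂ : Level} (K L : HeytingField c ℓ₁ ℓ₂)
  (φ : HeytingField.Carrier K → HeytingField.Carrier L)
  (isHomomorphism : IsRingHomomorphism (FieldDefinitions.rawRing K) (FieldDefinitions.rawRing L) φ) where
  open IsRingHomomorphism isHomomorphism
  private
    module K = HeytingField K
    module L = HeytingField L
    module Kᵈ = FieldDefinitions K
    module Lᵈ = FieldDefinitions L
    module S = RingSolver (HeytingCommutativeRing.commutativeRing K.heytingCommutativeRing)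
    module T = RingSolver (HeytingCommutativeRing.commutativeRing L.heytingCommutativeRing)

  ·-homo : ∀ n x → φ (n Kᵈ.· x) L.≈ n Lᵈ.· φ x
  ·-homo zero    x = 0#-homo
  ·-homo (suc n) x = L.trans (+-homo x _) (L.+-congˡ (·-homo n x))

  ^-homo : ∀ x n → φ (x Kᵈ.^ n) L.≈ φ x Lᵈ.^ n
  ^-homo x zero    = 1#-homo
  ^-homo x (suc n) = L.trans (*-homo x _) (L.*-congˡ (^-homo x n))

  ⟦⟧-homo : ∀ {n} (e : Expr) (ρ : Vec K.Carrier n) → φ (S.⟦ e ⟧ ρ) L.≈ T.⟦ e ⟧ (Vec.map φ ρ)
  ⟦⟧-homo (var i) ρ = go ρ i
    where
    go : ∀ {n} (ρ : Vec K.Carrier n) i → φ (ρ S.! i) L.≈ Vec.map φ ρ T.! i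
    go []      i       = 0#-homo
    go (x ∷ ρ) zero    = L.refl
    go (x ∷ ρ) (suc i) = go ρ i
  ⟦⟧-homo 𝟘       ρ = 0#-homo
  ⟦⟧-homo 𝟙       ρ = 1#-homo
  ⟦⟧-homo (e ⊕ f) ρ = L.trans (+-homo _ _) (L.+-cong (⟦⟧-homo e ρ) (⟦⟧-homo f ρ))
  ⟦⟧-homo (e ⊗ f) ρ = L.trans (*-homo _ _) (L.*-cong (⟦⟧-homo e ρ) (⟦⟧-homo f ρ))
  ⟦⟧-homo (⊝ e)   ρ = L.trans (-‿homo _) (L.-‿cong (⟦⟧-homo e ρ))
  ⟦⟧-homo (k ⊙ e) ρ = L.trans (·-homo k _) (·-cong k (⟦⟧-homo e ρ))
    where
    ·-cong : ∀ n {x y} → x L.≈ y → n Lᵈ.· x L.≈ n Lᵈ.· y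
    ·-cong zero    x≈y = L.refl
    ·-cong (suc n) x≈y = L.+-cong x≈y (·-cong n x≈y)
  ⟦⟧-homo (e ↑ k) ρ = L.trans (^-homo _ k) (T.^-cong k (⟦⟧-homo e ρ))

infixl 6 _⊕ₚ_
infixl 7 _⊗ₚ_

_⊕ₚ_ : List Expr → List Expr → List Expr
[]      ⊕ₚ Q       = Q
(e ∷ P) ⊕ₚ []      = e ∷ P
(e ∷ P) ⊕ₚ (f ∷ Q) = e ⊕ f ∷ P ⊕ₚ Q

_⊗ₚ_ : List Expr → List Expr → List Expr
[]      ⊗ₚ Q = []
(e ∷ P) ⊗ₚ Q = List.map (e ⊗_) Q ⊕ₚ (𝟘 ∷ P ⊗ₚ Q)

equalₚ : ∀ m {n} → Vec Expr n → List Expr → List Expr → Bool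
equalₚ m σ []      []      = true
equalₚ m σ []      (f ∷ Q) = isZero {m} (normalise (𝟘 ⊖ substitute σ f)) ∧ equalₚ m σ [] Q
equalₚ m σ (e ∷ P) []      = isZero {m} (normalise (substitute σ e ⊖ 𝟘)) ∧ equalₚ m σ P []
equalₚ m σ (e ∷ P) (f ∷ Q) = isZero {m} (normalise (substitute σ e ⊖ substitute σ f)) ∧ equalₚ m σ P Q

module Polynomial {c ℓ₁ ℓ₂ : Level} (em : ExcludedMiddle (c ⊔ ℓ₁ ⊔ ℓ₂)) (K : HeytingField c ℓ₁ ℓ₂) where
  open HeytingField K hiding (zero)
  open FieldDefinitions K
  open FieldProperties em K

  ⟦_⟧ₚ : ∀ {n} → List Expr → Vec Carrier n → Poly
  ⟦ P ⟧ₚ ρ = List.map (λ e → ⟦ e ⟧ ρ) P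

  private
    ∧-split : ∀ {a b} → Bool.T (a ∧ b) → Bool.T a × Bool.T b
    ∧-split {true} {true} _ = _ , _

  solveₚ : ∀ {m j} (defs : Vec Expr j) (P Q : List Expr) →
    {Bool.T (equalₚ m (vars m Vec.++ defs) P Q)} →
    (ρ : Vec Carrier m) {values : Vec Carrier j} → Pointwise (λ x e → x ≈ ⟦ e ⟧ ρ) values defs →
    ⟦ P ⟧ₚ (ρ Vec.++ values) ≈ₚ ⟦ Q ⟧ₚ (ρ Vec.++ values)
  solveₚ {m} {j} defs P Q {p} ρ {values} values≈ = go P Q p
    where
    σ : Vec Expr (m ℕ.+ j)
    σ = vars m Vec.++ defs

    step : ∀ e f → Bool.T (isZero {m} (normalise (substitute σ e ⊖ substitute σ f))) →
      ⟦ e ⟧ (ρ Vec.++ values) ≈ ⟦ f ⟧ (ρ Vec.++ values)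
    step e f p = identity-given m defs e f p ρ values≈

    go : ∀ P Q → Bool.T (equalₚ m σ P Q) → ⟦ P ⟧ₚ (ρ Vec.++ values) ≈ₚ ⟦ Q ⟧ₚ (ρ Vec.++ values)
    go []      []      _ n       = refl
    go []      (f ∷ Q) p zero    = step 𝟘 f (proj₁ (∧-split p))
    go []      (f ∷ Q) p (suc n) = go [] Q (proj₂ (∧-split {isZero {m} (normalise (𝟘 ⊖ substitute σ f))} p)) n
    go (e ∷ P) []      p zero    = step e 𝟘 (proj₁ (∧-split p))
    go (e ∷ P) []      p (suc n) = go P [] (proj₂ (∧-split {isZero {m} (normalise (substitute σ e ⊖ 𝟘))} p)) n
    go (e ∷ P) (f ∷ Q) p zero    = step e f (proj₁ (∧-split p))
    go (e ∷ P) (f ∷ Q) p (suc n) =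
      go P Q (proj₂ (∧-split {isZero {m} (normalise (substitute σ e ⊖ substitute σ f))} p)) n

  Zeroₚ : Poly → Set ℓ₁
  Zeroₚ p = ∀ n → coeff p n ≈ 0#

  Degree : Poly → ℕ → Set ℓ₁
  Degree p d = ¬ coeff p d ≈ 0# × (∀ n → d ℕ.< n → coeff p n ≈ 0#)

  degree : ∀ p → Zeroₚ p ⊎ ∃ (Degree p)
  degree [] = inj₁ λ _ → refl
  degree (x ∷ p) with degree p
  ... | inj₂ (d , p_d≉0 , p>d) = inj₂ (suc d , p_d≉0 , λ { (suc n) (s≤s d<n) → p>d n d<n })
  ... | inj₁ p≈0 with zero? x
  ...   | yes x≈0 = inj₁ λ { zero → x≈0 ; (suc n) → p≈0 n }
  ...   | no  x≉0 = inj₂ (0 , x≉0 , λ { (suc n) _ → p≈0 n })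

  coeff-+ₚ : ∀ p q n → coeff (p +ₚ q) n ≈ coeff p n + coeff q n
  coeff-+ₚ []      q       n       = sym (+-identityˡ _)
  coeff-+ₚ (x ∷ p) []      n       = sym (+-identityʳ _)
  coeff-+ₚ (x ∷ p) (y ∷ q) zero    = refl
  coeff-+ₚ (x ∷ p) (y ∷ q) (suc n) = coeff-+ₚ p q n

  coeff-scale : ∀ k q n → coeff (List.map (k *_) q) n ≈ k * coeff q n
  coeff-scale k []      n       = sym (zeroʳ k)
  coeff-scale k (x ∷ q) zero    = refl
  coeff-scale k (x ∷ q) (suc n) = coeff-scale k q n

  coeff-*ₚ : ∀ x p q n → coeff ((x ∷ p) *ₚ q) n ≈ x * coeff q n + coeff (0# ∷ p *ₚ q) n
  coeff-*ₚ x p q n = trans (coeff-+ₚ (List.map (x *_) q) _ n) (+-congʳ (coeff-scale x q n))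

  zero-*ₚ : ∀ p q → Zeroₚ p → Zeroₚ (p *ₚ q)
  zero-*ₚ []      q p≈0 n = refl
  zero-*ₚ (x ∷ p) q p≈0 n = trans (coeff-*ₚ x p q n)
    (trans (+-cong (trans (*-congʳ (p≈0 0)) (zeroˡ _)) (shifted n)) (+-identityˡ 0#))
    where
    shifted : ∀ n → coeff (0# ∷ p *ₚ q) n ≈ 0#
    shifted zero    = refl
    shifted (suc n) = zero-*ₚ p q (p≈0 ∘ suc) n

  leading-*ₚ : ∀ p q d e → (∀ n → d ℕ.< n → coeff p n ≈ 0#) → (∀ n → e ℕ.< n → coeff q n ≈ 0#) →
    coeff (p *ₚ q) (d ℕ.+ e) ≈ coeff p d * coeff q e
  leading-*ₚ []      q d e p>d q>e = sym (zeroˡ _)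
  leading-*ₚ (x ∷ p) q zero e p>d q>e = trans (coeff-*ₚ x p q e)
    (trans (+-congˡ (shifted e)) (+-identityʳ _))
    where
    shifted : ∀ n → coeff (0# ∷ p *ₚ q) n ≈ 0#
    shifted zero    = refl
    shifted (suc n) = zero-*ₚ p q (λ m → p>d (suc m) (s≤s z≤n)) n
  leading-*ₚ (x ∷ p) q (suc d) e p>d q>e = trans (coeff-*ₚ x p q (suc d ℕ.+ e))
    (trans (+-cong (trans (*-congˡ (q>e _ (s≤s (ℕₚ.m≤n+m e d)))) (zeroʳ x))
                   (leading-*ₚ p q d e (λ n d<n → p>d (suc n) (s≤s d<n)) q>e))
      (+-identityˡ _))

  *ₚ-zero : ∀ p q → Zeroₚ q → Zeroₚ (p *ₚ q)
  *ₚ-zero []      q q≈0 n = refl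
  *ₚ-zero (x ∷ p) q q≈0 n = trans (coeff-*ₚ x p q n)
    (trans (+-cong (trans (*-congˡ (q≈0 n)) (zeroʳ x)) (shifted n)) (+-identityˡ 0#))
    where
    shifted : ∀ n → coeff (0# ∷ p *ₚ q) n ≈ 0#
    shifted zero    = refl
    shifted (suc n) = *ₚ-zero p q q≈0 n

  constant-unit : ∀ p → Degree p 0 → p ∣ₚ (1# ∷ [])
  constant-unit []      (p₀≉0 , _) = contradiction refl p₀≉0
  constant-unit (x ∷ p) (x≉0 , p>0) with inverse x≉0
  ... | x⁻¹ , xx⁻¹≈1 = (x⁻¹ ∷ []) RawMagma., equal
    where
    shifted : ∀ n → coeff (0# ∷ []) n ≈ 0#
    shifted zero    = refl
    shifted (suc n) = refl

    equal : (x⁻¹ ∷ []) *ₚ (x ∷ p) ≈ₚ 1# ∷ []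
    equal zero    = trans (coeff-*ₚ x⁻¹ [] (x ∷ p) 0) (trans (+-identityʳ _) (trans (*-comm x⁻¹ x) xx⁻¹≈1))
    equal (suc n) = trans (coeff-*ₚ x⁻¹ [] (x ∷ p) (suc n))
      (trans (+-cong (trans (*-congˡ (p>0 (suc n) (s≤s z≤n))) (zeroʳ x⁻¹)) (shifted (suc n))) (+-identityˡ 0#))

-- Identities in groups isomorphic to the symmetric and cyclic ones

module Isomorphism {c ℓ c′ ℓ′ : Level} {G : Group c ℓ} {H : Group c′ ℓ′} (iso : G ≅ H) where
  private
    module G = Group G
    module H = Group H
    φ = proj₁ iso
  open IsGroupIsomorphism (proj₂ iso) public using (injective; surjective; isGroupHomomorphism)
  open IsGroupHomomorphism isGroupHomomorphism public using (homo; ε-homo; ⟦⟧-cong)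

  -- An identity valid for all elements passes along a surjective homomorphism. The use is
  -- contrapositive: one element of the model group that violates it refutes it for the
  -- automorphisms.
  square-trivial : (∀ s → s G.∙ s G.≈ G.ε) → ∀ t → t H.∙ t H.≈ H.ε
  square-trivial trivial t with surjective t
  ... | s , φs≈t = H.trans (H.sym (H.trans (homo s s) (H.∙-cong (φs≈t G.refl) (φs≈t G.refl))))
    (H.trans (⟦⟧-cong (trivial s)) ε-homo)

  cube-trivial : (∀ s → s G.∙ (s G.∙ s) G.≈ G.ε) → ∀ t → t H.∙ (t H.∙ t) H.≈ H.ε
  cube-trivial trivial t with surjective t
  ... | s , φs≈t = H.trans
    (H.sym (H.trans (homo s (s G.∙ s)) (H.∙-cong (φs≈t G.refl)
      (H.trans (homo s s) (H.∙-cong (φs≈t G.refl) (φs≈t G.refl))))))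
    (H.trans (⟦⟧-cong (trivial s)) ε-homo)

  trivial : (∀ s → s G.≈ G.ε) → ∀ t → t H.≈ H.ε
  trivial s≈ε t with surjective t
  ... | s , φs≈t = H.trans (H.sym (φs≈t G.refl)) (H.trans (⟦⟧-cong (s≈ε s)) ε-homo)

  reflects-ε : ∀ {s} → φ s H.≈ H.ε → s G.≈ G.ε
  reflects-ε φs≈ε = injective (H.trans φs≈ε (H.sym ε-homo))

  commutative : (∀ s t → s H.∙ t H.≈ t H.∙ s) → ∀ s t → s G.∙ t G.≈ t G.∙ s
  commutative comm s t = injective (H.trans (homo s t) (H.trans (comm (φ s) (φ t)) (H.sym (homo t s))))

module C-properties (n : ℕ) where
  open Group (C n) public

  comm : ∀ s t → s ∙ t ≈ t ∙ s
  comm s t = ≡.subst (λ u → s ∙ t ≈ u) (ℤₚ.+-comm s t) (refl {s ∙ t})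

1≉0-C₂ : ¬ Group._≈_ (C 2) (+ 1) (+ 0)
1≉0-C₂ 2∣1 = contradiction (ℤ∣.∣⇒∣ᵤ 2∣1) (λ 2∣1 → toWitnessFalse {a? = 2 ℕ∣.∣? 1} _ 2∣1)

1+1≉0-C₃ : ¬ Group._≈_ (C 3) (+ 1 ℤ.+ + 1) (+ 0)
1+1≉0-C₃ 3∣2 = contradiction (ℤ∣.∣⇒∣ᵤ 3∣2) (λ 3∣2 → toWitnessFalse {a? = 3 ℕ∣.∣? 2} _ 3∣2)

square-trivial-C₂ : ∀ t → Group._≈_ (C 2) (t ℤ.+ t) (+ 0)
square-trivial-C₂ t = ℤ∣.divides t (solve 1 (λ t → t :+ t :- con (+ 0) := t :* con (+ 2)) ≡.refl t)
  where open ℤSolver.+-*-Solver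

-- If 3 divides `2t`, it divides `3t - 2t`.
no-involution-C₃ : ∀ t → Group._≈_ (C 3) (t ℤ.+ t) (+ 0) → Group._≈_ (C 3) t (+ 0)
no-involution-C₃ t 3∣2t = ≡.subst (+ 3 ∣_)
  (solve 1 (λ t → t :* con (+ 3) :- (t :+ t :- con (+ 0)) := t :- con (+ 0)) ≡.refl t)
  (∣m∣n⇒∣m-n (divides t ≡.refl) 3∣2t)
  where
  open ℤSolver.+-*-Solver
  open ℤ∣

module _ {c ℓ : Level} {G : Group c ℓ} where
  open Group G

  square∧cube-trivial : (∀ s → s ∙ s ≈ ε) → (∀ s → s ∙ (s ∙ s) ≈ ε) → ∀ s → s ≈ ε
  square∧cube-trivial s²≈ε s³≈ε s = trans (sym (identityʳ s)) (trans (∙-congˡ (sym (s²≈ε s))) (s³≈ε s))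

  C₂-square-trivial : G ≅ C 2 → ∀ s → s ∙ s ≈ ε
  C₂-square-trivial iso s = I.reflects-ε (H.trans {φ (s ∙ s)} {φ s ℤ.+ φ s} {+ 0} (I.homo s s) (square-trivial-C₂ (φ s)))
    where
    module I = Isomorphism {G = G} {H = C 2} iso
    module H = Group (C 2)
    φ = proj₁ iso

  C₃-no-involution : G ≅ C 3 → ∀ s → s ∙ s ≈ ε → s ≈ ε
  C₃-no-involution iso s s²≈ε = I.reflects-ε (no-involution-C₃ (φ s)
    (H.trans {φ s ℤ.+ φ s} {φ (s ∙ s)} {+ 0} (H.sym {φ (s ∙ s)} {φ s ℤ.+ φ s} (I.homo s s))
      (H.trans {φ (s ∙ s)} {φ ε} {+ 0} (I.⟦⟧-cong s²≈ε) I.ε-homo)))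
    where
    module I = Isomorphism {G = G} {H = C 3} iso
    module H = Group (C 3)
    φ = proj₁ iso

transposition 3-cycle : Perm.Permutation′ 3
transposition = Perm.transpose zero (suc zero)
3-cycle = transposition Perm.∘ₚ Perm.transpose (suc zero) (suc (suc zero))

transposition³≉ε : ¬ Group._≈_ (𝔖 3) (transposition Perm.∘ₚ (transposition Perm.∘ₚ transposition)) Perm.id
transposition³≉ε p with p zero
... | ()

3-cycle²≉ε : ¬ Group._≈_ (𝔖 3) (3-cycle Perm.∘ₚ 3-cycle) Perm.id
3-cycle²≉ε p with p zero
... | ()

-- The element 3 in the fields involved

module _ {c ℓ₁ ℓ₂ : Level} (em : ExcludedMiddle (c ⊔ ℓ₁ ⊔ ℓ₂)) (k : HeytingField c ℓ₁ ℓ₂) where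
  open HeytingField k hiding (zero)
  open FieldDefinitions k
  open FieldProperties em k

  -- Turns the excluded characteristic into the usable inequality `3 ≉ 0`. The descent on n goes by
  -- steps of 3, and the remainders 1 and 2 would each give `1 ≈ 0`.
  Characteristic-3 : 3 · 1# ≈ 0# → Characteristic 3
  Characteristic-3 3≈0 n = mk⇔ (to n) from
    where
    from : ∀ {n} → 3 ℕ∣.∣ n → n · 1# ≈ 0#
    from (ℕ∣.divides q ≡.refl) = trans
      (SemiringMult.×1-homo-* (CommutativeRing.semiring commutativeRing) q 3) (trans (*-congˡ 3≈0) (zeroʳ _))

    to : ∀ n → n · 1# ≈ 0# → 3 ℕ∣.∣ n
    to 0 _ = ℕ∣._∣0 3
    to 1 1≈0 = contradiction (trans (solve 0 (𝟙 ⊜ 1 ⊙ 𝟙)) 1≈0) 1≉0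
    to 2 2≈0 = contradiction (trans
      (solve 0 (𝟙 ⊜ 𝟘 ⊕ 𝟙 ⊗ (3 ⊙ 𝟙 ⊖ 𝟘) ⊕ (⊝ 𝟙) ⊗ (2 ⊙ 𝟙 ⊖ 𝟘))) (absorb₂ 3≈0 2≈0)) 1≉0
    to (suc (suc (suc n))) n+3≈0 = ℕ∣.∣m∣n⇒∣m+n ℕ∣.∣-refl (to n (trans
      (solve 1 (λ x → x ⊜ 𝟘 ⊕ 𝟙 ⊗ ((𝟙 ⊕ (𝟙 ⊕ (𝟙 ⊕ x))) ⊖ 𝟘) ⊕ (⊝ 𝟙) ⊗ (3 ⊙ 𝟙 ⊖ 𝟘)) (n · 1#)) (absorb₂ n+3≈0 3≈0)))

module _ {c ℓ₁ ℓ₂ : Level} (k M : HeytingField c ℓ₁ ℓ₂) where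
  private
    module k = HeytingField k
    module M = HeytingField M
    module kᵈ = FieldDefinitions k
    module Mᵈ = FieldDefinitions M

  extension-3≉0 : ∀ κ → IsExtension k M κ → ¬ 3 kᵈ.· k.1# k.≈ k.0# → ¬ 3 Mᵈ.· M.1# M.≈ M.0#
  extension-3≉0 κ extension 3≉0 3≈0 = 3≉0 (injective (M.trans
    (Homomorphism.·-homo k M κ isRingHomomorphism 3 k.1#)
    (M.trans (SemiringMult.×-congʳ (CommutativeRing.semiring (HeytingCommutativeRing.commutativeRing M.heytingCommutativeRing)) 3 1#-homo)
      (M.trans 3≈0 (M.sym 0#-homo)))))
    where open IsRingMonomorphism extension

-- Fields between M and its algebraic closure

module Extension {c ℓ₁ ℓ₂ : Level} (em : ExcludedMiddle (c ⊔ ℓ₁ ⊔ ℓ₂)) (M : HeytingField c ℓ₁ ℓ₂)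
                 (closure : AlgebraicClosure M) where
  open VecAll.All
  open AlgebraicClosure closure public
  open HeytingField Ω public hiding (zero)
  open InClosure M closure public
  module M = HeytingField M
  module Mᵈ = FieldDefinitions M
  module Mᵖ = FieldProperties em M
  open FieldDefinitions Ω public
    using (eval; coeff; _^_; _·_; _+ₚ_; _*ₚ_; Poly; HasDegree)
  open FieldProperties em Ω public
  open IsRingMonomorphism isExtension public
    using ()
    renaming (isRingHomomorphism to ι-isRingHomomorphism; injective to ι-injective;
              ⟦⟧-cong to ι-cong; +-homo to ι-+; *-homo to ι-*; -‿homo to ι-neg;
              0#-homo to ι-0; 1#-homo to ι-1)
  open Homomorphism M Ω ι ι-isRingHomomorphism public
    using () renaming (⟦⟧-homo to ι-⟦⟧; ·-homo to ι-·; ^-homo to ι-^)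

  ι-nonzero : ∀ {m} → ¬ m M.≈ M.0# → ¬ ι m ≈ 0#
  ι-nonzero m≉0 ιm≈0 = m≉0 (ι-injective (trans ιm≈0 (sym ι-0)))

  opaque
    holds? : (P : Set (c ⊔ ℓ₁)) → Dec P
    holds? = decide {b = ℓ₂} em

  record Intermediate : Set (Level.suc (c ⊔ ℓ₁)) where
    field
      subfield : Subfield
      base⊆    : base ⊆ Member subfield
    open Subfield subfield public renaming (Member to Contains; resp to ∈-resp)

  open Intermediate public using (∈-resp; base⊆)

  infix 4 _∈_ _∉_
  _∈_ _∉_ : Carrier → Intermediate → Set (c ⊔ ℓ₁)
  x ∈ E = Intermediate.Contains E x
  x ∉ E = ¬ x ∈ E

  infix 4 _⊑_
  _⊑_ : Intermediate → Intermediate → Set (c ⊔ ℓ₁)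
  E ⊑ E′ = ∀ {x} → x ∈ E → x ∈ E′

  private
    lookupAll : ∀ {n} E {ρ : Vec Carrier n} i → VecAll.All (_∈ E) ρ → ρ ! i ∈ E
    lookupAll E i       VecAll.[]      = Intermediate.0-closed E
    lookupAll E zero    (x VecAll.∷ _) = x
    lookupAll E (suc i) (_ VecAll.∷ ρ) = lookupAll E i ρ

  ⟦_⟧-∈ : ∀ {n} (e : Expr) E {ρ : Vec Carrier n} → VecAll.All (_∈ E) ρ → ⟦ e ⟧ ρ ∈ E
  ⟦ var i ⟧-∈ E ρ∈E = lookupAll E i ρ∈E
  ⟦ 𝟘 ⟧-∈     E ρ∈E = Intermediate.0-closed E
  ⟦ 𝟙 ⟧-∈     E ρ∈E = Intermediate.1-closed E
  ⟦ e ⊕ f ⟧-∈ E ρ∈E = Intermediate.+-closed E (⟦ e ⟧-∈ E ρ∈E) (⟦ f ⟧-∈ E ρ∈E)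
  ⟦ e ⊗ f ⟧-∈ E ρ∈E = Intermediate.*-closed E (⟦ e ⟧-∈ E ρ∈E) (⟦ f ⟧-∈ E ρ∈E)
  ⟦ ⊝ e ⟧-∈   E ρ∈E = Intermediate.-‿closed E (⟦ e ⟧-∈ E ρ∈E)
  ⟦ k ⊙ e ⟧-∈ E {ρ} ρ∈E = go k
    where
    go : ∀ k → k · ⟦ e ⟧ ρ ∈ E
    go zero    = Intermediate.0-closed E
    go (suc k) = Intermediate.+-closed E (⟦ e ⟧-∈ E ρ∈E) (go k)
  ⟦ e ↑ k ⟧-∈ E {ρ} ρ∈E = go k
    where
    go : ∀ k → ⟦ e ⟧ ρ ^ k ∈ E
    go zero    = Intermediate.1-closed E
    go (suc k) = Intermediate.*-closed E (⟦ e ⟧-∈ E ρ∈E) (go k)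

  closed : ∀ E n (f : N-ary n Expr Expr) {ρ : Vec Carrier n} → VecAll.All (_∈ E) ρ → ⟦ f $ⁿ vars n ⟧ ρ ∈ E
  closed E n f = ⟦ f $ⁿ vars n ⟧-∈ E

  quotient-∈ : ∀ E {d n x} → ¬ d ≈ 0# → d * x ≈ n → d ∈ E → n ∈ E → x ∈ E
  quotient-∈ E {d} {n} {x} d≉0 dx≈n d∈E n∈E with inverse d≉0
  ... | d⁻¹ , dd⁻¹≈1 = ∈-resp E
    (trans (solve 4 (λ d d⁻¹ n x → n ⊗ d⁻¹ ⊜ x ⊕ (⊝ d⁻¹) ⊗ (d ⊗ x ⊖ n) ⊕ x ⊗ (d ⊗ d⁻¹ ⊖ 𝟙)) d d⁻¹ n x)
           (absorb₂ dx≈n dd⁻¹≈1))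
    (Intermediate.*-closed E n∈E (Intermediate.inverse-closed E d∈E dd⁻¹≈1))

  solution-∈ : ∀ E {k r} x → ¬ k ≈ 0# → r + k * x ≈ 0# → k ∈ E → r ∈ E → x ∈ E
  solution-∈ E {k} {r} x k≉0 r+kx≈0 k∈E r∈E = quotient-∈ E k≉0
    (trans (solve 3 (λ k r x → k ⊗ x ⊜ ⊝ r ⊕ 𝟙 ⊗ ((r ⊕ k ⊗ x) ⊖ 𝟘)) k r x) (absorb r+kx≈0))
    k∈E (Intermediate.-‿closed E r∈E)

  eval-∈ : ∀ E {p t} → All (_∈ E) p → t ∈ E → eval p t ∈ E
  eval-∈ E []        t∈E = Intermediate.0-closed E
  eval-∈ E (x∈E ∷ p) t∈E = Intermediate.+-closed E x∈E (Intermediate.*-closed E t∈E (eval-∈ E p t∈E))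

  -- A ring between M and its algebraic closure is a field: the inverse of x
  -- is a polynomial in x, by an algebraic equation with non-zero constant term.
  module _ (P : Subset) (P-resp : ∀ {x y} → x ≈ y → P x → P y) (base⊆P : base ⊆ P)
           (P-+ : ∀ {x y} → P x → P y → P (x + y)) (P-* : ∀ {x y} → P x → P y → P (x * y))
           (P-neg : ∀ {x} → P x → P (- x)) where
    private
      eval-P : ∀ p {x} → P x → P (eval (List.map ι p) x)
      eval-P []      Px = base⊆P (M.0# , ι-0)
      eval-P (m ∷ p) Px = P-+ (base⊆P (m , refl)) (P-* Px (eval-P p Px))

      inverse-P : ∀ p n → ¬ Mᵈ.coeff p n M.≈ M.0# → ∀ {x} → P x → ¬ x ≈ 0# →
                  eval (List.map ι p) x ≈ 0# → ∃ λ y → P y × x * y ≈ 1#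
      inverse-P []      n pₙ≉0 Px x≉0 px≈0 = contradiction M.refl pₙ≉0
      inverse-P (m ∷ p) n pₙ≉0 {x} Px x≉0 px≈0 with Mᵖ.zero? m
      inverse-P (m ∷ p) zero    pₙ≉0 Px x≉0 px≈0 | yes m≈0 = contradiction m≈0 pₙ≉0
      inverse-P (m ∷ p) (suc n) pₙ≉0 Px x≉0 px≈0 | yes m≈0 = inverse-P p n pₙ≉0 Px x≉0
        (zero-product (trans (sym (trans (+-congʳ (trans (ι-cong m≈0) ι-0)) (+-identityˡ _))) px≈0) x≉0)
      inverse-P (m ∷ p) n pₙ≉0 {x} Px x≉0 px≈0 | no m≉0 with Mᵖ.inverse m≉0
      ... | m⁻¹ , mm⁻¹≈1 = - (ι m⁻¹ * eval (List.map ι p) x) ,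
        P-neg (P-* (base⊆P (m⁻¹ , refl)) (eval-P p Px)) ,
        trans (solve 4 (λ x i m e → x ⊗ (⊝ (i ⊗ e)) ⊜
                         𝟙 ⊕ (⊝ i) ⊗ ((m ⊕ x ⊗ e) ⊖ 𝟘) ⊕ 𝟙 ⊗ (m ⊗ i ⊖ 𝟙))
                x (ι m⁻¹) (ι m) (eval (List.map ι p) x))
              (absorb₂ px≈0 (trans (sym (ι-* m m⁻¹)) (trans (ι-cong mm⁻¹≈1) ι-1)))

    intermediate : Intermediate
    intermediate = record
      { subfield = record
        { Member   = P
        ; resp     = P-resp
        ; 0-closed = base⊆P (M.0# , ι-0)
        ; 1-closed = base⊆P (M.1# , ι-1)
        ; +-closed = P-+
        ; *-closed = P-*
        ; -‿closed = P-neg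
        ; inverse-closed = inverse-closed-P
        }
      ; base⊆ = base⊆P
      }
      where
      inverse-closed-P : ∀ {x y} → P x → x * y ≈ 1# → P y
      inverse-closed-P {x} {y} Px xy≈1 with algebraic x
      ... | p , n , (pₙ#0 , _) , px≈0
        with inverse-P p n (Mᵖ.#⇒≉ pₙ#0) Px x≉0 px≈0
        where
        x≉0 : ¬ x ≈ 0#
        x≉0 x≈0 = 1≉0 (trans (sym xy≈1) (trans (*-congʳ x≈0) (zeroˡ y)))
      ... | z , Pz , xz≈1 = P-resp
        (trans (solve 3 (λ x y z → z ⊜ y ⊕ (⊝ z) ⊗ (x ⊗ y ⊖ 𝟙) ⊕ y ⊗ (x ⊗ z ⊖ 𝟙)) x y z)
               (absorb₂ xy≈1 xz≈1))
        Pz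

  infixr 7 _∩ᴵ_
  _∩ᴵ_ : Intermediate → Intermediate → Intermediate
  E ∩ᴵ E′ = intermediate (λ x → x ∈ E × x ∈ E′)
    (λ x≈y (p , q) → ∈-resp E x≈y p , ∈-resp E′ x≈y q)
    (λ m → base⊆ E m , base⊆ E′ m)
    (λ (p , q) (p′ , q′) → Intermediate.+-closed E p p′ , Intermediate.+-closed E′ q q′)
    (λ (p , q) (p′ , q′) → Intermediate.*-closed E p p′ , Intermediate.*-closed E′ q q′)
    (λ (p , q) → Intermediate.-‿closed E p , Intermediate.-‿closed E′ q)

  base-field : Intermediate
  base-field = intermediate base
    (λ { x≈y (m , ιm≈x) → m , trans ιm≈x x≈y }) id
    (λ { (m , p) (m′ , p′) → m M.+ m′ , trans (ι-+ m m′) (+-cong p p′) })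
    (λ { (m , p) (m′ , p′) → m M.* m′ , trans (ι-* m m′) (*-cong p p′) })
    (λ { (m , p) → M.- m , trans (ι-neg m) (-‿cong p) })

  ι-∈ : ∀ E m → ι m ∈ E
  ι-∈ E m = base⊆ E (m , refl)

  module _ (E : Intermediate) where
    +ₚ-∈ : ∀ {p q} → All (_∈ E) p → All (_∈ E) q → All (_∈ E) (p +ₚ q)
    +ₚ-∈ []        q∈E       = q∈E
    +ₚ-∈ (x ∷ p∈E) []        = x ∷ p∈E
    +ₚ-∈ (x ∷ p∈E) (y ∷ q∈E) = Intermediate.+-closed E x y ∷ +ₚ-∈ p∈E q∈E

    scale-∈ : ∀ {k q} → k ∈ E → All (_∈ E) q → All (_∈ E) (List.map (k *_) q)
    scale-∈ k []        = []
    scale-∈ k (x ∷ q∈E) = Intermediate.*-closed E k x ∷ scale-∈ k q∈E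

    *ₚ-∈ : ∀ {p q} → All (_∈ E) p → All (_∈ E) q → All (_∈ E) (p *ₚ q)
    *ₚ-∈ []        q∈E = []
    *ₚ-∈ (x ∷ p∈E) q∈E = +ₚ-∈ (scale-∈ x q∈E) (Intermediate.0-closed E ∷ *ₚ-∈ p∈E q∈E)

    negₚ-∈ : ∀ {p} → All (_∈ E) p → All (_∈ E) (List.map -_ p)
    negₚ-∈ []        = []
    negₚ-∈ (x ∷ p∈E) = Intermediate.-‿closed E x ∷ negₚ-∈ p∈E

  -- Simple extensions by roots of quadratics and cubics

  infixl 8 _⟨_⟩
  opaque
    -- Since θ is algebraic, the polynomial values at θ already form a field. Membership thus yields
    -- a polynomial that can be reduced, where `Generated` would yield only a derivation.
    _⟨_⟩ : Intermediate → Carrier → Intermediate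
    E ⟨ θ ⟩ = intermediate (λ x → ∃ λ p → All (_∈ E) p × x ≈ eval p θ)
      (λ { x≈y (p , p∈E , x≈p) → p , p∈E , trans (sym x≈y) x≈p })
      (λ { {x} x∈M → x ∷ [] , base⊆ E x∈M ∷ [] , solve 2 (λ x t → x ⊜ x ⊕ t ⊗ 𝟘) x θ })
      (λ { (p , p∈E , x≈p) (q , q∈E , y≈q) →
           p +ₚ q , +ₚ-∈ E p∈E q∈E , trans (+-cong x≈p y≈q) (sym (eval-+ₚ p q θ)) })
      (λ { (p , p∈E , x≈p) (q , q∈E , y≈q) →
           p *ₚ q , *ₚ-∈ E p∈E q∈E , trans (*-cong x≈p y≈q) (sym (eval-*ₚ p q θ)) })
      (λ { (p , p∈E , x≈p) → List.map -_ p , negₚ-∈ E p∈E , trans (-‿cong x≈p) (sym (eval-neg p θ)) })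

    ⟨⟩-elim : ∀ {E θ x} → x ∈ E ⟨ θ ⟩ → ∃ λ p → All (_∈ E) p × x ≈ eval p θ
    ⟨⟩-elim x∈ = x∈

    ⟨⟩-base : ∀ {E θ} → E ⊑ E ⟨ θ ⟩
    ⟨⟩-base {E} {θ} {x} x∈E = x ∷ [] , x∈E ∷ [] , solve 2 (λ x t → x ⊜ x ⊕ t ⊗ 𝟘) x θ

    ⟨⟩-generator : ∀ {E θ} → θ ∈ E ⟨ θ ⟩
    ⟨⟩-generator {E} {θ} = 0# ∷ 1# ∷ [] , Intermediate.0-closed E ∷ Intermediate.1-closed E ∷ [] ,
      solve 1 (λ t → t ⊜ 𝟘 ⊕ t ⊗ (𝟙 ⊕ t ⊗ 𝟘)) θ

  ⟨⟩-least : ∀ {E E′ θ} → E ⊑ E′ → θ ∈ E′ → E ⟨ θ ⟩ ⊑ E′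
  ⟨⟩-least {E′ = E′} E⊑E′ θ∈E′ x∈ with ⟨⟩-elim x∈
  ... | p , p∈E , x≈p = ∈-resp E′ (sym x≈p) (eval-∈ E′ (All.map E⊑E′ p∈E) θ∈E′)

  -- Division by `X² - sX - n` in Horner form. The remainder is chosen before t, so one remainder
  -- serves both conjugate roots.
  quadratic-remainder : ∀ E {s n p} → s ∈ E → n ∈ E → All (_∈ E) p →
    ∃₂ λ u v → u ∈ E × v ∈ E × (∀ t → t ^ 2 ≈ s * t + n → eval p t ≈ u + v * t)
  quadratic-remainder E s∈E n∈E [] = 0# , 0# , Intermediate.0-closed E , Intermediate.0-closed E ,
    λ t _ → solve 1 (λ t → 𝟘 ⊜ 𝟘 ⊕ 𝟘 ⊗ t) t
  quadratic-remainder E {s} {n} {x ∷ p} s∈E n∈E (x∈E ∷ p∈E)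
    with quadratic-remainder E s∈E n∈E p∈E
  ... | u , v , u∈E , v∈E , p≈ = x + v * n , u + v * s ,
    closed E 3 (λ x v n → x ⊕ v ⊗ n) (x∈E ∷ v∈E ∷ n∈E ∷ []) ,
    closed E 3 (λ u v s → u ⊕ v ⊗ s) (u∈E ∷ v∈E ∷ s∈E ∷ []) ,
    λ t t²≈ → trans (+-congˡ (*-congˡ (p≈ t t²≈)))
      (trans (solve 6 (λ x u v s n t → x ⊕ t ⊗ (u ⊕ v ⊗ t) ⊜
                 (x ⊕ v ⊗ n) ⊕ (u ⊕ v ⊗ s) ⊗ t ⊕ v ⊗ (t ↑ 2 ⊖ (s ⊗ t ⊕ n))) x u v s n t)
             (absorb t²≈))
    where open VecAll.All

  cubic : Carrier → Carrier → Carrier → Carrier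
  cubic P Q t = t ^ 3 + P * t + Q

  cubic-remainder : ∀ E {P Q p} → P ∈ E → Q ∈ E → All (_∈ E) p →
    ∃ λ r₀ → ∃₂ λ r₁ r₂ → r₀ ∈ E × r₁ ∈ E × r₂ ∈ E ×
    (∀ t → cubic P Q t ≈ 0# → eval p t ≈ r₀ + r₁ * t + r₂ * t ^ 2)
  cubic-remainder E P∈E Q∈E [] = 0# , 0# , 0# ,
    Intermediate.0-closed E , Intermediate.0-closed E , Intermediate.0-closed E ,
    λ t _ → solve 1 (λ t → 𝟘 ⊜ 𝟘 ⊕ 𝟘 ⊗ t ⊕ 𝟘 ⊗ t ↑ 2) t
  cubic-remainder E {P} {Q} {x ∷ p} P∈E Q∈E (x∈E ∷ p∈E)
    with cubic-remainder E P∈E Q∈E p∈E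
  ... | r₀ , r₁ , r₂ , r₀∈E , r₁∈E , r₂∈E , p≈ = x - r₂ * Q , r₀ - r₂ * P , r₁ ,
    closed E 3 (λ x r Q → x ⊖ r ⊗ Q) (x∈E ∷ r₂∈E ∷ Q∈E ∷ []) ,
    closed E 3 (λ x r Q → x ⊖ r ⊗ Q) (r₀∈E ∷ r₂∈E ∷ P∈E ∷ []) , r₁∈E ,
    λ t t³≈ → trans (+-congˡ (*-congˡ (p≈ t t³≈)))
      (trans (solve 7 (λ x r₀ r₁ r₂ P Q t → x ⊕ t ⊗ (r₀ ⊕ r₁ ⊗ t ⊕ r₂ ⊗ t ↑ 2) ⊜
                 (x ⊖ r₂ ⊗ Q) ⊕ (r₀ ⊖ r₂ ⊗ P) ⊗ t ⊕ r₁ ⊗ t ↑ 2 ⊕ r₂ ⊗ ((t ↑ 3 ⊕ P ⊗ t ⊕ Q) ⊖ 𝟘))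
                 x r₀ r₁ r₂ P Q t)
             (absorb t³≈))
    where open VecAll.All

  NoRoot : Intermediate → Carrier → Carrier → Set (c ⊔ ℓ₁)
  NoRoot E P Q = ∀ r → r ∈ E → ¬ cubic P Q r ≈ 0#

  -- A relation with `r₂ ≉ 0` makes x a root of a monic quadratic over E. Dividing the cubic by it
  -- leaves a linear remainder vanishing at x: either this puts x into E, or it is zero and the
  -- complementary linear factor has its root in E.
  powers-independent : ∀ E {P Q x r₀ r₁ r₂} → P ∈ E → Q ∈ E → NoRoot E P Q → cubic P Q x ≈ 0# →
    r₀ ∈ E → r₁ ∈ E → r₂ ∈ E → r₀ + r₁ * x + r₂ * x ^ 2 ≈ 0# → r₀ ≈ 0# × r₁ ≈ 0# × r₂ ≈ 0#
  powers-independent E {P} {Q} {x} {r₀} {r₁} {r₂} P∈E Q∈E noRoot root r₀∈E r₁∈E r₂∈E relation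
    with zero? r₂
  ... | yes r₂≈0 = r₀≈0 , r₁≈0 , r₂≈0
    where
    linear : r₀ + r₁ * x ≈ 0#
    linear = trans (solve 4 (λ r₀ r₁ r₂ x → r₀ ⊕ r₁ ⊗ x ⊜
      𝟘 ⊕ 𝟙 ⊗ ((r₀ ⊕ r₁ ⊗ x ⊕ r₂ ⊗ x ↑ 2) ⊖ 𝟘) ⊕ (⊝ (x ↑ 2)) ⊗ (r₂ ⊖ 𝟘)) r₀ r₁ r₂ x)
      (absorb₂ relation r₂≈0)

    r₁≈0 : r₁ ≈ 0#
    r₁≈0 with zero? r₁
    ... | yes r₁≈0 = r₁≈0
    ... | no  r₁≉0 = contradiction root (noRoot x (solution-∈ E x r₁≉0 linear r₁∈E r₀∈E))

    r₀≈0 : r₀ ≈ 0#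
    r₀≈0 = trans (solve 3 (λ r₀ r₁ x → r₀ ⊜ 𝟘 ⊕ 𝟙 ⊗ ((r₀ ⊕ r₁ ⊗ x) ⊖ 𝟘) ⊕ (⊝ x) ⊗ (r₁ ⊖ 𝟘)) r₀ r₁ x)
                 (absorb₂ linear r₁≈0)
  ... | no r₂≉0 with divide r₂≉0 (- r₁) | divide r₂≉0 (- r₀)
  ... | s , r₂s≈-r₁ | t , r₂t≈-r₀ = ⊥-elim impossible
    where
    open VecAll.All

    s∈E : s ∈ E
    s∈E = quotient-∈ E r₂≉0 r₂s≈-r₁ r₂∈E (Intermediate.-‿closed E r₁∈E)

    t∈E : t ∈ E
    t∈E = quotient-∈ E r₂≉0 r₂t≈-r₀ r₂∈E (Intermediate.-‿closed E r₀∈E)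

    x²≈ : x ^ 2 ≈ s * x + t
    x²≈ = *-cancel r₂≉0 (trans
      (solve 6 (λ r₀ r₁ r₂ s t x → r₂ ⊗ x ↑ 2 ⊜
          r₂ ⊗ (s ⊗ x ⊕ t) ⊕ 𝟙 ⊗ ((r₀ ⊕ r₁ ⊗ x ⊕ r₂ ⊗ x ↑ 2) ⊖ 𝟘)
            ⊕ (⊝ x) ⊗ (r₂ ⊗ s ⊖ ⊝ r₁) ⊕ (⊝ 𝟙) ⊗ (r₂ ⊗ t ⊖ ⊝ r₀))
        r₀ r₁ r₂ s t x)
      (absorb₃ relation r₂s≈-r₁ r₂t≈-r₀))

    -- The remainder of the cubic modulo X² - sX - t.
    linear : (s * t + Q) + (s ^ 2 + t + P) * x ≈ 0#
    linear = trans
      (solve 5 (λ P Q s t x → (s ⊗ t ⊕ Q) ⊕ (s ↑ 2 ⊕ t ⊕ P) ⊗ x ⊜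
          𝟘 ⊕ 𝟙 ⊗ ((x ↑ 3 ⊕ P ⊗ x ⊕ Q) ⊖ 𝟘) ⊕ (⊝ (x ⊕ s)) ⊗ (x ↑ 2 ⊖ (s ⊗ x ⊕ t))) P Q s t x)
      (absorb₂ root x²≈)

    impossible : _
    impossible with zero? (s ^ 2 + t + P)
    ... | no k≉0 = noRoot x (solution-∈ E x k≉0 linear
            (closed E 3 (λ s t P → s ↑ 2 ⊕ t ⊕ P) (s∈E ∷ t∈E ∷ P∈E ∷ []))
            (closed E 3 (λ s t Q → s ⊗ t ⊕ Q) (s∈E ∷ t∈E ∷ Q∈E ∷ []))) root
    -- The remainder vanishes identically, so `X + s` divides the cubic.
    ... | yes k≈0 = noRoot (- s) (Intermediate.-‿closed E s∈E) (trans
      (solve 5 (λ P Q s t x → (⊝ s) ↑ 3 ⊕ P ⊗ ⊝ s ⊕ Q ⊜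
          𝟘 ⊕ 𝟙 ⊗ (((s ⊗ t ⊕ Q) ⊕ (s ↑ 2 ⊕ t ⊕ P) ⊗ x) ⊖ 𝟘) ⊕ (⊝ (x ⊕ s)) ⊗ ((s ↑ 2 ⊕ t ⊕ P) ⊖ 𝟘))
        P Q s t x)
      (absorb₂ linear k≈0))

  -- Degree at most two: elements of E qualify as well, so no irreducibility has to be carried
  -- along.
  Quadratic : Intermediate → Carrier → Set (c ⊔ ℓ₁)
  Quadratic E η = ∃₂ λ s n → s ∈ E × n ∈ E × η ^ 2 ≈ s * η + n

  Quadratic-⊑ : ∀ {E E′ η} → E ⊑ E′ → Quadratic E η → Quadratic E′ η
  Quadratic-⊑ E⊑E′ (s , n , s∈E , n∈E , η²≈) = s , n , E⊑E′ s∈E , E⊑E′ n∈E , η²≈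

  quadratic-member : ∀ {E η x} → Quadratic E η → x ∈ E ⟨ η ⟩ → ∃₂ λ u v → u ∈ E × v ∈ E × x ≈ u + v * η
  quadratic-member {E} {η} (s , n , s∈E , n∈E , η²≈) x∈ with ⟨⟩-elim x∈
  ... | p , p∈E , x≈p with quadratic-remainder E s∈E n∈E p∈E
  ... | u , v , u∈E , v∈E , p≈ = u , v , u∈E , v∈E , trans x≈p (p≈ η η²≈)

  cubic-member : ∀ {E P Q x y} → P ∈ E → Q ∈ E → cubic P Q x ≈ 0# → y ∈ E ⟨ x ⟩ →
    ∃ λ r₀ → ∃₂ λ r₁ r₂ → r₀ ∈ E × r₁ ∈ E × r₂ ∈ E × y ≈ r₀ + r₁ * x + r₂ * x ^ 2
  cubic-member {E} {x = x} P∈E Q∈E root y∈ with ⟨⟩-elim y∈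
  ... | p , p∈E , y≈p with cubic-remainder E P∈E Q∈E p∈E
  ... | r₀ , r₁ , r₂ , r₀∈E , r₁∈E , r₂∈E , p≈ =
    r₀ , r₁ , r₂ , r₀∈E , r₁∈E , r₂∈E , trans y≈p (p≈ x root)

  -- The two coefficients are the trace of `u + v * η` and the negative of its norm.
  quadratic-element : ∀ {E η x} → Quadratic E η → x ∈ E ⟨ η ⟩ → Quadratic E x
  quadratic-element {E} {η} {x} η-quadratic@(s , n , s∈E , n∈E , η²≈) x∈ with quadratic-member {E} η-quadratic x∈
  ... | u , v , u∈E , v∈E , x≈ =
    2 · u + s * v , v ^ 2 * n - u ^ 2 - s * u * v ,
    closed E 3 (λ u v s → 2 ⊙ u ⊕ s ⊗ v) (u∈E ∷ v∈E ∷ s∈E ∷ []) ,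
    closed E 4 (λ u v s n → v ↑ 2 ⊗ n ⊖ u ↑ 2 ⊖ s ⊗ u ⊗ v) (u∈E ∷ v∈E ∷ s∈E ∷ n∈E ∷ []) ,
    trans (solve 6 (λ u v s n η x → x ↑ 2 ⊜
            (2 ⊙ u ⊕ s ⊗ v) ⊗ x ⊕ (v ↑ 2 ⊗ n ⊖ u ↑ 2 ⊖ s ⊗ u ⊗ v)
              ⊕ (x ⊕ (u ⊕ v ⊗ η) ⊖ 2 ⊙ u ⊖ s ⊗ v) ⊗ (x ⊖ (u ⊕ v ⊗ η)) ⊕ v ↑ 2 ⊗ (η ↑ 2 ⊖ (s ⊗ η ⊕ n)))
            u v s n η x)
          (absorb₂ x≈ η²≈)
    where open VecAll.All

  NoRoot⇒¬Quadratic : ∀ {E P Q x} → P ∈ E → Q ∈ E → NoRoot E P Q → cubic P Q x ≈ 0# → ¬ Quadratic E x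
  NoRoot⇒¬Quadratic {E} {x = x} P∈E Q∈E noRoot root (s , n , s∈E , n∈E , x²≈) =
    1≉0 (proj₂ (proj₂ (powers-independent E P∈E Q∈E noRoot root
      (Intermediate.-‿closed E n∈E) (Intermediate.-‿closed E s∈E) (Intermediate.1-closed E)
      (trans (solve 3 (λ s n x → ⊝ n ⊕ (⊝ s) ⊗ x ⊕ 𝟙 ⊗ x ↑ 2 ⊜ 𝟘 ⊕ 𝟙 ⊗ (x ↑ 2 ⊖ (s ⊗ x ⊕ n))) s n x)
             (absorb x²≈)))))

  -- Every element of `E ⟨ η ⟩` satisfies a quadratic equation over E, whereas one for a root would
  -- be a relation between its powers.
  NoRoot-quadratic : ∀ {E P Q η} → P ∈ E → Q ∈ E → NoRoot E P Q → Quadratic E η → NoRoot (E ⟨ η ⟩) P Q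
  NoRoot-quadratic {E} P∈E Q∈E noRoot η-quadratic r r∈ root =
    NoRoot⇒¬Quadratic {E} P∈E Q∈E noRoot root (quadratic-element {E} η-quadratic r∈)

  -- The powers of x remain independent over `E ⟨ η ⟩`, where the cubic still has no root. Read over
  -- that field, `η ≈ r₀ + r₁ * x + r₂ * x ^ 2` is a relation between them, and its constant term
  -- gives `η ≈ r₀`.
  quadratic∩cubic : ∀ {E P Q x η} → P ∈ E → Q ∈ E → NoRoot E P Q → cubic P Q x ≈ 0# →
    Quadratic E η → η ∈ E ⟨ x ⟩ → η ∈ E
  quadratic∩cubic {E} {P} {Q} {x} {η} P∈E Q∈E noRoot root η-quadratic η∈
    with cubic-member {E} P∈E Q∈E root η∈
  ... | r₀ , r₁ , r₂ , r₀∈E , r₁∈E , r₂∈E , η≈ = ∈-resp E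
    (difference-zero (proj₁ (powers-independent (E ⟨ η ⟩) (⟨⟩-base {E} P∈E) (⟨⟩-base {E} Q∈E)
      (NoRoot-quadratic {E} P∈E Q∈E noRoot η-quadratic) root
      (closed (E ⟨ η ⟩) 2 (λ r η → r ⊖ η) (⟨⟩-base {E} r₀∈E ∷ ⟨⟩-generator {E} ∷ []))
      (⟨⟩-base {E} r₁∈E) (⟨⟩-base {E} r₂∈E)
      (trans (solve 5 (λ r₀ r₁ r₂ x η → (r₀ ⊖ η) ⊕ r₁ ⊗ x ⊕ r₂ ⊗ x ↑ 2 ⊜
                𝟘 ⊕ (⊝ 𝟙) ⊗ (η ⊖ (r₀ ⊕ r₁ ⊗ x ⊕ r₂ ⊗ x ↑ 2))) r₀ r₁ r₂ x η)
             (absorb η≈)))))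
    r₀∈E
    where open VecAll.All

  -- Eliminating `x ^ 2` from the expressions of z and `z ^ 2` gives x by a division, unless the
  -- determinant vanishes. In that case `z ^ 2 - w₀` is a multiple of `z - u₀`, so z is quadratic
  -- over E and hence already in E.
  cubic-generator : ∀ {E P Q x z} → P ∈ E → Q ∈ E → NoRoot E P Q → cubic P Q x ≈ 0# →
    z ∈ E ⟨ x ⟩ → z ∉ E → x ∈ E ⟨ z ⟩
  cubic-generator {E} {P} {Q} {x} {z} P∈E Q∈E noRoot root z∈ z∉E
    with cubic-member {E} P∈E Q∈E root z∈
       | cubic-member {E} P∈E Q∈E root (closed (E ⟨ x ⟩) 1 (λ z → z ↑ 2) (z∈ VecAll.∷ VecAll.[]))
  ... | u₀ , u₁ , u₂ , u₀∈E , u₁∈E , u₂∈E , z≈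
      | w₀ , w₁ , w₂ , w₀∈E , w₁∈E , w₂∈E , z²≈
    with zero? (u₁ * w₂ - u₂ * w₁)
  ... | no det≉0 = solution-∈ (E ⟨ z ⟩) x det≉0
    (trans (solve 8 (λ u₀ u₁ u₂ w₀ w₁ w₂ x z →
              (u₂ ⊗ (z ↑ 2 ⊖ w₀) ⊖ w₂ ⊗ (z ⊖ u₀)) ⊕ (u₁ ⊗ w₂ ⊖ u₂ ⊗ w₁) ⊗ x ⊜
              𝟘 ⊕ (⊝ w₂) ⊗ (z ⊖ (u₀ ⊕ u₁ ⊗ x ⊕ u₂ ⊗ x ↑ 2)) ⊕ u₂ ⊗ (z ↑ 2 ⊖ (w₀ ⊕ w₁ ⊗ x ⊕ w₂ ⊗ x ↑ 2)))
              u₀ u₁ u₂ w₀ w₁ w₂ x z)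
           (absorb₂ z≈ z²≈))
    (⟨⟩-base {E} (closed E 4 (λ u₁ u₂ w₁ w₂ → u₁ ⊗ w₂ ⊖ u₂ ⊗ w₁) (u₁∈E ∷ u₂∈E ∷ w₁∈E ∷ w₂∈E ∷ [])))
    (closed (E ⟨ z ⟩) 5 (λ z u₀ u₂ w₀ w₂ → u₂ ⊗ (z ↑ 2 ⊖ w₀) ⊖ w₂ ⊗ (z ⊖ u₀))
      (⟨⟩-generator {E} ∷ ⟨⟩-base {E} u₀∈E ∷ ⟨⟩-base {E} u₂∈E ∷ ⟨⟩-base {E} w₀∈E ∷ ⟨⟩-base {E} w₂∈E ∷ []))
    where open VecAll.All
  ... | yes det≈0 = contradiction (quadratic∩cubic {E} P∈E Q∈E noRoot root z-quadratic z∈) z∉E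
    where
    open VecAll.All

    z-quadratic : Quadratic E z
    z-quadratic with zero? u₁ | zero? u₂
    ... | yes u₁≈0 | yes u₂≈0 = contradiction
      (∈-resp E (sym (trans z≈ (trans
        (solve 4 (λ u₀ u₁ u₂ x → u₀ ⊕ u₁ ⊗ x ⊕ u₂ ⊗ x ↑ 2 ⊜ u₀ ⊕ x ⊗ (u₁ ⊖ 𝟘) ⊕ x ↑ 2 ⊗ (u₂ ⊖ 𝟘))
          u₀ u₁ u₂ x) (absorb₂ u₁≈0 u₂≈0)))) u₀∈E) z∉E
    ... | _ | no u₂≉0 with divide u₂≉0 w₂
    ... | s , u₂s≈w₂ = s , w₀ - s * u₀ , s∈E ,
      closed E 3 (λ w s u → w ⊖ s ⊗ u) (w₀∈E ∷ s∈E ∷ u₀∈E ∷ []) ,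
      *-cancel u₂≉0 (trans (solve 9 (λ u₀ u₁ u₂ w₀ w₁ w₂ x z s → u₂ ⊗ z ↑ 2 ⊜
          u₂ ⊗ (s ⊗ z ⊕ (w₀ ⊖ s ⊗ u₀))
            ⊕ (u₂ ⊗ (⊝ s)) ⊗ (z ⊖ (u₀ ⊕ u₁ ⊗ x ⊕ u₂ ⊗ x ↑ 2))
            ⊕ u₂ ⊗ (z ↑ 2 ⊖ (w₀ ⊕ w₁ ⊗ x ⊕ w₂ ⊗ x ↑ 2))
            ⊕ (⊝ (u₁ ⊗ x ⊕ u₂ ⊗ x ↑ 2)) ⊗ (u₂ ⊗ s ⊖ w₂) ⊕ (⊝ x) ⊗ ((u₁ ⊗ w₂ ⊖ u₂ ⊗ w₁) ⊖ 𝟘))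
          u₀ u₁ u₂ w₀ w₁ w₂ x z s)
        (trans (absorb₂ u₂s≈w₂ det≈0) (absorb₂ z≈ z²≈)))
      where
      s∈E : s ∈ E
      s∈E = quotient-∈ E u₂≉0 u₂s≈w₂ u₂∈E w₂∈E
    z-quadratic | no u₁≉0 | _ with divide u₁≉0 w₁
    ... | s , u₁s≈w₁ = s , w₀ - s * u₀ , s∈E ,
      closed E 3 (λ w s u → w ⊖ s ⊗ u) (w₀∈E ∷ s∈E ∷ u₀∈E ∷ []) ,
      *-cancel u₁≉0 (trans (solve 9 (λ u₀ u₁ u₂ w₀ w₁ w₂ x z s → u₁ ⊗ z ↑ 2 ⊜
          u₁ ⊗ (s ⊗ z ⊕ (w₀ ⊖ s ⊗ u₀))
            ⊕ (u₁ ⊗ (⊝ s)) ⊗ (z ⊖ (u₀ ⊕ u₁ ⊗ x ⊕ u₂ ⊗ x ↑ 2))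
            ⊕ u₁ ⊗ (z ↑ 2 ⊖ (w₀ ⊕ w₁ ⊗ x ⊕ w₂ ⊗ x ↑ 2))
            ⊕ (⊝ (u₁ ⊗ x ⊕ u₂ ⊗ x ↑ 2)) ⊗ (u₁ ⊗ s ⊖ w₁) ⊕ x ↑ 2 ⊗ ((u₁ ⊗ w₂ ⊖ u₂ ⊗ w₁) ⊖ 𝟘))
          u₀ u₁ u₂ w₀ w₁ w₂ x z s)
        (trans (absorb₂ u₁s≈w₁ det≈0) (absorb₂ z≈ z²≈)))
      where
      s∈E : s ∈ E
      s∈E = quotient-∈ E u₁≉0 u₁s≈w₁ u₁∈E w₁∈E

  -- Irreducibility over M from independence of the powers of a root

  open Polynomial em M

  evalᴹ : Mᵈ.Poly → Carrier → Carrier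
  evalᴹ p t = eval (List.map ι p) t

  evalᴹ-+ₚ : ∀ p q t → evalᴹ (p Mᵈ.+ₚ q) t ≈ evalᴹ p t + evalᴹ q t
  evalᴹ-+ₚ []      q       t = sym (+-identityˡ _)
  evalᴹ-+ₚ (x ∷ p) []      t = sym (+-identityʳ _)
  evalᴹ-+ₚ (x ∷ p) (y ∷ q) t = trans (+-cong (ι-+ x y) (*-congˡ (evalᴹ-+ₚ p q t)))
    (solve 5 (λ x y t u v → (x ⊕ y) ⊕ t ⊗ (u ⊕ v) ⊜ (x ⊕ t ⊗ u) ⊕ (y ⊕ t ⊗ v))
      (ι x) (ι y) t (evalᴹ p t) (evalᴹ q t))

  evalᴹ-scale : ∀ k q t → evalᴹ (List.map (k M.*_) q) t ≈ ι k * evalᴹ q t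
  evalᴹ-scale k []      t = sym (zeroʳ _)
  evalᴹ-scale k (x ∷ q) t = trans (+-cong (ι-* k x) (*-congˡ (evalᴹ-scale k q t)))
    (solve 4 (λ k x t u → k ⊗ x ⊕ t ⊗ (k ⊗ u) ⊜ k ⊗ (x ⊕ t ⊗ u)) (ι k) (ι x) t (evalᴹ q t))

  evalᴹ-*ₚ : ∀ p q t → evalᴹ (p Mᵈ.*ₚ q) t ≈ evalᴹ p t * evalᴹ q t
  evalᴹ-*ₚ []      q t = sym (zeroˡ _)
  evalᴹ-*ₚ (x ∷ p) q t = trans (evalᴹ-+ₚ (List.map (x M.*_) q) (M.0# ∷ p Mᵈ.*ₚ q) t)
    (trans (+-cong (evalᴹ-scale x q t) (+-cong ι-0 (*-congˡ (evalᴹ-*ₚ p q t))))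
      (solve 4 (λ x u v t → x ⊗ v ⊕ (𝟘 ⊕ t ⊗ (u ⊗ v)) ⊜ (x ⊕ t ⊗ u) ⊗ v) (ι x) (evalᴹ p t) (evalᴹ q t) t))

  evalᴹ-zero : ∀ p t → Zeroₚ p → evalᴹ p t ≈ 0#
  evalᴹ-zero []      t p≈0 = refl
  evalᴹ-zero (x ∷ p) t p≈0 = trans (+-cong (trans (ι-cong (p≈0 0)) ι-0) (*-congˡ (evalᴹ-zero p t (p≈0 ∘ suc))))
    (solve 1 (λ t → 𝟘 ⊕ t ⊗ 𝟘 ⊜ 𝟘) t)

  evalᴹ-≈ₚ : ∀ p q t → p Mᵈ.≈ₚ q → evalᴹ p t ≈ evalᴹ q t
  evalᴹ-≈ₚ []      q       t p≈q = sym (evalᴹ-zero q t (M.sym ∘ p≈q))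
  evalᴹ-≈ₚ (x ∷ p) []      t p≈q = evalᴹ-zero (x ∷ p) t p≈q
  evalᴹ-≈ₚ (x ∷ p) (y ∷ q) t p≈q = +-cong (ι-cong (p≈q 0)) (*-congˡ (evalᴹ-≈ₚ p q t (p≈q ∘ suc)))

  root⇒∤1 : ∀ {p t} → evalᴹ p t ≈ 0# → ¬ p Mᵈ.∣ₚ (M.1# ∷ [])
  root⇒∤1 {p} {t} root (q RawMagma., qp≈1) = 1≉0 (trans
    (sym (trans (+-congʳ ι-1) (solve 1 (λ t → 𝟙 ⊕ t ⊗ 𝟘 ⊜ 𝟙) t)))
    (trans (sym (evalᴹ-≈ₚ (q Mᵈ.*ₚ p) (M.1# ∷ []) t qp≈1))
      (trans (evalᴹ-*ₚ q p t) (trans (*-congˡ root) (zeroʳ _)))))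

  combination : ℕ → (ℕ → M.Carrier) → Carrier → Carrier
  combination zero    k t = 0#
  combination (suc n) k t = ι (k 0) + t * combination n (k ∘ suc) t

  evalᴹ-combination : ∀ n p t → (∀ m → n ℕ.≤ m → Mᵈ.coeff p m M.≈ M.0#) → evalᴹ p t ≈ combination n (Mᵈ.coeff p) t
  evalᴹ-combination zero    p       t p≥n = evalᴹ-zero p t (λ m → p≥n m z≤n)
  evalᴹ-combination (suc n) []      t p≥n = sym (zero-combination (suc n))
    where
    zero-combination : ∀ n → combination n (Mᵈ.coeff []) t ≈ 0#
    zero-combination zero    = refl
    zero-combination (suc n) = trans (+-cong ι-0 (*-congˡ (zero-combination n)))
      (solve 1 (λ t → 𝟘 ⊕ t ⊗ 𝟘 ⊜ 𝟘) t)
  evalᴹ-combination (suc n) (x ∷ p) t p≥n =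
    +-congˡ (*-congˡ (evalᴹ-combination n p t (λ m n≤m → p≥n (suc m) (s≤s n≤m))))

  Independent : Carrier → ℕ → Set (c ⊔ ℓ₁)
  Independent t n = ∀ k → combination n k t ≈ 0# → ∀ i → i ℕ.< n → k i M.≈ M.0#

  -- In a factorisation, t is a root of one factor. Were the other factor not constant, the first
  -- would have degree at most n, and its coefficients would form a nontrivial relation between
  -- independent powers of t.
  independent⇒irreducible : ∀ {P n t} → ¬ Mᵈ.coeff P (suc n) M.≈ M.0# →
    (∀ m → suc n ℕ.< m → Mᵈ.coeff P m M.≈ M.0#) → evalᴹ P t ≈ 0# → Independent t (suc n) → Mᵈ.Irreducible P
  independent⇒irreducible {P} {n} {t} P_n≉0 P>n root independent = record
    { p∤1     = root⇒∤1 root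
    ; split-∣1 = λ {g} {h} → split g h
    }
    where
    cofactor : ∀ u v {d e} → evalᴹ u t ≈ 0# → Degree u d → Degree v e → d ℕ.+ e ℕ.≤ suc n → v Mᵈ.∣ₚ (M.1# ∷ [])
    cofactor u v {e = zero}  ut≈0 u-degree v-degree d+e≤n = constant-unit v v-degree
    cofactor u v {d} {suc e} ut≈0 (u_d≉0 , u>d) v-degree d+e≤n = contradiction
      (independent (Mᵈ.coeff u)
        (trans (sym (evalᴹ-combination (suc n) u t λ m n<m → u>d m (ℕₚ.<-≤-trans d<n n<m))) ut≈0) d d<n)
      u_d≉0
      where
      d<n : d ℕ.< suc n
      d<n = ℕₚ.<-≤-trans (ℕₚ.m<m+n d (s≤s z≤n)) d+e≤n

    split : ∀ g h → P Mᵈ.≈ₚ g Mᵈ.*ₚ h → g Mᵈ.∣ₚ (M.1# ∷ []) ⊎ h Mᵈ.∣ₚ (M.1# ∷ [])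
    split g h P≈gh = [ (λ gt≈0 → inj₂ (cofactor g h gt≈0 g-degree h-degree d+e≤n))
                     , (λ ht≈0 → inj₁ (cofactor h g ht≈0 h-degree g-degree
                         (≡.subst (ℕ._≤ suc n) (ℕₚ.+-comm d e) d+e≤n))) ]′ root-of-factor
      where
      leading≉0 : ∀ m → ¬ Mᵈ.coeff (g Mᵈ.*ₚ h) m M.≈ M.0# → m ℕ.≤ suc n
      leading≉0 m gh≉0 = ℕₚ.≮⇒≥ λ n<m → gh≉0 (M.trans (M.sym (P≈gh m)) (P>n m n<m))

      g≉0 : ∃ (Degree g)
      g≉0 = [ (λ g≈0 → contradiction (M.trans (P≈gh (suc n)) (zero-*ₚ g h g≈0 (suc n))) P_n≉0) , id ]′ (degree g)

      h≉0 : ∃ (Degree h)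
      h≉0 = [ (λ h≈0 → contradiction (M.trans (P≈gh (suc n)) (*ₚ-zero g h h≈0 (suc n))) P_n≉0) , id ]′ (degree h)

      d e : ℕ
      d = proj₁ g≉0
      e = proj₁ h≉0

      g-degree : Degree g d
      g-degree = proj₂ g≉0

      h-degree : Degree h e
      h-degree = proj₂ h≉0

      d+e≤n : d ℕ.+ e ℕ.≤ suc n
      d+e≤n = leading≉0 (d ℕ.+ e) λ gh≈0 → Mᵖ.nonzero-* (proj₁ g-degree) (proj₁ h-degree)
        (M.trans (M.sym (leading-*ₚ g h d e (proj₂ g-degree) (proj₂ h-degree))) gh≈0)

      root-of-factor : evalᴹ g t ≈ 0# ⊎ evalᴹ h t ≈ 0#
      root-of-factor with zero? (evalᴹ g t)
      ... | yes gt≈0 = inj₁ gt≈0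
      ... | no  gt≉0 = inj₂ (zero-product
        (trans (sym (evalᴹ-*ₚ g h t)) (trans (sym (evalᴹ-≈ₚ P (g Mᵈ.*ₚ h) t P≈gh)) root)) gt≉0)

  independent₁ : ∀ t → Independent t 1
  independent₁ t k k₀≈0 zero _ = ι-injective (trans
    (solve 2 (λ k t → k ⊜ k ⊕ t ⊗ 𝟘) (ι (k 0)) t) (trans k₀≈0 (sym ι-0)))
  independent₁ t k k₀≈0 (suc i) (s≤s ())

  independent₂ : ∀ {t} → t ∉ base-field → Independent t 2
  independent₂ {t} t∉M k relation = λ where
      zero          _ → ι-injective (trans k₀≈0 (sym ι-0))
      (suc zero)    _ → ι-injective (trans k₁≈0 (sym ι-0))
      (suc (suc i)) (s≤s (s≤s ()))
    where
    linear : ι (k 0) + ι (k 1) * t ≈ 0#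
    linear = trans (solve 3 (λ a b t → a ⊕ b ⊗ t ⊜ a ⊕ t ⊗ (b ⊕ t ⊗ 𝟘)) (ι (k 0)) (ι (k 1)) t) relation

    k₁≈0 : ι (k 1) ≈ 0#
    k₁≈0 = decidable-stable (zero? _) λ k₁≉0 →
      t∉M (solution-∈ base-field t k₁≉0 linear (ι-∈ base-field (k 1)) (ι-∈ base-field (k 0)))

    k₀≈0 : ι (k 0) ≈ 0#
    k₀≈0 = trans (solve 3 (λ a b t → a ⊜ 𝟘 ⊕ 𝟙 ⊗ ((a ⊕ b ⊗ t) ⊖ 𝟘) ⊕ (⊝ t) ⊗ (b ⊖ 𝟘)) (ι (k 0)) (ι (k 1)) t)
      (absorb₂ linear k₁≈0)

  independent₃ : ∀ {P Q t} → P ∈ base-field → Q ∈ base-field → NoRoot base-field P Q → cubic P Q t ≈ 0# → Independent t 3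
  independent₃ {t = t} P∈M Q∈M noRoot root k relation = λ where
      zero                _ → ι-injective (trans (proj₁ k≈0) (sym ι-0))
      (suc zero)          _ → ι-injective (trans (proj₁ (proj₂ k≈0)) (sym ι-0))
      (suc (suc zero))    _ → ι-injective (trans (proj₂ (proj₂ k≈0)) (sym ι-0))
      (suc (suc (suc i))) (s≤s (s≤s (s≤s ())))
    where
    k≈0 : ι (k 0) ≈ 0# × ι (k 1) ≈ 0# × ι (k 2) ≈ 0#
    k≈0 = powers-independent base-field P∈M Q∈M noRoot root
      (ι-∈ base-field (k 0)) (ι-∈ base-field (k 1)) (ι-∈ base-field (k 2))
      (trans (solve 4 (λ a b c t → a ⊕ b ⊗ t ⊕ c ⊗ t ↑ 2 ⊜ a ⊕ t ⊗ (b ⊕ t ⊗ (c ⊕ t ⊗ 𝟘)))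
                (ι (k 0)) (ι (k 1)) (ι (k 2)) t) relation)

  -- If t³ + Pt = Y with Y quadratic over M, the degree of t is that of a tower of
  -- a cubic and a quadratic extension.
  independent₆ : ∀ {P Y t} → P ∈ base-field → Y ∉ base-field →
    NoRoot (base-field ⟨ Y ⟩) P (- Y) → cubic P (- Y) t ≈ 0# → Independent t 6
  independent₆ {P} {Y} {t} P∈M Y∉M noRoot root k relation = λ where
      zero                      _ → vanish (proj₁ k₀k₃)
      (suc zero)                _ → vanish (proj₁ k₁k₄)
      (suc (suc zero))          _ → vanish (proj₁ k₂k₅)
      (suc (suc (suc zero)))    _ → vanish (proj₂ k₀k₃)
      (suc (suc (suc (suc zero))))       _ → vanish (proj₂ k₁k₄)
      (suc (suc (suc (suc (suc zero))))) _ → vanish (proj₂ k₂k₅)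
      (suc (suc (suc (suc (suc (suc i)))))) (s≤s (s≤s (s≤s (s≤s (s≤s (s≤s ()))))))
    where
    open VecAll.All

    vanish : ∀ {m} → ι m ≈ 0# → m M.≈ M.0#
    vanish ιm≈0 = ι-injective (trans ιm≈0 (sym ι-0))

    E : Intermediate
    E = base-field ⟨ Y ⟩

    a₀ a₁ a₂ a₃ a₄ a₅ : Carrier
    a₀ = ι (k 0)
    a₁ = ι (k 1)
    a₂ = ι (k 2)
    a₃ = ι (k 3)
    a₄ = ι (k 4)
    a₅ = ι (k 5)

    a∈ : ∀ i → ι (k i) ∈ E
    a∈ i = ι-∈ E (k i)

    P∈ : P ∈ E
    P∈ = base⊆ E P∈M

    Y∈ : Y ∈ E
    Y∈ = ⟨⟩-generator

    -- The coefficients of 1, t and `t ^ 2` after replacing `t ^ 3` by `Y - P * t`. Each is then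
    -- split into its components along 1 and Y.
    u≈0 : (a₀ + a₃ * Y - P * a₅ * Y) ≈ 0# × (a₁ - P * a₃ + a₄ * Y + P ^ 2 * a₅) ≈ 0# × (a₂ - P * a₄ + a₅ * Y) ≈ 0#
    u≈0 = powers-independent E P∈ (Intermediate.-‿closed E Y∈) noRoot root
      (closed E 5 (λ a₀ a₃ a₅ P Y → a₀ ⊕ a₃ ⊗ Y ⊖ P ⊗ a₅ ⊗ Y) (a∈ 0 ∷ a∈ 3 ∷ a∈ 5 ∷ P∈ ∷ Y∈ ∷ []))
      (closed E 6 (λ a₁ a₃ a₄ a₅ P Y → a₁ ⊖ P ⊗ a₃ ⊕ a₄ ⊗ Y ⊕ P ↑ 2 ⊗ a₅) (a∈ 1 ∷ a∈ 3 ∷ a∈ 4 ∷ a∈ 5 ∷ P∈ ∷ Y∈ ∷ []))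
      (closed E 5 (λ a₂ a₄ a₅ P Y → a₂ ⊖ P ⊗ a₄ ⊕ a₅ ⊗ Y) (a∈ 2 ∷ a∈ 4 ∷ a∈ 5 ∷ P∈ ∷ Y∈ ∷ []))
      (trans (solve 9 (λ a₀ a₁ a₂ a₃ a₄ a₅ P Y t →
          (a₀ ⊕ a₃ ⊗ Y ⊖ P ⊗ a₅ ⊗ Y) ⊕ (a₁ ⊖ P ⊗ a₃ ⊕ a₄ ⊗ Y ⊕ P ↑ 2 ⊗ a₅) ⊗ t ⊕ (a₂ ⊖ P ⊗ a₄ ⊕ a₅ ⊗ Y) ⊗ t ↑ 2 ⊜
          𝟘 ⊕ 𝟙 ⊗ ((a₀ ⊕ t ⊗ (a₁ ⊕ t ⊗ (a₂ ⊕ t ⊗ (a₃ ⊕ t ⊗ (a₄ ⊕ t ⊗ (a₅ ⊕ t ⊗ 𝟘)))))) ⊖ 𝟘)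
            ⊕ (⊝ (a₃ ⊕ a₄ ⊗ t ⊕ a₅ ⊗ (t ↑ 2 ⊖ P))) ⊗ ((t ↑ 3 ⊕ P ⊗ t ⊕ ⊝ Y) ⊖ 𝟘))
          a₀ a₁ a₂ a₃ a₄ a₅ P Y t)
        (absorb₂ relation root))

    split : ∀ {u v} → u ∈ base-field → v ∈ base-field → u + v * Y ≈ 0# → u ≈ 0# × v ≈ 0#
    split {u} {v} u∈M v∈M u+vY≈0 =
      trans (solve 3 (λ u v Y → u ⊜ 𝟘 ⊕ 𝟙 ⊗ ((u ⊕ v ⊗ Y) ⊖ 𝟘) ⊕ (⊝ Y) ⊗ (v ⊖ 𝟘)) u v Y) (absorb₂ u+vY≈0 v≈0) , v≈0
      where
      v≈0 : v ≈ 0#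
      v≈0 = decidable-stable (zero? v) λ v≉0 → Y∉M (solution-∈ base-field Y v≉0 u+vY≈0 v∈M u∈M)

    M∋ : ∀ i → ι (k i) ∈ base-field
    M∋ i = ι-∈ base-field (k i)

    step₂ : a₂ - P * a₄ ≈ 0# × a₅ ≈ 0#
    step₂ = split (closed base-field 3 (λ a P b → a ⊖ P ⊗ b) (M∋ 2 ∷ P∈M ∷ M∋ 4 ∷ [])) (M∋ 5) (proj₂ (proj₂ u≈0))

    step₁ : a₁ - P * a₃ + P ^ 2 * a₅ ≈ 0# × a₄ ≈ 0#
    step₁ = split (closed base-field 4 (λ a P b c → a ⊖ P ⊗ b ⊕ P ↑ 2 ⊗ c) (M∋ 1 ∷ P∈M ∷ M∋ 3 ∷ M∋ 5 ∷ [])) (M∋ 4)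
      (trans (solve 6 (λ a₁ a₃ a₄ a₅ P Y → a₁ ⊖ P ⊗ a₃ ⊕ P ↑ 2 ⊗ a₅ ⊕ a₄ ⊗ Y ⊜ a₁ ⊖ P ⊗ a₃ ⊕ a₄ ⊗ Y ⊕ P ↑ 2 ⊗ a₅)
                a₁ a₃ a₄ a₅ P Y) (proj₁ (proj₂ u≈0)))

    step₀ : a₀ ≈ 0# × a₃ - P * a₅ ≈ 0#
    step₀ = split (M∋ 0) (closed base-field 3 (λ a P b → a ⊖ P ⊗ b) (M∋ 3 ∷ P∈M ∷ M∋ 5 ∷ []))
      (trans (solve 5 (λ a₀ a₃ a₅ P Y → a₀ ⊕ (a₃ ⊖ P ⊗ a₅) ⊗ Y ⊜ a₀ ⊕ a₃ ⊗ Y ⊖ P ⊗ a₅ ⊗ Y) a₀ a₃ a₅ P Y) (proj₁ u≈0))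

    remove : ∀ {u v q} → u - q * v ≈ 0# → v ≈ 0# → u ≈ 0#
    remove {u} {v} {q} p v≈0 = trans
      (solve 3 (λ u v q → u ⊜ 𝟘 ⊕ 𝟙 ⊗ ((u ⊖ q ⊗ v) ⊖ 𝟘) ⊕ q ⊗ (v ⊖ 𝟘)) u v q) (absorb₂ p v≈0)

    k₂k₅ : a₂ ≈ 0# × a₅ ≈ 0#
    k₂k₅ = remove (proj₁ step₂) (proj₂ step₁) , proj₂ step₂

    k₀k₃ : a₀ ≈ 0# × a₃ ≈ 0#
    k₀k₃ = proj₁ step₀ , remove (proj₂ step₀) (proj₂ step₂)

    k₁k₄ : a₁ ≈ 0# × a₄ ≈ 0#
    k₁k₄ = remove (trans (solve 4 (λ a₁ a₃ a₅ P → a₁ ⊖ P ⊗ a₃ ⊜ (a₁ ⊖ P ⊗ a₃ ⊕ P ↑ 2 ⊗ a₅) ⊕ (⊝ (P ↑ 2)) ⊗ (a₅ ⊖ 𝟘)) a₁ a₃ a₅ P)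
                    (trans (absorb (proj₂ step₂)) (proj₁ step₁))) (proj₂ k₀k₃) , proj₂ step₁

  -- Extensions with a basis of two elements

  module TwoDimensional (I : Intermediate) (degree-two : HasDegreeOverBase (Intermediate.Contains I) 2) where

    private
      e = proj₁ degree-two
      e∈ = proj₁ (proj₂ degree-two)
      span = proj₁ (proj₂ (proj₂ degree-two))
      independent = proj₂ (proj₂ (proj₂ degree-two))

    -- The minors of the coordinates of 1, x and `x ^ 2` are the coefficients of a linear relation
    -- between these three. If the minor `n₂` at `x ^ 2` vanishes, x is proportional to 1 and hence
    -- rational.
    rational-or-quadratic : ∀ {x} → x ∈ I → x ∈ base-field ⊎ Quadratic base-field x
    rational-or-quadratic {x} x∈ = by-minor (zero? n₂) (zero? α₀) (zero? α₁)
      where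
      1-span = span 1# (Intermediate.1-closed I)
      x-span = span x x∈
      x²-span = span (x ^ 2) (closed I 1 (λ x → x ↑ 2) (x∈ ∷ []))

      α₀ α₁ β₀ β₁ γ₀ γ₁ e₀ e₁ n₀ n₁ n₂ : Carrier
      α₀ = ι (proj₁ 1-span 0F)
      α₁ = ι (proj₁ 1-span 1F)
      β₀ = ι (proj₁ x-span 0F)
      β₁ = ι (proj₁ x-span 1F)
      γ₀ = ι (proj₁ x²-span 0F)
      γ₁ = ι (proj₁ x²-span 1F)
      e₀ = e 0F
      e₁ = e 1F
      n₀ = β₀ * γ₁ - β₁ * γ₀
      n₁ = γ₀ * α₁ - γ₁ * α₀
      n₂ = α₀ * β₁ - α₁ * β₀

      M∋ : ∀ m → ι m ∈ base-field
      M∋ = ι-∈ base-field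

      minor-∈ : ∀ m m′ n n′ → ι m * ι n′ - ι m′ * ι n ∈ base-field
      minor-∈ m m′ n n′ = closed base-field 4 (λ m m′ n n′ → m ⊗ n′ ⊖ m′ ⊗ n) (M∋ m ∷ M∋ m′ ∷ M∋ n ∷ M∋ n′ ∷ [])

      by-minor : Dec (n₂ ≈ 0#) → Dec (α₀ ≈ 0#) → Dec (α₁ ≈ 0#) → x ∈ base-field ⊎ Quadratic base-field x
      by-minor (yes n₂≈0) (no α₀≉0) _ = inj₁ (quotient-∈ base-field α₀≉0
        (trans (solve 7 (λ x α₀ α₁ β₀ β₁ e₀ e₁ → α₀ ⊗ x ⊜ β₀
            ⊕ α₀ ⊗ (x ⊖ (β₀ ⊗ e₀ ⊕ (β₁ ⊗ e₁ ⊕ 𝟘))) ⊕ (⊝ β₀) ⊗ (𝟙 ⊖ (α₀ ⊗ e₀ ⊕ (α₁ ⊗ e₁ ⊕ 𝟘)))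
            ⊕ e₁ ⊗ ((α₀ ⊗ β₁ ⊖ α₁ ⊗ β₀) ⊖ 𝟘)) x α₀ α₁ β₀ β₁ e₀ e₁)
          (absorb₃ (proj₂ x-span) (proj₂ 1-span) n₂≈0)) (M∋ _) (M∋ _))
      by-minor (yes n₂≈0) (yes _) (no α₁≉0) = inj₁ (quotient-∈ base-field α₁≉0
        (trans (solve 7 (λ x α₀ α₁ β₀ β₁ e₀ e₁ → α₁ ⊗ x ⊜ β₁
            ⊕ α₁ ⊗ (x ⊖ (β₀ ⊗ e₀ ⊕ (β₁ ⊗ e₁ ⊕ 𝟘))) ⊕ (⊝ β₁) ⊗ (𝟙 ⊖ (α₀ ⊗ e₀ ⊕ (α₁ ⊗ e₁ ⊕ 𝟘)))
            ⊕ (⊝ e₀) ⊗ ((α₀ ⊗ β₁ ⊖ α₁ ⊗ β₀) ⊖ 𝟘)) x α₀ α₁ β₀ β₁ e₀ e₁)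
          (absorb₃ (proj₂ x-span) (proj₂ 1-span) n₂≈0)) (M∋ _) (M∋ _))
      by-minor (yes _) (yes α₀≈0) (yes α₁≈0) = contradiction
        (trans (solve 4 (λ α₀ α₁ e₀ e₁ → 𝟙 ⊜ 𝟘 ⊕ 𝟙 ⊗ (𝟙 ⊖ (α₀ ⊗ e₀ ⊕ (α₁ ⊗ e₁ ⊕ 𝟘))) ⊕ e₀ ⊗ (α₀ ⊖ 𝟘) ⊕ e₁ ⊗ (α₁ ⊖ 𝟘))
                  α₀ α₁ e₀ e₁) (absorb₃ (proj₂ 1-span) α₀≈0 α₁≈0))
        1≉0
      by-minor (no n₂≉0) _ _ = inj₂ (proj₁ σ , proj₁ τ ,
        quotient-∈ base-field n₂≉0 (proj₂ σ) n₂∈ (Intermediate.-‿closed base-field n₁∈) ,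
        quotient-∈ base-field n₂≉0 (proj₂ τ) n₂∈ (Intermediate.-‿closed base-field n₀∈) ,
        *-cancel n₂≉0 (trans
          (solve 6 (λ x n₀ n₁ n₂ s t → n₂ ⊗ x ↑ 2 ⊜ n₂ ⊗ (s ⊗ x ⊕ t)
              ⊕ 𝟙 ⊗ ((n₀ ⊕ n₁ ⊗ x ⊕ n₂ ⊗ x ↑ 2) ⊖ 𝟘) ⊕ (⊝ x) ⊗ (n₂ ⊗ s ⊖ ⊝ n₁) ⊕ (⊝ 𝟙) ⊗ (n₂ ⊗ t ⊖ ⊝ n₀))
            x n₀ n₁ n₂ (proj₁ σ) (proj₁ τ))
          (absorb₃ relation (proj₂ σ) (proj₂ τ))))
        where
        σ = divide n₂≉0 (- n₁)
        τ = divide n₂≉0 (- n₀)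

        n₀∈ : n₀ ∈ base-field
        n₀∈ = minor-∈ _ _ _ _

        n₁∈ : n₁ ∈ base-field
        n₁∈ = minor-∈ _ _ _ _

        n₂∈ : n₂ ∈ base-field
        n₂∈ = minor-∈ _ _ _ _

        relation : n₀ + n₁ * x + n₂ * x ^ 2 ≈ 0#
        relation = trans
          (solve 9 (λ α₀ α₁ β₀ β₁ γ₀ γ₁ e₀ e₁ x →
            let n₀ = β₀ ⊗ γ₁ ⊖ β₁ ⊗ γ₀; n₁ = γ₀ ⊗ α₁ ⊖ γ₁ ⊗ α₀; n₂ = α₀ ⊗ β₁ ⊖ α₁ ⊗ β₀ in
            n₀ ⊕ n₁ ⊗ x ⊕ n₂ ⊗ x ↑ 2 ⊜ 𝟘 ⊕ n₀ ⊗ (𝟙 ⊖ (α₀ ⊗ e₀ ⊕ (α₁ ⊗ e₁ ⊕ 𝟘)))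
              ⊕ n₁ ⊗ (x ⊖ (β₀ ⊗ e₀ ⊕ (β₁ ⊗ e₁ ⊕ 𝟘))) ⊕ n₂ ⊗ (x ↑ 2 ⊖ (γ₀ ⊗ e₀ ⊕ (γ₁ ⊗ e₁ ⊕ 𝟘))))
            α₀ α₁ β₀ β₁ γ₀ γ₁ e₀ e₁ x)
          (absorb₃ (proj₂ 1-span) (proj₂ x-span) (proj₂ x²-span))

    -- If both basis elements were rational, `e₁ * e₀ - e₀ * e₁ ≈ 0` would be a relation over M.
    -- Independence then gives `e₀ ≈ 0`, which is itself a relation with coefficients 1 and 0.
    ¬⊑base : ¬ I ⊑ base-field
    ¬⊑base all∈M with all∈M (e∈ 0F) | all∈M (e∈ 1F)
    ... | f₀ , ιf₀≈e₀ | f₁ , ιf₁≈e₁ = Mᵖ.1≉0 (independent (λ { 0F → M.1# ; 1F → M.0# })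
        (trans (+-cong (*-congˡ e₀≈0) (+-congʳ (*-congʳ ι-0)))
          (solve 2 (λ i e → i ⊗ 𝟘 ⊕ (𝟘 ⊗ e ⊕ 𝟘) ⊜ 𝟘) (ι M.1#) (e 1F)))
        0F)
      where
      f₀≈0 : M.- f₀ M.≈ M.0#
      f₀≈0 = independent (λ { 0F → f₁ ; 1F → M.- f₀ })
        (trans (+-cong (*-cong ιf₁≈e₁ refl) (+-congʳ (*-congʳ (trans (ι-neg f₀) (-‿cong ιf₀≈e₀)))))
          (solve 2 (λ e₀ e₁ → e₁ ⊗ e₀ ⊕ (⊝ e₀ ⊗ e₁ ⊕ 𝟘) ⊜ 𝟘) (e 0F) (e 1F)))
        1F

      e₀≈0 : e 0F ≈ 0#
      e₀≈0 = trans (sym ιf₀≈e₀) (trans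
        (solve 1 (λ f → f ⊜ 𝟘 ⊕ (⊝ 𝟙) ⊗ (⊝ f ⊖ 𝟘)) (ι f₀))
        (absorb (trans (sym (ι-neg f₀)) (trans (ι-cong f₀≈0) ι-0))))

  -- The roots of a depressed cubic and the resolvent ω

  module WithoutCharacteristic3 (3≉0 : ¬ 3 · 1# ≈ 0#) where

    3·-nonzero : ∀ {x} → ¬ x ≈ 0# → ¬ 3 · x ≈ 0#
    3·-nonzero {x} x≉0 3x≈0 = nonzero-* 3≉0 x≉0
      (trans (solve 1 (λ x → (3 ⊙ 𝟙) ⊗ x ⊜ 3 ⊙ x) x) 3x≈0)

    27·-cancel : ∀ {x} → 27 · x ≈ 0# → x ≈ 0#
    27·-cancel {x} 27x≈0 = decidable-stable (zero? x) λ x≉0 → 3·-nonzero (3·-nonzero (3·-nonzero x≉0))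
      (trans (solve 1 (λ x → 3 ⊙ (3 ⊙ (3 ⊙ x)) ⊜ 27 ⊙ x) x) 27x≈0)

    -- The roots of X³ - 3AX - B, with A and B written in terms of the thirds
    -- g = (x₁ - x₃) / 3 and h = (x₂ - x₁) / 3 of their differences.
    record Roots (A B : Carrier) : Set (c ⊔ ℓ₁) where
      field
        g h : Carrier
        A≈  : A ≈ g ^ 2 + g * h + h ^ 2
        B≈  : B ≈ (g - h) * (g + 2 · h) * - (2 · g + h)
        Δ≉0 : ¬ g * h * (g + h) ≈ 0#

      x₁ x₂ x₃ ω ω′ Δ : Carrier
      x₁ = g - h
      x₂ = g + 2 · h
      x₃ = - (2 · g + h)
      ω  = g ^ 3 - 3 · (g ^ 2 * h) - 6 · (g * h ^ 2) - h ^ 3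
      ω′ = g ^ 3 + 6 · (g ^ 2 * h) + 3 · (g * h ^ 2) - h ^ 3
      Δ  = g * h * (g + h)

      private
        defs : Vec Expr 2
        defs = a ↑ 2 ⊕ a ⊗ b ⊕ b ↑ 2 ∷ (a ⊖ b) ⊗ (a ⊕ 2 ⊙ b) ⊗ ⊝ (2 ⊙ a ⊕ b) ∷ []
          where
          a b : Expr
          a = var 0
          b = var 1

      solveᵣ : ∀ {k} (ρ : Vec Carrier k) (f : N-ary (2 ℕ.+ k ℕ.+ 2) Expr (Expr × Expr)) →
        let e₁ = proj₁ (f $ⁿ vars (2 ℕ.+ k ℕ.+ 2)); e₂ = proj₂ (f $ⁿ vars (2 ℕ.+ k ℕ.+ 2))
            σ = vars (2 ℕ.+ k) Vec.++ defs in
        {Bool.T (isZero {2 ℕ.+ k} (normalise (substitute σ e₁ ⊖ substitute σ e₂)))} →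
        ⟦ e₁ ⟧ (g ∷ h ∷ ρ Vec.++ A ∷ B ∷ []) ≈ ⟦ e₂ ⟧ (g ∷ h ∷ ρ Vec.++ A ∷ B ∷ [])
      solveᵣ {k} ρ f {p} = solve-given (2 ℕ.+ k) defs f {p} (g ∷ h ∷ ρ) (A≈ ∷ B≈ ∷ [])

      factorisation : ∀ t → cubic (- (3 · A)) (- B) t ≈ (t - x₁) * ((t - x₂) * (t - x₃))
      factorisation t = solveᵣ (t ∷ []) λ g h t A B → t ↑ 3 ⊕ ⊝ (3 ⊙ A) ⊗ t ⊕ ⊝ B ⊜
        (t ⊖ (g ⊖ h)) ⊗ ((t ⊖ (g ⊕ 2 ⊙ h)) ⊗ (t ⊖ ⊝ (2 ⊙ g ⊕ h)))

      root₁ : cubic (- (3 · A)) (- B) x₁ ≈ 0#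
      root₁ = solveᵣ [] λ g h A B → (g ⊖ h) ↑ 3 ⊕ ⊝ (3 ⊙ A) ⊗ (g ⊖ h) ⊕ ⊝ B ⊜ 𝟘

      root₂ : cubic (- (3 · A)) (- B) x₂ ≈ 0#
      root₂ = solveᵣ [] λ g h A B → (g ⊕ 2 ⊙ h) ↑ 3 ⊕ ⊝ (3 ⊙ A) ⊗ (g ⊕ 2 ⊙ h) ⊕ ⊝ B ⊜ 𝟘

      root₃ : cubic (- (3 · A)) (- B) x₃ ≈ 0#
      root₃ = solveᵣ [] λ g h A B → (⊝ (2 ⊙ g ⊕ h)) ↑ 3 ⊕ ⊝ (3 ⊙ A) ⊗ ⊝ (2 ⊙ g ⊕ h) ⊕ ⊝ B ⊜ 𝟘

      root-cases : ∀ {t} → cubic (- (3 · A)) (- B) t ≈ 0# → t ≈ x₁ ⊎ t ≈ x₂ ⊎ t ≈ x₃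
      root-cases {t} t-root with zero? (t - x₁) | zero? (t - x₂)
      ... | yes p | _     = inj₁ (difference-zero p)
      ... | no  _ | yes q = inj₂ (inj₁ (difference-zero q))
      ... | no  p | no  q = inj₂ (inj₂ (difference-zero
        (zero-product (zero-product (trans (sym (factorisation t)) t-root) p) q)))

      sum-zero : x₁ + x₂ + x₃ ≈ 0#
      sum-zero = solveᵣ [] λ g h A B → (g ⊖ h) ⊕ (g ⊕ 2 ⊙ h) ⊕ ⊝ (2 ⊙ g ⊕ h) ⊜ 𝟘

      third-root : x₃ ≈ - x₁ - x₂
      third-root = solveᵣ [] λ g h A B → ⊝ (2 ⊙ g ⊕ h) ⊜ ⊝ (g ⊖ h) ⊖ (g ⊕ 2 ⊙ h)

      x₁²-A≈ : x₁ ^ 2 - A ≈ - (3 · (g * h))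
      x₁²-A≈ = solveᵣ [] λ g h A B → (g ⊖ h) ↑ 2 ⊖ A ⊜ ⊝ (3 ⊙ (g ⊗ h))

      g≉0 : ¬ g ≈ 0#
      g≉0 g≈0 = Δ≉0 (trans (solve 2 (λ g h → g ⊗ h ⊗ (g ⊕ h) ⊜ 𝟘 ⊕ (h ⊗ (g ⊕ h)) ⊗ (g ⊖ 𝟘)) g h) (absorb g≈0))

      h≉0 : ¬ h ≈ 0#
      h≉0 h≈0 = Δ≉0 (trans (solve 2 (λ g h → g ⊗ h ⊗ (g ⊕ h) ⊜ 𝟘 ⊕ (g ⊗ (g ⊕ h)) ⊗ (h ⊖ 𝟘)) g h) (absorb h≈0))

      g+h≉0 : ¬ g + h ≈ 0#
      g+h≉0 g+h≈0 = Δ≉0 (trans (*-congˡ g+h≈0) (zeroʳ _))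

      x₁²≉A : ¬ x₁ ^ 2 - A ≈ 0#
      x₁²≉A p = 3·-nonzero (nonzero-* g≉0 h≉0)
        (trans (solve 2 (λ u v → v ⊜ 𝟘 ⊕ (⊝ 𝟙) ⊗ (u ⊖ 𝟘) ⊕ 𝟙 ⊗ (u ⊖ ⊝ v)) (x₁ ^ 2 - A) (3 · (g * h)))
               (absorb₂ p x₁²-A≈))

      x₁≉x₂ : ¬ x₁ ≈ x₂
      x₁≉x₂ p = 3·-nonzero h≉0 (trans
        (solve 2 (λ g h → 3 ⊙ h ⊜ 𝟘 ⊕ (⊝ 𝟙) ⊗ ((g ⊖ h) ⊖ (g ⊕ 2 ⊙ h))) g h) (absorb p))

      x₁≉x₃ : ¬ x₁ ≈ x₃
      x₁≉x₃ p = 3·-nonzero g≉0 (trans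
        (solve 2 (λ g h → 3 ⊙ g ⊜ 𝟘 ⊕ 𝟙 ⊗ ((g ⊖ h) ⊖ ⊝ (2 ⊙ g ⊕ h))) g h) (absorb p))

      x₂≉x₃ : ¬ x₂ ≈ x₃
      x₂≉x₃ p = 3·-nonzero g+h≉0 (trans
        (solve 2 (λ g h → 3 ⊙ (g ⊕ h) ⊜ 𝟘 ⊕ 𝟙 ⊗ ((g ⊕ 2 ⊙ h) ⊖ ⊝ (2 ⊙ g ⊕ h))) g h) (absorb p))

      ω+ω′ : ω′ ≈ - B - ω
      ω+ω′ = solveᵣ [] λ g h A B → g ↑ 3 ⊕ 6 ⊙ (g ↑ 2 ⊗ h) ⊕ 3 ⊙ (g ⊗ h ↑ 2) ⊖ h ↑ 3 ⊜
        ⊝ B ⊖ (g ↑ 3 ⊖ 3 ⊙ (g ↑ 2 ⊗ h) ⊖ 6 ⊙ (g ⊗ h ↑ 2) ⊖ h ↑ 3)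

      -- The other root of this quadratic is `ω′`: the two have sum `- B` and product `B² - 3A³`.
      ω² : ω ^ 2 ≈ - B * ω + (3 · A ^ 3 - B ^ 2)
      ω² = solveᵣ [] λ g h A B → let ω = g ↑ 3 ⊖ 3 ⊙ (g ↑ 2 ⊗ h) ⊖ 6 ⊙ (g ⊗ h ↑ 2) ⊖ h ↑ 3 in
        ω ↑ 2 ⊜ ⊝ B ⊗ ω ⊕ (3 ⊙ A ↑ 3 ⊖ B ↑ 2)

      -- The difference is `- 9 Δ`, nonzero in every characteristic other than 3.
      ω≉ω′ : ¬ ω ≈ ω′
      ω≉ω′ p = 3·-nonzero (3·-nonzero Δ≉0) (trans
        (solve 2 (λ g h → 3 ⊙ (3 ⊙ (g ⊗ h ⊗ (g ⊕ h))) ⊜ 𝟘 ⊕ (⊝ 𝟙) ⊗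
          ((g ↑ 3 ⊖ 3 ⊙ (g ↑ 2 ⊗ h) ⊖ 6 ⊙ (g ⊗ h ↑ 2) ⊖ h ↑ 3) ⊖
           (g ↑ 3 ⊕ 6 ⊙ (g ↑ 2 ⊗ h) ⊕ 3 ⊙ (g ⊗ h ↑ 2) ⊖ h ↑ 3))) g h)
        (absorb p))

      -- x₂ is a rational function of x₁ over the field generated by ω.
      successor : (x₁ ^ 2 - A) * x₂ ≈ ω - A * x₁
      successor = solveᵣ [] λ g h A B → ((g ⊖ h) ↑ 2 ⊖ A) ⊗ (g ⊕ 2 ⊙ h) ⊜
        (g ↑ 3 ⊖ 3 ⊙ (g ↑ 2 ⊗ h) ⊖ 6 ⊙ (g ⊗ h ↑ 2) ⊖ h ↑ 3) ⊖ A ⊗ (g ⊖ h)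

      x₂-quadratic : x₂ ^ 2 ≈ - x₁ * x₂ + (3 · A - x₁ ^ 2)
      x₂-quadratic = solveᵣ [] λ g h A B → (g ⊕ 2 ⊙ h) ↑ 2 ⊜
        ⊝ (g ⊖ h) ⊗ (g ⊕ 2 ⊙ h) ⊕ (3 ⊙ A ⊖ (g ⊖ h) ↑ 2)

      x₃-quadratic : x₃ ^ 2 ≈ - x₁ * x₃ + (3 · A - x₁ ^ 2)
      x₃-quadratic = solveᵣ [] λ g h A B → (⊝ (2 ⊙ g ⊕ h)) ↑ 2 ⊜
        ⊝ (g ⊖ h) ⊗ ⊝ (2 ⊙ g ⊕ h) ⊕ (3 ⊙ A ⊖ (g ⊖ h) ↑ 2)

    module Rotation {A B} (roots : Roots A B) where
      open Roots roots

      -- The third of `x₂ - x₁` is h and that of `x₃ - x₂` is `- (g + h)`, so this is the shift of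
      -- the roots by one place.
      rotate : Roots A B
      rotate = record
        { g = h
        ; h = - (g + h)
        ; A≈ = solveᵣ [] λ g h A B → A ⊜ h ↑ 2 ⊕ h ⊗ ⊝ (g ⊕ h) ⊕ (⊝ (g ⊕ h)) ↑ 2
        ; B≈ = solveᵣ [] λ g h A B → B ⊜
            (h ⊖ ⊝ (g ⊕ h)) ⊗ (h ⊕ 2 ⊙ ⊝ (g ⊕ h)) ⊗ ⊝ (2 ⊙ h ⊕ ⊝ (g ⊕ h))
        ; Δ≉0 = λ p → Δ≉0 (trans (solve 2 (λ g h → g ⊗ h ⊗ (g ⊕ h) ⊜ h ⊗ ⊝ (g ⊕ h) ⊗ (h ⊕ ⊝ (g ⊕ h))) g h) p)
        }

      rotate-x₁ : Roots.x₁ rotate ≈ x₂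
      rotate-x₁ = solve 2 (λ g h → h ⊖ ⊝ (g ⊕ h) ⊜ g ⊕ 2 ⊙ h) g h

      rotate-x₂ : Roots.x₂ rotate ≈ x₃
      rotate-x₂ = solve 2 (λ g h → h ⊕ 2 ⊙ ⊝ (g ⊕ h) ⊜ ⊝ (2 ⊙ g ⊕ h)) g h

      rotate-x₃ : Roots.x₃ rotate ≈ x₁
      rotate-x₃ = solve 2 (λ g h → ⊝ (2 ⊙ h ⊕ ⊝ (g ⊕ h)) ⊜ g ⊖ h) g h

      rotate-ω : Roots.ω rotate ≈ ω
      rotate-ω = solve 2 (λ g h → let h′ = ⊝ (g ⊕ h) in
        h ↑ 3 ⊖ 3 ⊙ (h ↑ 2 ⊗ h′) ⊖ 6 ⊙ (h ⊗ h′ ↑ 2) ⊖ h′ ↑ 3 ⊜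
        g ↑ 3 ⊖ 3 ⊙ (g ↑ 2 ⊗ h) ⊖ 6 ⊙ (g ⊗ h ↑ 2) ⊖ h ↑ 3) g h

    -- L is the splitting field of X³ - 3AX - B over M.
    record SplittingField (A B : Carrier) (L : Intermediate) : Set (Level.suc (c ⊔ ℓ₁)) where
      field
        roots : Roots A B
        A∈M   : A ∈ base-field
        B∈M   : B ∈ base-field
      open Roots roots public
      field
        x₁∈L  : x₁ ∈ L
        x₂∈L  : x₂ ∈ L
        least : ∀ E → x₁ ∈ E → x₂ ∈ E → L ⊑ E

      M⟨x₁⟩ : Intermediate
      M⟨x₁⟩ = base-field ⟨ x₁ ⟩

      A∈ : ∀ E → A ∈ E
      A∈ E = base⊆ E A∈M

      B∈ : ∀ E → B ∈ E
      B∈ E = base⊆ E B∈M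

      P∈ : ∀ E → - (3 · A) ∈ E
      P∈ E = closed E 1 (λ A → ⊝ (3 ⊙ A)) (A∈ E ∷ [])

      Q∈ : ∀ E → - B ∈ E
      Q∈ E = closed E 1 (λ B → ⊝ B) (B∈ E ∷ [])

      x₃∈ : ∀ E → x₁ ∈ E → x₂ ∈ E → x₃ ∈ E
      x₃∈ E x₁∈ x₂∈ = ∈-resp E (sym third-root) (closed E 2 (λ x y → ⊝ x ⊖ y) (x₁∈ ∷ x₂∈ ∷ []))

      x₃∈L : x₃ ∈ L
      x₃∈L = x₃∈ L x₁∈L x₂∈L

      x₂∈ : ∀ E → x₁ ∈ E → ω ∈ E → x₂ ∈ E
      x₂∈ E x₁∈ ω∈ = quotient-∈ E x₁²≉A successor
        (closed E 2 (λ x A → x ↑ 2 ⊖ A) (x₁∈ ∷ A∈ E ∷ []))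
        (closed E 3 (λ x A ω → ω ⊖ A ⊗ x) (x₁∈ ∷ A∈ E ∷ ω∈ ∷ []))

      ω∈ : ∀ E → x₁ ∈ E → x₂ ∈ E → ω ∈ E
      ω∈ E x₁∈ x₂∈ = ∈-resp E
        (trans (solve 5 (λ x A y z ω → (x ↑ 2 ⊖ A) ⊗ y ⊕ A ⊗ x ⊜
                   ω ⊕ 𝟙 ⊗ ((x ↑ 2 ⊖ A) ⊗ y ⊖ (ω ⊖ A ⊗ x))) x₁ A x₂ x₃ ω) (absorb successor))
        (closed E 3 (λ x A y → (x ↑ 2 ⊖ A) ⊗ y ⊕ A ⊗ x) (x₁∈ ∷ A∈ E ∷ x₂∈ ∷ []))

      ω-quadratic : ∀ E → Quadratic E ω
      ω-quadratic E = - B , 3 · A ^ 3 - B ^ 2 , Q∈ E ,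
        closed E 2 (λ A B → 3 ⊙ A ↑ 3 ⊖ B ↑ 2) (A∈ E ∷ B∈ E ∷ []) , ω²

      Irreducibleᶜ : Intermediate → Set (c ⊔ ℓ₁)
      Irreducibleᶜ E = NoRoot E (- (3 · A)) (- B)

    rotateˢ : ∀ {A B L} → SplittingField A B L → SplittingField A B L
    rotateˢ {L = L} S = record
      { roots = rotate
      ; A∈M = A∈M
      ; B∈M = B∈M
      ; x₁∈L = ∈-resp L (sym rotate-x₁) x₂∈L
      ; x₂∈L = ∈-resp L (sym rotate-x₂) x₃∈L
      ; least = λ E x₂∈E x₃∈E →
          let x₂∈E = ∈-resp E rotate-x₁ x₂∈E
              x₃∈E = ∈-resp E rotate-x₂ x₃∈E
          in least E (∈-resp E (solve 2 (λ g h → ⊝ (g ⊕ 2 ⊙ h) ⊖ ⊝ (2 ⊙ g ⊕ h) ⊜ g ⊖ h) g h)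
               (closed E 2 (λ x y → ⊝ x ⊖ y) (x₂∈E ∷ x₃∈E ∷ []))) x₂∈E
      }
      where
      open SplittingField S
      open Rotation roots

    two-roots : ∀ {A B L} (S : SplittingField A B L) → let open SplittingField S in ∀ K {t t′} → t ∈ K → t′ ∈ K →
      cubic (- (3 · A)) (- B) t ≈ 0# → cubic (- (3 · A)) (- B) t′ ≈ 0# → ¬ t ≈ t′ → x₁ ∈ K × x₂ ∈ K
    two-roots S K {t} {t′} t∈ t′∈ t-root t′-root t≉t′ = pair (root-cases t-root) (root-cases t′-root)
      where
      open SplittingField S

      member : ∀ {s x} → s ∈ K → s ≈ x → x ∈ K
      member s∈ s≈ = ∈-resp K s≈ s∈

      remaining : ∀ {s t x y z} → x + y + z ≈ 0# → s ∈ K → t ∈ K → s ≈ y → t ≈ z → x ∈ K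
      remaining {x = x} {y} {z} x+y+z≈0 s∈ t∈ s≈ t≈ = ∈-resp K
        (sym (trans (solve 3 (λ x y z → x ⊜ (⊝ y ⊖ z) ⊕ 𝟙 ⊗ ((x ⊕ y ⊕ z) ⊖ 𝟘)) x y z) (absorb x+y+z≈0)))
        (closed K 2 (λ y z → ⊝ y ⊖ z) (member s∈ s≈ ∷ member t∈ t≈ ∷ []))

      sum₂ : x₂ + x₁ + x₃ ≈ 0#
      sum₂ = trans (+-congʳ (+-comm x₂ x₁)) sum-zero

      pair : t ≈ x₁ ⊎ t ≈ x₂ ⊎ t ≈ x₃ → t′ ≈ x₁ ⊎ t′ ≈ x₂ ⊎ t′ ≈ x₃ → x₁ ∈ K × x₂ ∈ K
      pair (inj₁ p) (inj₁ q) = contradiction (trans p (sym q)) t≉t′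
      pair (inj₁ p) (inj₂ (inj₁ q)) = member t∈ p , member t′∈ q
      pair (inj₁ p) (inj₂ (inj₂ q)) = member t∈ p , remaining sum₂ t∈ t′∈ p q
      pair (inj₂ (inj₁ p)) (inj₁ q) = member t′∈ q , member t∈ p
      pair (inj₂ (inj₁ p)) (inj₂ (inj₁ q)) = contradiction (trans p (sym q)) t≉t′
      pair (inj₂ (inj₁ p)) (inj₂ (inj₂ q)) = remaining sum-zero t∈ t′∈ p q , member t∈ p
      pair (inj₂ (inj₂ p)) (inj₁ q) = member t′∈ q , remaining sum₂ t′∈ t∈ q p
      pair (inj₂ (inj₂ p)) (inj₂ (inj₁ q)) = remaining sum-zero t′∈ t∈ q p , member t′∈ q
      pair (inj₂ (inj₂ p)) (inj₂ (inj₂ q)) = contradiction (trans p (sym q)) t≉t′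

    -- Over `M⟨ω⟩` the cubic still has no root, and there L lies in the cubic extension by `x₁`. A
    -- quadratic element of L therefore belongs to `M⟨ω⟩`.
    quadratic-subfield : ∀ {A B L} (S : SplittingField A B L) → let open SplittingField S in
      Irreducibleᶜ base-field → ∀ {η} → η ∈ L → Quadratic base-field η → η ∈ base-field ⟨ ω ⟩
    quadratic-subfield S irreducible η∈ η-quadratic = quadratic∩cubic {K} (P∈ K) (Q∈ K)
      (NoRoot-quadratic {base-field} (P∈ base-field) (Q∈ base-field) irreducible (ω-quadratic base-field))
      root₁ (Quadratic-⊑ {base-field} {K} (base⊆ K) η-quadratic)
      (least (K ⟨ x₁ ⟩) (⟨⟩-generator {K})
        (x₂∈ (K ⟨ x₁ ⟩) (⟨⟩-generator {K}) (⟨⟩-base {K} (⟨⟩-generator {base-field}))) η∈)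
      where
      open SplittingField S

      K : Intermediate
      K = base-field ⟨ ω ⟩

    -- Automorphisms of a splitting field

    module Automorphisms (L : Intermediate) where
      open Intermediate L using () renaming (subfield to Lˢ)
      open Automorphism using (to; fixesBase; +-homo; *-homo; -‿homo; 0#-homo; 1#-homo; injective)

      Aut : Set (c ⊔ ℓ₁)
      Aut = Automorphism Lˢ

      image : (σ : Aut) → ∀ {x} → x ∈ L → Carrier
      image σ {x} x∈L = proj₁ (to σ (x , x∈L))

      image-∈ : (σ : Aut) → ∀ {x} (x∈L : x ∈ L) → image σ x∈L ∈ L
      image-∈ σ {x} x∈L = proj₂ (to σ (x , x∈L))

      image-cong : (σ : Aut) → ∀ {x y} (x∈L : x ∈ L) (y∈L : y ∈ L) → x ≈ y → image σ x∈L ≈ image σ y∈L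
      image-cong σ x∈L y∈L x≈y = Automorphism.⟦⟧-cong σ {_ , x∈L} {_ , y∈L} x≈y

      image-base : (σ : Aut) → ∀ {x} (x∈L : x ∈ L) → x ∈ base-field → image σ x∈L ≈ x
      image-base σ {x} x∈L x∈M = fixesBase σ (x , x∈L) x∈M

      image-injective : (σ : Aut) → ∀ {x y} (x∈L : x ∈ L) (y∈L : y ∈ L) → image σ x∈L ≈ image σ y∈L → x ≈ y
      image-injective σ x∈L y∈L = injective σ {_ , x∈L} {_ , y∈L}

      image-⟦⟧ : (σ : Aut) → ∀ {n} (e : Expr) (ρ : Vec (∃ (_∈ L)) n) (e∈L : ⟦ e ⟧ (Vec.map proj₁ ρ) ∈ L) →
        image σ e∈L ≈ ⟦ e ⟧ (Vec.map (proj₁ ∘ to σ) ρ)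
      image-⟦⟧ σ e ρ e∈L = trans (image-cong σ e∈L (mem e) refl) (go e)
        where
        ρ-∈ : ∀ {n} (ρ : Vec (∃ (_∈ L)) n) → VecAll.All (_∈ L) (Vec.map proj₁ ρ)
        ρ-∈ []              = []
        ρ-∈ ((_ , x∈L) ∷ ρ) = x∈L ∷ ρ-∈ ρ

        mem : ∀ e → ⟦ e ⟧ (Vec.map proj₁ ρ) ∈ L
        mem e = ⟦ e ⟧-∈ L (ρ-∈ ρ)

        lookup-image : ∀ {n} (ρ : Vec (∃ (_∈ L)) n) i (m : Vec.map proj₁ ρ ! i ∈ L) →
          image σ m ≈ Vec.map (proj₁ ∘ to σ) ρ ! i
        lookup-image []              i       m = trans (image-cong σ m (Intermediate.0-closed L) refl) (0#-homo σ)
        lookup-image ((x , x∈L) ∷ ρ) zero    m = image-cong σ m x∈L refl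
        lookup-image (_ ∷ ρ)         (suc i) m = lookup-image ρ i m

        go : ∀ e → image σ (mem e) ≈ ⟦ e ⟧ (Vec.map (proj₁ ∘ to σ) ρ)
        go (var i) = lookup-image ρ i (mem (var i))
        go 𝟘       = 0#-homo σ
        go 𝟙       = 1#-homo σ
        go (e ⊕ f) = trans (+-homo σ (_ , mem e) (_ , mem f)) (+-cong (go e) (go f))
        go (e ⊗ f) = trans (*-homo σ (_ , mem e) (_ , mem f)) (*-cong (go e) (go f))
        go (⊝ e)   = trans (-‿homo σ (_ , mem e)) (-‿cong (go e))
        go (k ⊙ e) = times k (mem (k ⊙ e))
          where
          times : ∀ k (m : k · ⟦ e ⟧ (Vec.map proj₁ ρ) ∈ L) → image σ m ≈ k · ⟦ e ⟧ (Vec.map (proj₁ ∘ to σ) ρ)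
          times zero    m = trans (image-cong σ m (Intermediate.0-closed L) refl) (0#-homo σ)
          times (suc k) m = trans (image-cong σ m (Intermediate.+-closed L (mem e) (mem (k ⊙ e))) refl)
            (trans (+-homo σ (_ , mem e) (_ , mem (k ⊙ e))) (+-cong (go e) (times k (mem (k ⊙ e)))))
        go (e ↑ k) = power k (mem (e ↑ k))
          where
          power : ∀ k (m : ⟦ e ⟧ (Vec.map proj₁ ρ) ^ k ∈ L) → image σ m ≈ ⟦ e ⟧ (Vec.map (proj₁ ∘ to σ) ρ) ^ k
          power zero    m = trans (image-cong σ m (Intermediate.1-closed L) refl) (1#-homo σ)
          power (suc k) m = trans (image-cong σ m (Intermediate.*-closed L (mem e) (mem (e ↑ k))) refl)
            (trans (*-homo σ (_ , mem e) (_ , mem (e ↑ k))) (*-cong (go e) (power k (mem (e ↑ k)))))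

      image-equation : (σ : Aut) → ∀ n (f : N-ary n Expr (Expr × Expr)) →
        let e₁ = proj₁ (f $ⁿ vars n); e₂ = proj₂ (f $ⁿ vars n) in (ρ : Vec (∃ (_∈ L)) n) →
        ⟦ e₁ ⟧ (Vec.map proj₁ ρ) ≈ ⟦ e₂ ⟧ (Vec.map proj₁ ρ) →
        ⟦ e₁ ⟧ (Vec.map (proj₁ ∘ to σ) ρ) ≈ ⟦ e₂ ⟧ (Vec.map (proj₁ ∘ to σ) ρ)
      image-equation σ n f ρ e₁≈e₂ = trans (sym (image-⟦⟧ σ e₁ ρ (mem e₁)))
        (trans (image-cong σ (mem e₁) (mem e₂) e₁≈e₂) (image-⟦⟧ σ e₂ ρ (mem e₂)))
        where
        e₁ = proj₁ (f $ⁿ vars n)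
        e₂ = proj₂ (f $ⁿ vars n)

        ρ-∈ : ∀ {n} (ρ : Vec (∃ (_∈ L)) n) → VecAll.All (_∈ L) (Vec.map proj₁ ρ)
        ρ-∈ []              = []
        ρ-∈ ((_ , x∈L) ∷ ρ) = x∈L ∷ ρ-∈ ρ

        mem : ∀ e → ⟦ e ⟧ (Vec.map proj₁ ρ) ∈ L
        mem e = ⟦ e ⟧-∈ L (ρ-∈ ρ)

      -- As the set of agreement is a field, agreement on `x₁` and `x₂` spreads to all of L by
      -- minimality.
      equaliser : (σ τ : Aut) → Intermediate
      equaliser σ τ = intermediate (λ x → Σ (x ∈ L) λ x∈L → image σ x∈L ≈ image τ x∈L)
        (λ { x≈y (x∈L , eq) → ∈-resp L x≈y x∈L ,
             trans (image-cong σ _ x∈L (sym x≈y)) (trans eq (image-cong τ x∈L _ x≈y)) })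
        (λ x∈M → base⊆ L x∈M , trans (image-base σ _ x∈M) (sym (image-base τ _ x∈M)))
        (λ { (x∈L , p) (y∈L , q) → Intermediate.+-closed L x∈L y∈L ,
             trans (+-homo σ (_ , x∈L) (_ , y∈L)) (trans (+-cong p q) (sym (+-homo τ (_ , x∈L) (_ , y∈L)))) })
        (λ { (x∈L , p) (y∈L , q) → Intermediate.*-closed L x∈L y∈L ,
             trans (*-homo σ (_ , x∈L) (_ , y∈L)) (trans (*-cong p q) (sym (*-homo τ (_ , x∈L) (_ , y∈L)))) })
        (λ { (x∈L , p) → Intermediate.-‿closed L x∈L ,
             trans (-‿homo σ (_ , x∈L)) (trans (-‿cong p) (sym (-‿homo τ (_ , x∈L)))) })

      -- Required for every polynomial that represents x, so that an image can be computed from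
      -- whichever representation is at hand.
      Sends : Intermediate → Carrier → Carrier → Aut → Set (c ⊔ ℓ₁)
      Sends E θ θ′ σ = ∀ {p} → All (_∈ E) p → ∀ {x} (x∈L : x ∈ L) → x ≈ eval p θ → image σ x∈L ≈ eval p θ′

      opaque
        -- An automorphism is determined by a generator θ of L over E and its image θ′;
        -- conversely θ′ can be any generator satisfying the same equations over E.
        extend : ∀ E {θ θ′} → L ⊑ E ⟨ θ ⟩ → E ⊑ L → θ ∈ L → θ′ ∈ L → L ⊑ E ⟨ θ′ ⟩ →
          (∀ {p} → All (_∈ E) p → eval p θ ≈ 0# → eval p θ′ ≈ 0#) →
          (∀ {p} → All (_∈ E) p → eval p θ′ ≈ 0# → eval p θ ≈ 0#) →
          ∃ (Sends E θ θ′)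
        extend E {θ} {θ′} L⊑ E⊑L θ∈L θ′∈L L⊑′ conj conj′ = automorphism , λ p∈E x∈L x≈ → f-eval x∈L p∈E x≈
          where
          -- Well-definedness: polynomials with the same value at s differ by one that vanishes at
          -- s, hence also at t.
          transfer : ∀ {s t} → (∀ {p} → All (_∈ E) p → eval p s ≈ 0# → eval p t ≈ 0#) →
            ∀ {p q} → All (_∈ E) p → All (_∈ E) q → eval p s ≈ eval q s → eval p t ≈ eval q t
          transfer {s} {t} specialise {p} {q} p∈E q∈E p≈q = difference-zero (trans (sym (difference t))
            (specialise (+ₚ-∈ E p∈E (negₚ-∈ E q∈E)) (trans (difference s) (trans (+-congʳ p≈q) (-‿inverseʳ _)))))
            where
            difference : ∀ u → eval (p +ₚ List.map -_ q) u ≈ eval p u - eval q u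
            difference u = trans (eval-+ₚ p (List.map -_ q) u) (+-congˡ (eval-neg q u))

          f : ∃ (_∈ L) → ∃ (_∈ L)
          f (x , x∈L) = eval (proj₁ (⟨⟩-elim {E} {θ} (L⊑ x∈L))) θ′ , eval-∈ L (All.map E⊑L (proj₁ (proj₂ (⟨⟩-elim {E} {θ} (L⊑ x∈L))))) θ′∈L

          f-eval : ∀ {x} (x∈L : x ∈ L) {p} → All (_∈ E) p → x ≈ eval p θ → proj₁ (f (x , x∈L)) ≈ eval p θ′
          f-eval x∈L q∈E x≈q = transfer conj (proj₁ (proj₂ (⟨⟩-elim {E} {θ} (L⊑ x∈L)))) q∈E
            (trans (sym (proj₂ (proj₂ (⟨⟩-elim {E} {θ} (L⊑ x∈L))))) x≈q)

          constant : ∀ x t → x ≈ eval (x ∷ []) t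
          constant = solve 2 λ x t → x ⊜ x ⊕ t ⊗ 𝟘

          automorphism : Aut
          automorphism = record
            { to = f
            ; isRingIsomorphism = record
              { isRingMonomorphism = record
                { isRingHomomorphism = record
                  { isSemiringHomomorphism = record
                    { isNearSemiringHomomorphism = record
                      { +-isMonoidHomomorphism = record
                        { isMagmaHomomorphism = record
                          { isRelHomomorphism = record
                            { cong = λ { {_ , x∈L} {_ , y∈L} x≈y →
                                let p , p∈E , y≈p = ⟨⟩-elim {E} {θ} (L⊑ y∈L) in f-eval x∈L p∈E (trans x≈y y≈p) } }
                          ; homo = λ (_ , x∈L) (_ , y∈L) →
                              let p , p∈E , x≈p = ⟨⟩-elim {E} {θ} (L⊑ x∈L)
                                  q , q∈E , y≈q = ⟨⟩-elim {E} {θ} (L⊑ y∈L)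
                              in trans
                                (f-eval _ (+ₚ-∈ E p∈E q∈E) (trans (+-cong x≈p y≈q) (sym (eval-+ₚ p q θ))))
                                (eval-+ₚ p q θ′)
                          }
                        ; ε-homo = f-eval _ [] refl
                        }
                      ; *-homo = λ (_ , x∈L) (_ , y∈L) →
                          let p , p∈E , x≈p = ⟨⟩-elim {E} {θ} (L⊑ x∈L)
                              q , q∈E , y≈q = ⟨⟩-elim {E} {θ} (L⊑ y∈L)
                          in trans
                            (f-eval _ (*ₚ-∈ E p∈E q∈E) (trans (*-cong x≈p y≈q) (sym (eval-*ₚ p q θ))))
                            (eval-*ₚ p q θ′)
                      }
                    ; 1#-homo = trans (f-eval _ (Intermediate.1-closed E ∷ []) (constant 1# θ))
                                      (sym (constant 1# θ′))
                    }
                  ; -‿homo = λ (_ , x∈L) →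
                      let p , p∈E , x≈p = ⟨⟩-elim {E} {θ} (L⊑ x∈L) in trans
                        (f-eval _ (negₚ-∈ E p∈E) (trans (-‿cong x≈p) (sym (eval-neg p θ))))
                        (eval-neg p θ′)
                  }
                ; injective = λ { {_ , x∈L} {_ , y∈L} fx≈fy →
                    let p , p∈E , x≈p = ⟨⟩-elim {E} {θ} (L⊑ x∈L)
                        q , q∈E , y≈q = ⟨⟩-elim {E} {θ} (L⊑ y∈L)
                    in trans x≈p (trans (transfer conj′ p∈E q∈E fx≈fy) (sym y≈q)) }
                }
              ; surjective = λ (y , y∈L) →
                  let p , p∈E , y≈p = ⟨⟩-elim {E} {θ′} (L⊑′ y∈L)
                  in (eval p θ , eval-∈ L (All.map E⊑L p∈E) θ∈L) ,
                     λ { {_ , z∈L} z≈ → trans (f-eval z∈L p∈E z≈) (sym y≈p) }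
              }
            ; fixesBase = λ (x , x∈L) x∈M →
                trans (f-eval x∈L (base⊆ E x∈M ∷ []) (constant x θ)) (sym (constant x θ′))
            }

    module _ {A B L} (S : SplittingField A B L) where
      open SplittingField S
      open Automorphisms L

      private
        module G = Group (Gal (Intermediate.subfield L))

      automorphisms-agree : ∀ σ τ → image σ x₁∈L ≈ image τ x₁∈L → image σ x₂∈L ≈ image τ x₂∈L → σ G.≈ τ
      automorphisms-agree σ τ p q (x , x∈L) with least (equaliser σ τ) (x₁∈L , p) (x₂∈L , q) x∈L
      ... | x∈L′ , eq = trans (image-cong σ x∈L x∈L′ refl) (trans eq (image-cong τ x∈L′ x∈L refl))

      image-relation : ∀ σ n (f : N-ary n Expr (Expr × Expr)) →
        let e₁ = proj₁ (f $ⁿ vars n); e₂ = proj₂ (f $ⁿ vars n) in (ρ : Vec (∃ (_∈ L)) n) (ρ′ : Vec Carrier n) →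
        Pointwise _≈_ (Vec.map (proj₁ ∘ Automorphism.to σ) ρ) ρ′ →
        ⟦ e₁ ⟧ (Vec.map proj₁ ρ) ≈ ⟦ e₂ ⟧ (Vec.map proj₁ ρ) → ⟦ e₁ ⟧ ρ′ ≈ ⟦ e₂ ⟧ ρ′
      image-relation σ n f ρ ρ′ σρ≈ρ′ e₁≈e₂ =
        trans (sym (⟦⟧-congᵥ (proj₁ (f $ⁿ vars n)) σρ≈ρ′))
          (trans (image-equation σ n f ρ e₁≈e₂) (⟦⟧-congᵥ (proj₂ (f $ⁿ vars n)) σρ≈ρ′))

      image-root : ∀ σ {x} (x∈L : x ∈ L) → cubic (- (3 · A)) (- B) x ≈ 0# →
        image σ x∈L ≈ x₁ ⊎ image σ x∈L ≈ x₂ ⊎ image σ x∈L ≈ x₃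
      image-root σ {x} x∈L root = root-cases
        (image-relation σ 3 (λ A B t → t ↑ 3 ⊕ ⊝ (3 ⊙ A) ⊗ t ⊕ ⊝ B ⊜ 𝟘)
          ((A , A∈ L) ∷ (B , B∈ L) ∷ (x , x∈L) ∷ []) (A ∷ B ∷ image σ x∈L ∷ [])
          (image-base σ (A∈ L) A∈M ∷ image-base σ (B∈ L) B∈M ∷ refl ∷ [])
          root)

      private
        -- This is the relation `successor` from a root to the following one. When `ω` is rational
        -- its coefficients are fixed by every automorphism, so automorphisms preserve the cyclic
        -- order of the roots.
        Next : Carrier → Carrier → Set ℓ₁
        Next s t = (s ^ 2 - A) * t ≈ ω - A * s

        next₂ : Next x₂ x₃
        next₂ = solveᵣ [] λ g h A B → ((g ⊕ 2 ⊙ h) ↑ 2 ⊖ A) ⊗ ⊝ (2 ⊙ g ⊕ h) ⊜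
          (g ↑ 3 ⊖ 3 ⊙ (g ↑ 2 ⊗ h) ⊖ 6 ⊙ (g ⊗ h ↑ 2) ⊖ h ↑ 3) ⊖ A ⊗ (g ⊕ 2 ⊙ h)

        next₃ : Next x₃ x₁
        next₃ = solveᵣ [] λ g h A B → ((⊝ (2 ⊙ g ⊕ h)) ↑ 2 ⊖ A) ⊗ (g ⊖ h) ⊜
          (g ↑ 3 ⊖ 3 ⊙ (g ↑ 2 ⊗ h) ⊖ 6 ⊙ (g ⊗ h ↑ 2) ⊖ h ↑ 3) ⊖ A ⊗ ⊝ (2 ⊙ g ⊕ h)

        x₂²≉A : ¬ x₂ ^ 2 - A ≈ 0#
        x₂²≉A p = Roots.x₁²≉A rotate
          (trans (+-congʳ (^-cong 2 rotate-x₁)) p)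
          where open Rotation roots

        x₃²≉A : ¬ x₃ ^ 2 - A ≈ 0#
        x₃²≉A p = Roots.x₁²≉A (Rotation.rotate rotate)
          (trans (+-congʳ (^-cong 2 (trans (Rotation.rotate-x₁ rotate) rotate-x₂))) p)
          where open Rotation roots

        next-unique : ∀ {s s′ t t′} → ¬ s ^ 2 - A ≈ 0# → Next s t → s′ ≈ s → Next s′ t′ → t′ ≈ t
        next-unique s²≉A n s′≈s n′ = *-cancel s²≉A (trans (*-congʳ (+-congʳ (^-cong 2 (sym s′≈s))))
          (trans n′ (trans (+-congˡ (-‿cong (*-congˡ s′≈s))) (sym n))))

        next-image : ω ∈ base-field → ∀ σ {s t} (s∈L : s ∈ L) (t∈L : t ∈ L) → Next s t →
          Next (image σ s∈L) (image σ t∈L)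
        next-image ω∈M σ {s} {t} s∈L t∈L = image-relation σ 4
          (λ A ω s t → (s ↑ 2 ⊖ A) ⊗ t ⊜ ω ⊖ A ⊗ s)
          ((A , A∈ L) ∷ (ω , base⊆ L ω∈M) ∷ (s , s∈L) ∷ (t , t∈L) ∷ [])
          (A ∷ ω ∷ image σ s∈L ∷ image σ t∈L ∷ [])
          (image-base σ (A∈ L) A∈M ∷ image-base σ (base⊆ L ω∈M) ω∈M ∷ refl ∷ refl ∷ [])

        cube-fixes : ∀ σ {x y z} (x∈L : x ∈ L) (y∈L : y ∈ L) (z∈L : z ∈ L) →
          image σ x∈L ≈ y → image σ y∈L ≈ z → image σ z∈L ≈ x → image (σ G.∙ (σ G.∙ σ)) x∈L ≈ x
        cube-fixes σ x∈L y∈L z∈L p q r = trans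
          (image-cong σ (image-∈ σ (image-∈ σ x∈L)) z∈L (trans (image-cong σ (image-∈ σ x∈L) y∈L p) q)) r

        square-fixes : ∀ σ {x y} (x∈L : x ∈ L) (y∈L : y ∈ L) →
          image σ x∈L ≈ y → image σ y∈L ≈ x → image (σ G.∙ σ) x∈L ≈ x
        square-fixes σ x∈L y∈L p q = trans (image-cong σ (image-∈ σ x∈L) y∈L p) q

      cube-trivial : ω ∈ base-field → ∀ σ → σ G.∙ (σ G.∙ σ) G.≈ G.ε
      cube-trivial ω∈M σ = fixes (image-root σ x₁∈L root₁)
        where
        s₁₂ = next-image ω∈M σ x₁∈L x₂∈L successor
        s₂₃ = next-image ω∈M σ x₂∈L x₃∈L next₂

        agree = automorphisms-agree (σ G.∙ (σ G.∙ σ)) G.ε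

        fixes : image σ x₁∈L ≈ x₁ ⊎ image σ x₁∈L ≈ x₂ ⊎ image σ x₁∈L ≈ x₃ → σ G.∙ (σ G.∙ σ) G.≈ G.ε
        fixes (inj₁ p) = agree (cube-fixes σ x₁∈L x₁∈L x₁∈L p p p) (cube-fixes σ x₂∈L x₂∈L x₂∈L q q q)
          where
          q : image σ x₂∈L ≈ x₂
          q = next-unique x₁²≉A successor p s₁₂
        fixes (inj₂ (inj₁ p)) = agree (cube-fixes σ x₁∈L x₂∈L x₃∈L p q r) (cube-fixes σ x₂∈L x₃∈L x₁∈L q r p)
          where
          q : image σ x₂∈L ≈ x₃
          q = next-unique x₂²≉A next₂ p s₁₂

          r : image σ x₃∈L ≈ x₁
          r = next-unique x₃²≉A next₃ q s₂₃
        fixes (inj₂ (inj₂ p)) = agree (cube-fixes σ x₁∈L x₃∈L x₂∈L p r q) (cube-fixes σ x₂∈L x₁∈L x₃∈L q p r)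
          where
          q : image σ x₂∈L ≈ x₁
          q = next-unique x₃²≉A next₃ p s₁₂

          r : image σ x₃∈L ≈ x₂
          r = next-unique x₁²≉A successor q s₂₃

      square-trivial : x₁ ∈ base-field → ∀ σ → σ G.∙ σ G.≈ G.ε
      square-trivial x₁∈M σ = automorphisms-agree (σ G.∙ σ) G.ε
        (square-fixes σ x₁∈L x₁∈L p p) (fixes (image-root σ x₂∈L root₂))
        where
        p : image σ x₁∈L ≈ x₁
        p = image-base σ x₁∈L x₁∈M

        r : image σ x₃∈L ≈ - image σ x₁∈L - image σ x₂∈L
        r = image-relation σ 3 (λ x y z → z ⊜ ⊝ x ⊖ y) ((_ , x₁∈L) ∷ (_ , x₂∈L) ∷ (_ , x₃∈L) ∷ [])
          (image σ x₁∈L ∷ image σ x₂∈L ∷ image σ x₃∈L ∷ [])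
          (refl ∷ refl ∷ refl ∷ []) third-root

        fixes : image σ x₂∈L ≈ x₁ ⊎ image σ x₂∈L ≈ x₂ ⊎ image σ x₂∈L ≈ x₃ → image (σ G.∙ σ) x₂∈L ≈ x₂
        fixes (inj₁ q) = contradiction (image-injective σ x₁∈L x₂∈L (trans p (sym q))) x₁≉x₂
        fixes (inj₂ (inj₁ q)) = square-fixes σ x₂∈L x₂∈L q q
        fixes (inj₂ (inj₂ q)) = square-fixes σ x₂∈L x₃∈L q
          (trans r (trans (+-cong (-‿cong p) (-‿cong q))
            (solve 2 (λ g h → ⊝ (g ⊖ h) ⊖ ⊝ (2 ⊙ g ⊕ h) ⊜ g ⊕ 2 ⊙ h) g h)))

      Gal-trivial : x₁ ∈ base-field → x₂ ∈ base-field → ∀ σ → σ G.≈ G.ε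
      Gal-trivial x₁∈M x₂∈M σ = automorphisms-agree σ G.ε
        (image-base σ x₁∈L x₁∈M) (image-base σ x₂∈L x₂∈M)

      M⟨x₁⟩⊑L : M⟨x₁⟩ ⊑ L
      M⟨x₁⟩⊑L = ⟨⟩-least {base-field} {L} (base⊆ L) x₁∈L

      second-root : x₂ ≈ - x₁ - x₃
      second-root = solve 2 (λ g h → g ⊕ 2 ⊙ h ⊜ ⊝ (g ⊖ h) ⊖ ⊝ (2 ⊙ g ⊕ h)) g h

      opaque
        -- Over `M⟨x₁⟩` both `x₂` and `x₃` are roots of `X² + x₁X + x₁² - 3A`. Neither lies in that
        -- field, so a linear remainder vanishing at one of them is zero and vanishes at the other.
        conjugation : x₂ ∉ M⟨x₁⟩ → Σ Aut λ σ → image σ x₁∈L ≈ x₁ × image σ x₂∈L ≈ x₃ × image σ x₃∈L ≈ x₂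
        conjugation x₂∉ = σ ,
          trans (proj₂ extension (x₁∈E ∷ []) x₁∈L (solve 2 (λ x t → x ⊜ x ⊕ t ⊗ 𝟘) x₁ x₂))
            (solve 2 (λ x t → x ⊕ t ⊗ 𝟘 ⊜ x) x₁ x₃) ,
          trans (proj₂ extension (Intermediate.0-closed M⟨x₁⟩ ∷ Intermediate.1-closed M⟨x₁⟩ ∷ []) x₂∈L
                   (solve 1 (λ t → t ⊜ 𝟘 ⊕ t ⊗ (𝟙 ⊕ t ⊗ 𝟘)) x₂))
            (solve 1 (λ t → 𝟘 ⊕ t ⊗ (𝟙 ⊕ t ⊗ 𝟘) ⊜ t) x₃) ,
          trans (proj₂ extension (Intermediate.-‿closed M⟨x₁⟩ x₁∈E ∷ Intermediate.-‿closed M⟨x₁⟩ (Intermediate.1-closed M⟨x₁⟩) ∷ []) x₃∈L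
                   (solve 2 (λ g h → ⊝ (2 ⊙ g ⊕ h) ⊜ ⊝ (g ⊖ h) ⊕ (g ⊕ 2 ⊙ h) ⊗ (⊝ 𝟙 ⊕ (g ⊕ 2 ⊙ h) ⊗ 𝟘)) g h))
            (solve 2 (λ g h → let z = ⊝ (2 ⊙ g ⊕ h) in ⊝ (g ⊖ h) ⊕ z ⊗ (⊝ 𝟙 ⊕ z ⊗ 𝟘) ⊜ g ⊕ 2 ⊙ h) g h)
          where
          x₁∈E : x₁ ∈ M⟨x₁⟩
          x₁∈E = ⟨⟩-generator {base-field}

          x₃∉ : x₃ ∉ M⟨x₁⟩
          x₃∉ x₃∈ = x₂∉ (∈-resp M⟨x₁⟩ (sym second-root)
            (closed M⟨x₁⟩ 2 (λ x z → ⊝ x ⊖ z) (x₁∈E ∷ x₃∈ ∷ [])))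

          L⊑₂ : L ⊑ M⟨x₁⟩ ⟨ x₂ ⟩
          L⊑₂ = least (M⟨x₁⟩ ⟨ x₂ ⟩) (⟨⟩-base {M⟨x₁⟩} x₁∈E) (⟨⟩-generator {M⟨x₁⟩})

          L⊑₃ : L ⊑ M⟨x₁⟩ ⟨ x₃ ⟩
          L⊑₃ = least E₃ x₁∈E₃ (∈-resp E₃ (sym second-root)
            (closed E₃ 2 (λ x z → ⊝ x ⊖ z) (x₁∈E₃ ∷ ⟨⟩-generator {M⟨x₁⟩} ∷ [])))
            where
            E₃ : Intermediate
            E₃ = M⟨x₁⟩ ⟨ x₃ ⟩

            x₁∈E₃ : x₁ ∈ E₃
            x₁∈E₃ = ⟨⟩-base {M⟨x₁⟩} {x₃} x₁∈E

          conjugate : ∀ {s t} → s ∉ M⟨x₁⟩ → s ^ 2 ≈ - x₁ * s + (3 · A - x₁ ^ 2) →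
            t ^ 2 ≈ - x₁ * t + (3 · A - x₁ ^ 2) →
            ∀ {p} → All (_∈ M⟨x₁⟩) p → eval p s ≈ 0# → eval p t ≈ 0#
          conjugate {s} {t} s∉ s² t² {p} p∈E ps≈0
            with quadratic-remainder M⟨x₁⟩ (Intermediate.-‿closed M⟨x₁⟩ x₁∈E)
                   (closed M⟨x₁⟩ 2 (λ A x → 3 ⊙ A ⊖ x ↑ 2) (A∈ M⟨x₁⟩ ∷ x₁∈E ∷ [])) p∈E
          ... | u , v , u∈E , v∈E , p≈ = trans (p≈ t t²)
            (trans (solve 4 (λ u v s t → u ⊕ v ⊗ t ⊜ 𝟘 ⊕ 𝟙 ⊗ ((u ⊕ v ⊗ s) ⊖ 𝟘) ⊕ (t ⊖ s) ⊗ (v ⊖ 𝟘)) u v s t)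
                   (absorb₂ linear v≈0))
            where
            linear : u + v * s ≈ 0#
            linear = trans (sym (p≈ s s²)) ps≈0

            v≈0 : v ≈ 0#
            v≈0 with zero? v
            ... | yes v≈0 = v≈0
            ... | no  v≉0 = contradiction (solution-∈ M⟨x₁⟩ s v≉0 linear v∈E u∈E) s∉

          extension : ∃ (Sends M⟨x₁⟩ x₂ x₃)
          extension = extend M⟨x₁⟩ L⊑₂ M⟨x₁⟩⊑L x₂∈L x₃∈L L⊑₃
            (conjugate x₂∉ x₂-quadratic x₃-quadratic) (conjugate x₃∉ x₃-quadratic x₂-quadratic)

          σ : Aut
          σ = proj₁ extension

        -- With `ω` rational, each of `x₁` and `x₂` generates L over M. A polynomial vanishing at
        -- one of them has remainder zero modulo the cubic, hence vanishes at the other.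
        cyclic-shift : Irreducibleᶜ base-field → ω ∈ base-field → Σ Aut λ σ → image σ x₁∈L ≈ x₂
        cyclic-shift irreducible ω∈M = proj₁ extension ,
          trans (proj₂ extension (Intermediate.0-closed base-field ∷ Intermediate.1-closed base-field ∷ []) x₁∈L
                   (solve 1 (λ t → t ⊜ 𝟘 ⊕ t ⊗ (𝟙 ⊕ t ⊗ 𝟘)) x₁))
            (solve 1 (λ t → 𝟘 ⊕ t ⊗ (𝟙 ⊕ t ⊗ 𝟘) ⊜ t) x₂)
          where
          E₂ : Intermediate
          E₂ = base-field ⟨ x₂ ⟩

          x₂∈E₂ : x₂ ∈ E₂
          x₂∈E₂ = ⟨⟩-generator {base-field}

          x₃∈E₂ : x₃ ∈ E₂
          x₃∈E₂ = quotient-∈ E₂ x₂²≉A next₂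
            (closed E₂ 2 (λ x A → x ↑ 2 ⊖ A) (x₂∈E₂ ∷ A∈ E₂ ∷ []))
            (closed E₂ 3 (λ x A ω → ω ⊖ A ⊗ x) (x₂∈E₂ ∷ A∈ E₂ ∷ base⊆ E₂ ω∈M ∷ []))

          x₁∈E₂ : x₁ ∈ E₂
          x₁∈E₂ = ∈-resp E₂ (solve 2 (λ g h → ⊝ (g ⊕ 2 ⊙ h) ⊖ ⊝ (2 ⊙ g ⊕ h) ⊜ g ⊖ h) g h)
            (closed E₂ 2 (λ x y → ⊝ x ⊖ y) (x₂∈E₂ ∷ x₃∈E₂ ∷ []))

          conjugate : ∀ {s t} → cubic (- (3 · A)) (- B) s ≈ 0# → cubic (- (3 · A)) (- B) t ≈ 0# →
            ∀ {p} → All (_∈ base-field) p → eval p s ≈ 0# → eval p t ≈ 0#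
          conjugate {s} {t} s-root t-root {p} p∈M ps≈0
            with cubic-remainder base-field (P∈ base-field) (Q∈ base-field) p∈M
          ... | r₀ , r₁ , r₂ , r₀∈M , r₁∈M , r₂∈M , p≈
            with powers-independent base-field (P∈ base-field) (Q∈ base-field) irreducible s-root r₀∈M r₁∈M r₂∈M
                   (trans (sym (p≈ s s-root)) ps≈0)
          ... | r₀≈0 , r₁≈0 , r₂≈0 = trans (p≈ t t-root)
            (trans (solve 4 (λ r₀ r₁ r₂ t → r₀ ⊕ r₁ ⊗ t ⊕ r₂ ⊗ t ↑ 2 ⊜
                      𝟘 ⊕ 𝟙 ⊗ (r₀ ⊖ 𝟘) ⊕ t ⊗ (r₁ ⊖ 𝟘) ⊕ t ↑ 2 ⊗ (r₂ ⊖ 𝟘)) r₀ r₁ r₂ t)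
                   (absorb₃ r₀≈0 r₁≈0 r₂≈0))

          extension : ∃ (Sends base-field x₁ x₂)
          extension = extend base-field
            (least M⟨x₁⟩ (⟨⟩-generator {base-field})
              (x₂∈ M⟨x₁⟩ (⟨⟩-generator {base-field}) (base⊆ M⟨x₁⟩ ω∈M)))
            (base⊆ L) x₁∈L x₂∈L (least E₂ x₁∈E₂ x₂∈E₂)
            (conjugate root₁ root₂) (conjugate root₂ root₁)

      -- If `x₂` were in `M⟨x₁⟩`, so would be `ω`; being quadratic inside a cubic extension, it
      -- would be rational.
      ω∉⇒x₂∉ : Irreducibleᶜ base-field → ω ∉ base-field → x₂ ∉ M⟨x₁⟩
      ω∉⇒x₂∉ irreducible ω∉M x₂∈ = ω∉M
        (quadratic∩cubic {base-field} (P∈ base-field) (Q∈ base-field) irreducible root₁ (ω-quadratic base-field)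
          (ω∈ M⟨x₁⟩ (⟨⟩-generator {base-field}) x₂∈))

    -- What the Galois group says about ω and the roots

    -- Rotations suffice to bring a rational root to the first place and, unlike transpositions,
    -- leave `ω` unchanged.
    record Relabelling {A B L} (S : SplittingField A B L) : Set (Level.suc (c ⊔ ℓ₁)) where
      field
        relabelled : SplittingField A B L
        ω-same     : SplittingField.ω relabelled ≈ SplittingField.ω S
        rational   : SplittingField.x₁ relabelled ∈ base-field

    rational-root : ∀ {A B L} (S : SplittingField A B L) →
      SplittingField.Irreducibleᶜ S base-field ⊎ Relabelling S
    rational-root S with holds? (x₁ ∈ base-field) | holds? (x₂ ∈ base-field) | holds? (x₃ ∈ base-field)
      where open SplittingField S
    ... | yes x₁∈M | _ | _ = inj₂ record { relabelled = S ; ω-same = refl ; rational = x₁∈M }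
    ... | no _ | yes x₂∈M | _ = inj₂ record
      { relabelled = rotateˢ S
      ; ω-same     = rotate-ω
      ; rational   = ∈-resp base-field (sym rotate-x₁) x₂∈M
      }
      where open Rotation (SplittingField.roots S)
    ... | no _ | no _ | yes x₃∈M = inj₂ record
      { relabelled = rotateˢ (rotateˢ S)
      ; ω-same     = trans (Rotation.rotate-ω rotate) rotate-ω
      ; rational   = ∈-resp base-field (sym (trans (Rotation.rotate-x₁ rotate) rotate-x₂)) x₃∈M
      }
      where open Rotation (SplittingField.roots S)
    ... | no x₁∉M | no x₂∉M | no x₃∉M = inj₁ λ r r∈M root →
      [ (λ r≈ → x₁∉M (∈-resp base-field r≈ r∈M))
      , [ (λ r≈ → x₂∉M (∈-resp base-field r≈ r∈M)) , (λ r≈ → x₃∉M (∈-resp base-field r≈ r∈M)) ]′ ]′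
      (SplittingField.root-cases S root)

    module _ {A B L} (S : SplittingField A B L) where
      open SplittingField S
      open Automorphisms L
      private
        G : Group _ _
        G = Gal (Intermediate.subfield L)
        module G = Group G

      ¬square-trivial⇒irreducible : ¬ (∀ σ → σ G.∙ σ G.≈ G.ε) → Irreducibleᶜ base-field
      ¬square-trivial⇒irreducible ¬trivial with rational-root S
      ... | inj₁ irreducible   = irreducible
      ... | inj₂ S′ = contradiction (square-trivial (Relabelling.relabelled S′) (Relabelling.rational S′)) ¬trivial

      involution : x₂ ∉ M⟨x₁⟩ → ∃ λ σ → σ G.∙ σ G.≈ G.ε × ¬ σ G.≈ G.ε
      involution x₂∉ with conjugation S x₂∉
      ... | σ , p , q , r = σ ,
        automorphisms-agree S (σ G.∙ σ) G.ε
          (trans (image-cong σ (image-∈ σ x₁∈L) x₁∈L p) p)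
          (trans (image-cong σ (image-∈ σ x₂∈L) x₃∈L q) r) ,
        λ σ≈ε → x₂≉x₃ (trans (sym (σ≈ε (x₂ , x₂∈L))) q)

      noncommuting : Irreducibleᶜ base-field → ω ∉ base-field → ¬ (∀ σ τ → σ G.∙ τ G.≈ τ G.∙ σ)
      noncommuting irreducible ω∉M comm = x₂≉x₃ (trans (sym στ) (trans (comm σ τ (x₁ , x₁∈L)) τσ))
        where
        open Rotation roots
        module S′ = SplittingField (rotateˢ S)

        σ-conjugation : Σ Aut λ σ → image σ x₁∈L ≈ x₁ × image σ x₂∈L ≈ x₃ × image σ x₃∈L ≈ x₂
        σ-conjugation = conjugation S (ω∉⇒x₂∉ S irreducible ω∉M)

        τ-conjugation : Σ Aut λ τ → image τ S′.x₁∈L ≈ S′.x₁ × image τ S′.x₂∈L ≈ S′.x₃ × image τ S′.x₃∈L ≈ S′.x₂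
        τ-conjugation = conjugation (rotateˢ S)
          (ω∉⇒x₂∉ (rotateˢ S) irreducible (λ ω∈M → ω∉M (∈-resp base-field rotate-ω ω∈M)))

        σ τ : Aut
        σ = proj₁ σ-conjugation
        τ = proj₁ τ-conjugation

        -- τ exchanges x₁ and x₃, whereas σ exchanges x₂ and x₃.
        τx₁ : image τ x₁∈L ≈ x₃
        τx₁ = trans (image-cong τ x₁∈L S′.x₃∈L (sym rotate-x₃))
          (trans (proj₂ (proj₂ (proj₂ τ-conjugation))) rotate-x₂)

        στ : image (σ G.∙ τ) x₁∈L ≈ x₂
        στ = trans (image-cong σ (image-∈ τ x₁∈L) x₃∈L τx₁) (proj₂ (proj₂ (proj₂ σ-conjugation)))

        τσ : image (τ G.∙ σ) x₁∈L ≈ x₃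
        τσ = trans (image-cong τ (image-∈ σ x₁∈L) x₁∈L (proj₁ (proj₂ σ-conjugation))) τx₁

      -- A rational root would make all squares trivial and a rational `ω` all cubes; a 3-cycle
      -- violates the former and a transposition the latter.
      𝔖₃⇒ : G ≅ 𝔖 3 → Irreducibleᶜ base-field × ω ∉ base-field
      𝔖₃⇒ iso =
        ¬square-trivial⇒irreducible (λ trivial → 3-cycle²≉ε (I.square-trivial trivial 3-cycle)) ,
        λ ω∈M → transposition³≉ε (I.cube-trivial (cube-trivial S ω∈M) transposition)
        where module I = Isomorphism {G = G} {H = 𝔖 3} iso

      C₃⇒ : G ≅ C 3 → Irreducibleᶜ base-field × ω ∈ base-field
      C₃⇒ iso = irreducible , ω∈M
        where
        module I = Isomorphism {G = G} {H = C 3} iso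

        irreducible : Irreducibleᶜ base-field
        irreducible = ¬square-trivial⇒irreducible (λ trivial → 1+1≉0-C₃ (I.square-trivial trivial (+ 1)))

        ω∈M : ω ∈ base-field
        ω∈M = decidable-stable (holds? _) λ ω∉M →
          let σ , σ²≈ε , σ≉ε = involution (ω∉⇒x₂∉ S irreducible ω∉M)
          in σ≉ε (C₃-no-involution {G = G} iso σ σ²≈ε)

      -- The cubic must have a rational root: without one, a rational `ω` would make all cubes
      -- trivial besides all squares, and an irrational `ω` would produce automorphisms that do not
      -- commute.
      C₂⇒ : G ≅ C 2 → Σ (Relabelling S) λ S′ → SplittingField.x₂ (Relabelling.relabelled S′) ∉ base-field
      C₂⇒ iso = [ (λ irreducible → ⊥-elim (reducible irreducible)) , (λ S′ → S′ ,
          λ x₂∈M → 1≉0-C₂ (I.trivial (Gal-trivial (Relabelling.relabelled S′) (Relabelling.rational S′) x₂∈M) (+ 1))) ]′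
        (rational-root S)
        where
        module I = Isomorphism {G = G} {H = C 2} iso

        reducible : ¬ Irreducibleᶜ base-field
        reducible irreducible = [ (λ ω∈M → 1≉0-C₂ (I.trivial (square∧cube-trivial {G = G}
            (C₂-square-trivial {G = G} iso) (cube-trivial S ω∈M)) (+ 1)))
          , (λ ω∉M → noncommuting irreducible ω∉M (I.commutative (C-properties.comm 2))) ]′
          (Dec.toSum (holds? (ω ∈ base-field)))

      trivial⇒ : Trivial G → x₁ ∈ base-field × x₂ ∈ base-field
      trivial⇒ σ≈ε = [ (λ irreducible → ⊥-elim (reducible irreducible)) , (λ S′ →
          let open Relabelling S′
              L⊑M : L ⊑ base-field
              L⊑M = SplittingField.least relabelled base-field rational (x₂∈M relabelled rational)
          in L⊑M x₁∈L , L⊑M x₂∈L) ]′ (rational-root S)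
        where
        reducible : ¬ Irreducibleᶜ base-field
        reducible irreducible = [
            (λ ω∈M → let σ , σx₁≈x₂ = cyclic-shift S irreducible ω∈M in
              x₁≉x₂ (trans (sym (σ≈ε σ (x₁ , x₁∈L))) σx₁≈x₂))
          , (λ ω∉M → let σ , _ , σ≉ε = involution (ω∉⇒x₂∉ S irreducible ω∉M) in σ≉ε (σ≈ε σ)) ]′
          (Dec.toSum (holds? (ω ∈ base-field)))

        x₂∈M : ∀ S′ → SplittingField.x₁ S′ ∈ base-field → SplittingField.x₂ S′ ∈ base-field
        x₂∈M S′ x₁∈M = decidable-stable (holds? _) λ x₂∉M →
          let σ , _ , σx₂≈x₃ , _ = conjugation S′ (λ x₂∈ → x₂∉M (⟨⟩-least {base-field} {base-field} id x₁∈M x₂∈))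
          in SplittingField.x₂≉x₃ S′
            (trans (sym (σ≈ε σ (SplittingField.x₂ S′ , SplittingField.x₂∈L S′))) σx₂≈x₃)

    -- Substitutions between the roots of two cubics

    -- The substitution y = vx + w(x² - 2A) takes the roots of X³ - 3AX - B to
    -- those of X³ - 3 (QF A B v w) X - NF A B v w, and multiplies the discriminant by δ².
    QF NF δ : Carrier → Carrier → Carrier → Carrier → Carrier
    QF A B v w = A * v ^ 2 + B * v * w + A ^ 2 * w ^ 2
    NF A B v w = B * v ^ 3 + 6 · (A ^ 2 * v ^ 2 * w) + 3 · (A * B * v * w ^ 2) + (B ^ 2 - 2 · A ^ 3) * w ^ 3
    δ  A B v w = v ^ 3 - 3 · (A * v * w ^ 2) - B * w ^ 3

    T : Carrier → Carrier → Carrier → Carrier → Carrier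
    T A v w x = v * x + w * (x ^ 2 - 2 · A)

    -- The constant term of the affine action `ω ↦ δ ω + μ`. Expressed through C it has w as its
    -- only unknown, and it equals `D Y` at `θ = 3w`.
    μ : Carrier → Carrier → Carrier → Carrier → Carrier
    μ A B C w = (4 · A ^ 3 - B ^ 2) * w ^ 3 - 3 · (A * C * w)

    private
      QE NE δE : Expr → Expr → Expr → Expr → Expr
      QE A B v w = A ⊗ v ↑ 2 ⊕ B ⊗ v ⊗ w ⊕ A ↑ 2 ⊗ w ↑ 2
      NE A B v w = B ⊗ v ↑ 3 ⊕ 6 ⊙ (A ↑ 2 ⊗ v ↑ 2 ⊗ w) ⊕ 3 ⊙ (A ⊗ B ⊗ v ⊗ w ↑ 2) ⊕ (B ↑ 2 ⊖ 2 ⊙ A ↑ 3) ⊗ w ↑ 3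
      δE A B v w = v ↑ 3 ⊖ 3 ⊙ (A ⊗ v ⊗ w ↑ 2) ⊖ B ⊗ w ↑ 3

      TE μE : Expr → Expr → Expr → Expr → Expr
      TE A v w x = v ⊗ x ⊕ w ⊗ (x ↑ 2 ⊖ 2 ⊙ A)
      μE A B C w = (4 ⊙ A ↑ 3 ⊖ B ↑ 2) ⊗ w ↑ 3 ⊖ 3 ⊙ (A ⊗ C ⊗ w)

      x₁E x₂E x₃E ωE ω′E : Expr → Expr → Expr
      x₁E g h = g ⊖ h
      x₂E g h = g ⊕ 2 ⊙ h
      x₃E g h = ⊝ (2 ⊙ g ⊕ h)
      ωE  g h = g ↑ 3 ⊖ 3 ⊙ (g ↑ 2 ⊗ h) ⊖ 6 ⊙ (g ⊗ h ↑ 2) ⊖ h ↑ 3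
      ω′E g h = g ↑ 3 ⊕ 6 ⊙ (g ↑ 2 ⊗ h) ⊕ 3 ⊙ (g ⊗ h ↑ 2) ⊖ h ↑ 3

      cubicE : Expr → Expr → Expr → Expr
      cubicE A B t = t ↑ 3 ⊕ ⊝ (3 ⊙ A) ⊗ t ⊕ ⊝ B

    cubic-cong : ∀ {A A′ B B′ t t′} → A ≈ A′ → B ≈ B′ → t ≈ t′ →
      cubic (- (3 · A)) (- B) t ≈ cubic (- (3 · A′)) (- B′) t′
    cubic-cong p q r = ⟦⟧-congᵥ (cubicE (var 0) (var 1) (var 2)) (p ∷ q ∷ r ∷ [])

    record Solution (A B C G v w : Carrier) : Set ℓ₁ where
      field
        C≈ : C ≈ QF A B v w
        G≈ : G ≈ NF A B v w

      private
        defs : Vec Expr 2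
        defs = QE (var 0) (var 1) (var 2) (var 3) ∷ NE (var 0) (var 1) (var 2) (var 3) ∷ []

      solveˢ : ∀ {k} (ρ : Vec Carrier k) (f : N-ary (4 ℕ.+ k ℕ.+ 2) Expr (Expr × Expr)) →
        let e₁ = proj₁ (f $ⁿ vars (4 ℕ.+ k ℕ.+ 2)); e₂ = proj₂ (f $ⁿ vars (4 ℕ.+ k ℕ.+ 2))
            σ = vars (4 ℕ.+ k) Vec.++ defs in
        {Bool.T (isZero {4 ℕ.+ k} (normalise (substitute σ e₁ ⊖ substitute σ e₂)))} →
        ⟦ e₁ ⟧ (A ∷ B ∷ v ∷ w ∷ ρ Vec.++ C ∷ G ∷ []) ≈ ⟦ e₂ ⟧ (A ∷ B ∷ v ∷ w ∷ ρ Vec.++ C ∷ G ∷ [])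
      solveˢ {k} ρ f {p} = solve-given (4 ℕ.+ k) defs f {p} (A ∷ B ∷ v ∷ w ∷ ρ) (C≈ ∷ G≈ ∷ [])

      discriminant : 4 · C ^ 3 - G ^ 2 ≈ (4 · A ^ 3 - B ^ 2) * δ A B v w ^ 2
      discriminant = solveˢ [] λ A B v w C G → 4 ⊙ C ↑ 3 ⊖ G ↑ 2 ⊜ (4 ⊙ A ↑ 3 ⊖ B ↑ 2) ⊗ δE A B v w ↑ 2

      -- As B is nonzero for an irreducible cubic, this recovers `δ` rationally from `μ`.
      2μ+G : 2 · μ A B C w + G ≈ B * δ A B v w
      2μ+G = solveˢ [] λ A B v w C G → 2 ⊙ μE A B C w ⊕ G ⊜ B ⊗ δE A B v w

      -- The equation for w obtained by eliminating v; it is F₂ = 0 for X = 3w.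
      resolvent : A ^ 3 * (2 · μ A B C w + G) ^ 2 ≈ B ^ 2 * (μ A B C w ^ 2 + G * μ A B C w + C ^ 3)
      resolvent = solveˢ [] λ A B v w C G → let m = μE A B C w in
        A ↑ 3 ⊗ (2 ⊙ m ⊕ G) ↑ 2 ⊜ B ↑ 2 ⊗ (m ↑ 2 ⊕ G ⊗ m ⊕ C ↑ 3)

      -- The inverse substitution has the same shape, with `(v² - Aw²) / δ` and `- w / δ` in place
      -- of v and w.
      inverse-T : ∀ x → cubic (- (3 · A)) (- B) x ≈ 0# →
        δ A B v w * x ≈ (v ^ 2 - A * w ^ 2) * T A v w x - w * (T A v w x ^ 2 - 2 · C)
      inverse-T x root = trans
        (solveˢ (x ∷ []) λ A B v w x C G → let y = TE A v w x in
          δE A B v w ⊗ x ⊜ (v ↑ 2 ⊖ A ⊗ w ↑ 2) ⊗ y ⊖ w ⊗ (y ↑ 2 ⊖ 2 ⊙ C)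
            ⊕ (2 ⊙ (v ⊗ w ↑ 2) ⊕ w ↑ 3 ⊗ x) ⊗ (cubicE A B x ⊖ 𝟘))
        (absorb root)

      -- Eliminating v² and v³ from the two equations leaves one that is linear in v.
      linear : B * (A * C - (4 · A ^ 3 - B ^ 2) * w ^ 2) * v ≈
        A ^ 2 * G - (6 · A ^ 3 - B ^ 2) * C * w + A ^ 2 * w ^ 3 * (8 · A ^ 3 - 2 · B ^ 2)
      linear = solveˢ [] λ A B v w C G →
        B ⊗ (A ⊗ C ⊖ (4 ⊙ A ↑ 3 ⊖ B ↑ 2) ⊗ w ↑ 2) ⊗ v ⊜
        A ↑ 2 ⊗ G ⊖ (6 ⊙ A ↑ 3 ⊖ B ↑ 2) ⊗ C ⊗ w ⊕ A ↑ 2 ⊗ w ↑ 3 ⊗ (8 ⊙ A ↑ 3 ⊖ 2 ⊙ B ↑ 2)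

    Solution-resp : ∀ {A B C G v w w′} → w ≈ w′ → Solution A B C G v w → Solution A B C G v w′
    Solution-resp w≈w′ sol = record
      { C≈ = trans (Solution.C≈ sol) (⟦⟧-congᵥ (QE (var 0) (var 1) (var 2) (var 3)) (refl ∷ refl ∷ refl ∷ w≈w′ ∷ []))
      ; G≈ = trans (Solution.G≈ sol) (⟦⟧-congᵥ (NE (var 0) (var 1) (var 2) (var 3)) (refl ∷ refl ∷ refl ∷ w≈w′ ∷ []))
      }

    module _ {A B C G w} (B≉0 : ¬ B ≈ 0#) (A≉0 : ¬ A ≈ 0#)
      (nondegenerate : ¬ A ^ 3 * G ^ 2 - C ^ 3 * (4 · A ^ 3 - B ^ 2) ≈ 0#)
      (R : A ^ 3 * (2 · μ A B C w + G) ^ 2 ≈ B ^ 2 * (μ A B C w ^ 2 + G * μ A B C w + C ^ 3)) where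

      -- Write `κ = 4A³ - B²`. If `κw² = AC`, the resolvent collapses to `A³G² + κC³ = 2ACGκw`.
      -- Squaring and using `κw² = AC` again gives `(A³G² - κC³)² = 0`, against nondegeneracy.
      derivative≉0 : ¬ A * C - (4 · A ^ 3 - B ^ 2) * w ^ 2 ≈ 0#
      derivative≉0 s≈0 = nondegenerate (zero-square (trans
        (solve 5 (λ A B C G w →
          let κ = 4 ⊙ A ↑ 3 ⊖ B ↑ 2; s = A ⊗ C ⊖ κ ⊗ w ↑ 2; X = A ↑ 3 ⊗ G ↑ 2 ⊕ κ ⊗ C ↑ 3; Y = 2 ⊙ (A ⊗ C ⊗ G ⊗ κ ⊗ w) in
          (A ↑ 3 ⊗ G ↑ 2 ⊖ C ↑ 3 ⊗ κ) ↑ 2 ⊜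
            𝟘 ⊕ (X ⊕ Y) ⊗ (X ⊖ Y) ⊕ (⊝ (4 ⊙ (A ↑ 2 ⊗ C ↑ 2 ⊗ G ↑ 2 ⊗ κ))) ⊗ (s ⊖ 𝟘)) A B C G w)
        (absorb₂ X≈Y s≈0)))
        where
        X≈Y : A ^ 3 * G ^ 2 + (4 · A ^ 3 - B ^ 2) * C ^ 3 ≈ 2 · (A * C * G * (4 · A ^ 3 - B ^ 2) * w)
        X≈Y = trans
          (solve 5 (λ A B C G w →
            let κ = 4 ⊙ A ↑ 3 ⊖ B ↑ 2; s = A ⊗ C ⊖ κ ⊗ w ↑ 2; m = μE A B C w in
            A ↑ 3 ⊗ G ↑ 2 ⊕ κ ⊗ C ↑ 3 ⊜
            2 ⊙ (A ⊗ C ⊗ G ⊗ κ ⊗ w)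
              ⊕ 𝟙 ⊗ (A ↑ 3 ⊗ (2 ⊙ m ⊕ G) ↑ 2 ⊖ B ↑ 2 ⊗ (m ↑ 2 ⊕ G ⊗ m ⊕ C ↑ 3))
              ⊕ (⊝ (⊝ (4 ⊙ (A ↑ 2 ⊗ C ↑ 2)) ⊕ 4 ⊙ (A ⊗ C ⊗ κ ⊗ w ↑ 2) ⊕ κ ⊗ w ↑ 2 ⊗ s ⊖ G ⊗ κ ⊗ w)) ⊗ (s ⊖ 𝟘))
            A B C G w)
          (absorb₂ R s≈0)

      private
        -- Coefficient and right-hand side of the equation `Solution.linear`.
        e n : Carrier
        e = B * (A * C - (4 · A ^ 3 - B ^ 2) * w ^ 2)
        n = A ^ 2 * G - (6 · A ^ 3 - B ^ 2) * C * w + A ^ 2 * w ^ 3 * (8 · A ^ 3 - 2 · B ^ 2)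

      e≉0 : ¬ e ≈ 0#
      e≉0 = nonzero-* B≉0 derivative≉0

      -- The linear equation dictates v. Substituting it turns `e² (C - QF)` into a multiple of the
      -- hypothesis `R`, and the equation for G then follows from that for C together with the
      -- linear one.
      solution : ∃ λ v → Solution A B C G v w ×
        (∀ E → A ∈ E → B ∈ E → C ∈ E → G ∈ E → w ∈ E → v ∈ E)
      solution = v , record { C≈ = C≈ ; G≈ = G≈ } , λ E A∈ B∈ C∈ G∈ w∈ → quotient-∈ E e≉0 ev≈n
        (closed E 4 (λ A B C w → B ⊗ (A ⊗ C ⊖ (4 ⊙ A ↑ 3 ⊖ B ↑ 2) ⊗ w ↑ 2)) (A∈ ∷ B∈ ∷ C∈ ∷ w∈ ∷ []))
        (closed E 5 (λ A B C G w →
            A ↑ 2 ⊗ G ⊖ (6 ⊙ A ↑ 3 ⊖ B ↑ 2) ⊗ C ⊗ w ⊕ A ↑ 2 ⊗ w ↑ 3 ⊗ (8 ⊙ A ↑ 3 ⊖ 2 ⊙ B ↑ 2))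
          (A∈ ∷ B∈ ∷ C∈ ∷ G∈ ∷ w∈ ∷ []))
        where
        v : Carrier
        v = proj₁ (divide e≉0 n)

        ev≈n : e * v ≈ n
        ev≈n = proj₂ (divide e≉0 n)

        C≈ : C ≈ QF A B v w
        C≈ = *-cancel (nonzero-* e≉0 e≉0) (trans
          (solve 6 (λ A B C G v w →
            let m = μE A B C w
                e = B ⊗ (A ⊗ C ⊖ (4 ⊙ A ↑ 3 ⊖ B ↑ 2) ⊗ w ↑ 2)
                n = A ↑ 2 ⊗ G ⊖ (6 ⊙ A ↑ 3 ⊖ B ↑ 2) ⊗ C ⊗ w ⊕ A ↑ 2 ⊗ w ↑ 3 ⊗ (8 ⊙ A ↑ 3 ⊖ 2 ⊙ B ↑ 2)
            in e ⊗ e ⊗ C ⊜ e ⊗ e ⊗ QE A B v w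
              ⊕ (⊝ (A ⊗ (e ⊗ v ⊕ n) ⊕ B ⊗ w ⊗ e)) ⊗ (e ⊗ v ⊖ n)
              ⊕ (⊝ (A ↑ 2)) ⊗ (A ↑ 3 ⊗ (2 ⊙ m ⊕ G) ↑ 2 ⊖ B ↑ 2 ⊗ (m ↑ 2 ⊕ G ⊗ m ⊕ C ↑ 3)))
            A B C G v w)
          (absorb₂ ev≈n R))

        G≈ : G ≈ NF A B v w
        G≈ = *-cancel (nonzero-* A≉0 A≉0) (trans
          (solve 6 (λ A B C G v w →
            let e = B ⊗ (A ⊗ C ⊖ (4 ⊙ A ↑ 3 ⊖ B ↑ 2) ⊗ w ↑ 2)
                n = A ↑ 2 ⊗ G ⊖ (6 ⊙ A ↑ 3 ⊖ B ↑ 2) ⊗ C ⊗ w ⊕ A ↑ 2 ⊗ w ↑ 3 ⊗ (8 ⊙ A ↑ 3 ⊖ 2 ⊙ B ↑ 2)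
            in A ⊗ A ⊗ G ⊜ A ⊗ A ⊗ NE A B v w
              ⊕ (A ⊗ B ⊗ v ⊕ (6 ⊙ A ↑ 3 ⊖ B ↑ 2) ⊗ w) ⊗ (C ⊖ QE A B v w)
              ⊕ (⊝ 𝟙) ⊗ (e ⊗ v ⊖ n))
            A B C G v w)
          (absorb₂ C≈ ev≈n))

      unique : ∀ {v v′} → Solution A B C G v w → Solution A B C G v′ w → v ≈ v′
      unique s s′ = *-cancel e≉0 (trans (Solution.linear s) (sym (Solution.linear s′)))

    module Transform {A B C G v w} (r : Roots A B) (s : Solution A B C G v w)
      (discriminant≉0 : ¬ 4 · C ^ 3 - G ^ 2 ≈ 0#) where
      open Roots r
      open Solution s

      private
        defs : Vec Expr 4
        defs = a ∷ b ∷ QE a b (var 2) (var 3) ∷ NE a b (var 2) (var 3) ∷ []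
          where
          a b : Expr
          a = var 0 ↑ 2 ⊕ var 0 ⊗ var 1 ⊕ var 1 ↑ 2
          b = (var 0 ⊖ var 1) ⊗ (var 0 ⊕ 2 ⊙ var 1) ⊗ ⊝ (2 ⊙ var 0 ⊕ var 1)

      solveᵗ : ∀ {k} (ρ : Vec Carrier k) (f : N-ary (4 ℕ.+ k ℕ.+ 4) Expr (Expr × Expr)) →
        let e₁ = proj₁ (f $ⁿ vars (4 ℕ.+ k ℕ.+ 4)); e₂ = proj₂ (f $ⁿ vars (4 ℕ.+ k ℕ.+ 4))
            σ = vars (4 ℕ.+ k) Vec.++ defs in
        {Bool.T (isZero {4 ℕ.+ k} (normalise (substitute σ e₁ ⊖ substitute σ e₂)))} →
        ⟦ e₁ ⟧ (g ∷ h ∷ v ∷ w ∷ ρ Vec.++ A ∷ B ∷ C ∷ G ∷ []) ≈ ⟦ e₂ ⟧ (g ∷ h ∷ v ∷ w ∷ ρ Vec.++ A ∷ B ∷ C ∷ G ∷ [])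
      solveᵗ {k} ρ f {p} = solve-given (4 ℕ.+ k) defs f {p} (g ∷ h ∷ v ∷ w ∷ ρ)
        (A≈ ∷ B≈
         ∷ trans C≈ (⟦⟧-congᵥ (QE (var 0) (var 1) (var 2) (var 3)) (A≈ ∷ B≈ ∷ refl ∷ refl ∷ []))
         ∷ trans G≈ (⟦⟧-congᵥ (NE (var 0) (var 1) (var 2) (var 3)) (A≈ ∷ B≈ ∷ refl ∷ refl ∷ []))
         ∷ [])

      y-roots : Roots C G
      y-roots = record
        -- The difference `y₁ - y₃` factors as `(x₁ - x₃) (v + w (x₁ + x₃))`, and `x₁ + x₃ = - x₂`;
        -- likewise for `y₂ - y₁`.
        { g = g * (v - w * x₂)
        ; h = h * (v - w * x₃)
        ; A≈ = solveᵗ [] λ g h v w A B C G →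
            let g′ = g ⊗ (v ⊖ w ⊗ x₂E g h); h′ = h ⊗ (v ⊖ w ⊗ x₃E g h)
            in C ⊜ g′ ↑ 2 ⊕ g′ ⊗ h′ ⊕ h′ ↑ 2
        ; B≈ = solveᵗ [] λ g h v w A B C G →
            let g′ = g ⊗ (v ⊖ w ⊗ x₂E g h); h′ = h ⊗ (v ⊖ w ⊗ x₃E g h)
            in G ⊜ (g′ ⊖ h′) ⊗ (g′ ⊕ 2 ⊙ h′) ⊗ ⊝ (2 ⊙ g′ ⊕ h′)
        ; Δ≉0 = λ Δ≈0 → discriminant≉0 (trans
            (solveᵗ [] λ g h v w A B C G →
              let g′ = g ⊗ (v ⊖ w ⊗ x₂E g h); h′ = h ⊗ (v ⊖ w ⊗ x₃E g h); Δ′ = g′ ⊗ h′ ⊗ (g′ ⊕ h′)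
              in 4 ⊙ C ↑ 3 ⊖ G ↑ 2 ⊜ 𝟘 ⊕ (27 ⊙ Δ′) ⊗ (Δ′ ⊖ 𝟘))
            (absorb Δ≈0))
        }

      module y = Roots y-roots

      y₁≈ : y.x₁ ≈ T A v w x₁
      y₁≈ = solveᵗ [] λ g h v w A B C G →
        let g′ = g ⊗ (v ⊖ w ⊗ x₂E g h); h′ = h ⊗ (v ⊖ w ⊗ x₃E g h) in x₁E g′ h′ ⊜ TE A v w (x₁E g h)

      y₂≈ : y.x₂ ≈ T A v w x₂
      y₂≈ = solveᵗ [] λ g h v w A B C G →
        let g′ = g ⊗ (v ⊖ w ⊗ x₂E g h); h′ = h ⊗ (v ⊖ w ⊗ x₃E g h) in x₂E g′ h′ ⊜ TE A v w (x₂E g h)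

      y₃≈ : y.x₃ ≈ T A v w x₃
      y₃≈ = solveᵗ [] λ g h v w A B C G →
        let g′ = g ⊗ (v ⊖ w ⊗ x₂E g h); h′ = h ⊗ (v ⊖ w ⊗ x₃E g h) in x₃E g′ h′ ⊜ TE A v w (x₃E g h)

      ω-transform : y.ω ≈ δ A B v w * ω + μ A B C w
      ω-transform = solveᵗ [] λ g h v w A B C G →
        let g′ = g ⊗ (v ⊖ w ⊗ x₂E g h); h′ = h ⊗ (v ⊖ w ⊗ x₃E g h)
        in ωE g′ h′ ⊜ δE A B v w ⊗ ωE g h ⊕ μE A B C w

      ω′-transform : y.ω′ ≈ δ A B v w * ω′ + μ A B C w
      ω′-transform = solveᵗ [] λ g h v w A B C G →
        let g′ = g ⊗ (v ⊖ w ⊗ x₂E g h); h′ = h ⊗ (v ⊖ w ⊗ x₃E g h)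
        in ω′E g′ h′ ⊜ δE A B v w ⊗ ω′E g h ⊕ μE A B C w

    opaque
      -- An element y of E(x₁) is a quadratic polynomial in x₁; comparing its
      -- characteristic polynomial with X³ - 3CX - G gives a solution in E.
      solution-from-root : ∀ E {A B C G} (r : Roots A B) → A ∈ E → B ∈ E → C ∈ E → G ∈ E →
        NoRoot E (- (3 · A)) (- B) → NoRoot E (- (3 · C)) (- G) →
        ∀ {y} → y ∈ E ⟨ Roots.x₁ r ⟩ → cubic (- (3 · C)) (- G) y ≈ 0# →
        ∃₂ λ v w → v ∈ E × w ∈ E × Solution A B C G v w × y ≈ T A v w (Roots.x₁ r)
      solution-from-root E {A} {B} {C} {G} r A∈ B∈ C∈ G∈ noRootₓ noRootᵧ {y} y∈ y-root =
        let P∈ : - (3 · A) ∈ E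
            P∈ = closed E 1 (λ A → ⊝ (3 ⊙ A)) (A∈ ∷ [])
            Q∈ : - B ∈ E
            Q∈ = closed E 1 (λ B → ⊝ B) (B∈ ∷ [])
            r₀ , r₁ , r₂ , r₀∈ , r₁∈ , r₂∈ , y≈ = cubic-member {E} P∈ Q∈ root₁ y∈
            -- With `h = r₀ + 2Ar₂`, y satisfies `(y - h)³ - 3 QF (y - h) - NF = 0`. Subtracting
            -- this from its cubic equation leaves a relation of degree two in y, whose coefficients
            -- vanish: `3h = 0`, then `C = QF` and `G = NF`.
            u₀≈0 , u₁≈0 , u₂≈0 = powers-independent E
              (closed E 1 (λ A → ⊝ (3 ⊙ A)) (C∈ ∷ [])) (closed E 1 (λ B → ⊝ B) (G∈ ∷ [])) noRootᵧ y-root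
              (closed E 7 (λ A B C G r₀ r₁ r₂ → let h = r₀ ⊕ 2 ⊙ (A ⊗ r₂) in
                 h ↑ 3 ⊖ 3 ⊙ (QE A B r₁ r₂ ⊗ h) ⊖ G ⊕ NE A B r₁ r₂) (A∈ ∷ B∈ ∷ C∈ ∷ G∈ ∷ r₀∈ ∷ r₁∈ ∷ r₂∈ ∷ []))
              (closed E 6 (λ A B C r₀ r₁ r₂ → let h = r₀ ⊕ 2 ⊙ (A ⊗ r₂) in
                 ⊝ (3 ⊙ h ↑ 2) ⊖ 3 ⊙ C ⊕ 3 ⊙ QE A B r₁ r₂) (A∈ ∷ B∈ ∷ C∈ ∷ r₀∈ ∷ r₁∈ ∷ r₂∈ ∷ []))
              (closed E 3 (λ A r₀ r₂ → 3 ⊙ (r₀ ⊕ 2 ⊙ (A ⊗ r₂))) (A∈ ∷ r₀∈ ∷ r₂∈ ∷ []))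
              (relation r₀ r₁ r₂ y≈)
            h≈0 = cancel-3 u₂≈0
        in r₁ , r₂ , r₁∈ , r₂∈ , record { C≈ = C≈ r₀ r₁ r₂ h≈0 u₁≈0 ; G≈ = G≈ r₀ r₁ r₂ h≈0 u₀≈0 } ,
           trans y≈ (trans (solve 5 (λ A r₀ r₁ r₂ x → r₀ ⊕ r₁ ⊗ x ⊕ r₂ ⊗ x ↑ 2 ⊜
                              TE A r₁ r₂ x ⊕ 𝟙 ⊗ ((r₀ ⊕ 2 ⊙ (A ⊗ r₂)) ⊖ 𝟘)) A r₀ r₁ r₂ x₁) (absorb h≈0))
        where
        open Roots r

        cancel-3 : ∀ {x} → 3 · x ≈ 0# → x ≈ 0#
        cancel-3 {x} 3x≈0 = decidable-stable (zero? x) (λ x≉0 → 3·-nonzero x≉0 3x≈0)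

        C≈ : ∀ r₀ r₁ r₂ → r₀ + 2 · (A * r₂) ≈ 0# →
          - (3 · (r₀ + 2 · (A * r₂)) ^ 2) - 3 · C + 3 · QF A B r₁ r₂ ≈ 0# → C ≈ QF A B r₁ r₂
        C≈ r₀ r₁ r₂ h≈0 u₁≈0 = difference-zero (cancel-3 (trans
          (solve 3 (λ h C Q → 3 ⊙ (C ⊖ Q) ⊜
              𝟘 ⊕ (⊝ 𝟙) ⊗ ((⊝ (3 ⊙ h ↑ 2) ⊖ 3 ⊙ C ⊕ 3 ⊙ Q) ⊖ 𝟘) ⊕ (⊝ (3 ⊙ h)) ⊗ (h ⊖ 𝟘))
            (r₀ + 2 · (A * r₂)) C (QF A B r₁ r₂))
          (absorb₂ u₁≈0 h≈0)))

        G≈ : ∀ r₀ r₁ r₂ → let h = r₀ + 2 · (A * r₂) in h ≈ 0# →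
          h ^ 3 - 3 · (QF A B r₁ r₂ * h) - G + NF A B r₁ r₂ ≈ 0# → G ≈ NF A B r₁ r₂
        G≈ r₀ r₁ r₂ h≈0 u₀≈0 = trans
          (solve 4 (λ h G Q N → G ⊜ N ⊕ (⊝ 𝟙) ⊗ ((h ↑ 3 ⊖ 3 ⊙ (Q ⊗ h) ⊖ G ⊕ N) ⊖ 𝟘) ⊕ (h ↑ 2 ⊖ 3 ⊙ Q) ⊗ (h ⊖ 𝟘))
            (r₀ + 2 · (A * r₂)) G (QF A B r₁ r₂) (NF A B r₁ r₂))
          (absorb₂ u₀≈0 h≈0)

        relation : ∀ r₀ r₁ r₂ → y ≈ r₀ + r₁ * x₁ + r₂ * x₁ ^ 2 → let h = r₀ + 2 · (A * r₂) in
          (h ^ 3 - 3 · (QF A B r₁ r₂ * h) - G + NF A B r₁ r₂)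
            + (- (3 · h ^ 2) - 3 · C + 3 · QF A B r₁ r₂) * y + 3 · h * y ^ 2 ≈ 0#
        relation r₀ r₁ r₂ y≈ = trans
          (+-cong (+-cong refl (*-congˡ y≈)) (*-congˡ (^-cong 2 y≈)))
          (trans (solveᵣ (r₀ ∷ r₁ ∷ r₂ ∷ C ∷ G ∷ []) λ g h r₀ r₁ r₂ C G A B →
                    let k = r₀ ⊕ 2 ⊙ (A ⊗ r₂); x = x₁E g h; y = r₀ ⊕ r₁ ⊗ x ⊕ r₂ ⊗ x ↑ 2; Q = QE A B r₁ r₂ in
                    (k ↑ 3 ⊖ 3 ⊙ (Q ⊗ k) ⊖ G ⊕ NE A B r₁ r₂)
                      ⊕ (⊝ (3 ⊙ k ↑ 2) ⊖ 3 ⊙ C ⊕ 3 ⊙ Q) ⊗ y ⊕ 3 ⊙ k ⊗ y ↑ 2 ⊜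
                    𝟘 ⊕ 𝟙 ⊗ (cubicE C G y ⊖ 𝟘))
                 (absorb (trans (cubic-cong refl refl (sym y≈)) y-root)))

    -- The cubic of a triple, its depressed form and its splitting field

    ι-equation : ∀ n (f : N-ary n Expr (Expr × Expr)) →
      let e₁ = proj₁ (f $ⁿ vars n); e₂ = proj₂ (f $ⁿ vars n) in (ρ : Vec M.Carrier n) →
      Mᵖ.⟦ e₁ ⟧ ρ M.≈ Mᵖ.⟦ e₂ ⟧ ρ → ⟦ e₁ ⟧ (Vec.map ι ρ) ≈ ⟦ e₂ ⟧ (Vec.map ι ρ)
    ι-equation n f ρ e₁≈e₂ = trans (sym (ι-⟦⟧ (proj₁ (f $ⁿ vars n)) ρ))
      (trans (ι-cong e₁≈e₂) (ι-⟦⟧ (proj₂ (f $ⁿ vars n)) ρ))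

    generated-⊑ : ∀ {S : Subset} (K : Intermediate) → (∀ {x} → S x → x ∈ K) → ∀ {x} → Generated S x → x ∈ K
    generated-⊑ K S⊑K (generator Sx)         = S⊑K Sx
    generated-⊑ K S⊑K (resp x≈y g)           = ∈-resp K x≈y (generated-⊑ K S⊑K g)
    generated-⊑ K S⊑K 0-closed               = Intermediate.0-closed K
    generated-⊑ K S⊑K 1-closed               = Intermediate.1-closed K
    generated-⊑ K S⊑K (+-closed g h)         = Intermediate.+-closed K (generated-⊑ K S⊑K g) (generated-⊑ K S⊑K h)
    generated-⊑ K S⊑K (*-closed g h)         = Intermediate.*-closed K (generated-⊑ K S⊑K g) (generated-⊑ K S⊑K h)
    generated-⊑ K S⊑K (-‿closed g)           = Intermediate.-‿closed K (generated-⊑ K S⊑K g)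
    generated-⊑ K S⊑K (inverse-closed g eq)  = Intermediate.inverse-closed K (generated-⊑ K S⊑K g) eq

    module _ (a : Mᵈ.Triple) where
      private
        a₁ a₂ a₃ : M.Carrier
        a₁ = proj₁ a
        a₂ = proj₁ (proj₂ a)
        a₃ = proj₂ (proj₂ a)

      ιA ιB ιD : Carrier
      ιA = ι (Mᵈ.A a)
      ιB = ι (Mᵈ.B a)
      ιD = ι (Mᵈ.D a)

      private
        AE BE DE : Expr → Expr → Expr → Expr
        AE a₁ a₂ a₃ = a₁ ↑ 2 ⊖ 3 ⊙ a₂
        BE a₁ a₂ a₃ = 2 ⊙ a₁ ↑ 3 ⊖ 9 ⊙ (a₁ ⊗ a₂) ⊕ 27 ⊙ a₃
        DE a₁ a₂ a₃ = a₁ ↑ 2 ⊗ a₂ ↑ 2 ⊖ 4 ⊙ a₂ ↑ 3 ⊖ 4 ⊙ (a₁ ↑ 3 ⊗ a₃) ⊕ 18 ⊙ (a₁ ⊗ a₂ ⊗ a₃) ⊖ 27 ⊙ a₃ ↑ 2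

      27D-identity : 27 · ιD ≈ 4 · ιA ^ 3 - ιB ^ 2
      27D-identity = ι-equation 3 (λ A B D → 27 ⊙ D ⊜ 4 ⊙ A ↑ 3 ⊖ B ↑ 2) (Mᵈ.A a ∷ Mᵈ.B a ∷ Mᵈ.D a ∷ [])
        (Mᵖ.solve 3 (λ a₁ a₂ a₃ → 27 ⊙ DE a₁ a₂ a₃ ⊜ 4 ⊙ AE a₁ a₂ a₃ ↑ 3 ⊖ BE a₁ a₂ a₃ ↑ 2) a₁ a₂ a₃)

      depressed : ∀ α → 27 · evalᴹ (Mᵈ.f₃ a) α ≈ cubic (- (3 · ιA)) (- ιB) (3 · α - ι a₁)
      depressed α = solve-given 4
        (⊝ var 3 ∷ ⊝ var 1 ∷ 𝟙 ∷ AE (var 1) (var 2) (var 3) ∷ BE (var 1) (var 2) (var 3) ∷ [])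
        (λ α a₁ a₂ a₃ -a₃ -a₁ one A B → let x = 3 ⊙ α ⊖ a₁ in
          27 ⊙ (-a₃ ⊕ α ⊗ (a₂ ⊕ α ⊗ (-a₁ ⊕ α ⊗ (one ⊕ α ⊗ 𝟘)))) ⊜ x ↑ 3 ⊕ ⊝ (3 ⊙ A) ⊗ x ⊕ ⊝ B)
        (α ∷ ι a₁ ∷ ι a₂ ∷ ι a₃ ∷ [])
        (ι-neg a₃ ∷ ι-neg a₁ ∷ ι-1
          ∷ ι-⟦⟧ (AE (var 0) (var 1) (var 2)) (a₁ ∷ a₂ ∷ a₃ ∷ [])
          ∷ ι-⟦⟧ (BE (var 0) (var 1) (var 2)) (a₁ ∷ a₂ ∷ a₃ ∷ []) ∷ [])

      module _ (D≉0 : ¬ ιD ≈ 0#) where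
        private
          x₁-root : ∃ λ x → eval (- ιB ∷ - (3 · ιA) ∷ 0# ∷ 1# ∷ []) x ≈ 0#
          x₁-root = algebraicallyClosed (- ιB ∷ - (3 · ιA) ∷ 0# ∷ 1# ∷ []) 2 (≉⇒# 1≉0 , coeff-beyond _)
          x₁ : Carrier
          x₁ = proj₁ x₁-root

          -- The polynomial is the cofactor of `X - x₁` in the depressed cubic.
          x₂-root : ∃ λ x → eval (x₁ ^ 2 - 3 · ιA ∷ x₁ ∷ 1# ∷ []) x ≈ 0#
          x₂-root = algebraicallyClosed (x₁ ^ 2 - 3 · ιA ∷ x₁ ∷ 1# ∷ []) 1 (≉⇒# 1≉0 , coeff-beyond _)

          x₂ : Carrier
          x₂ = proj₁ x₂-root

          g h : Carrier
          g = proj₁ (divide 3≉0 (2 · x₁ + x₂))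
          h = proj₁ (divide 3≉0 (x₂ - x₁))

          3g≈ : 3 · 1# * g ≈ 2 · x₁ + x₂
          3g≈ = proj₂ (divide 3≉0 (2 · x₁ + x₂))

          3h≈ : 3 · 1# * h ≈ x₂ - x₁
          3h≈ = proj₂ (divide 3≉0 (x₂ - x₁))

          x₁≈ : x₁ ≈ g - h
          x₁≈ = *-cancel 3≉0 (trans
            (solve 4 (λ x y g h → (3 ⊙ 𝟙) ⊗ x ⊜ (3 ⊙ 𝟙) ⊗ (g ⊖ h) ⊕ (⊝ 𝟙) ⊗ ((3 ⊙ 𝟙) ⊗ g ⊖ (2 ⊙ x ⊕ y))
                ⊕ 𝟙 ⊗ ((3 ⊙ 𝟙) ⊗ h ⊖ (y ⊖ x))) x₁ x₂ g h) (absorb₂ 3g≈ 3h≈))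

          x₂≈ : x₂ ≈ g + 2 · h
          x₂≈ = *-cancel 3≉0 (trans
            (solve 4 (λ x y g h → (3 ⊙ 𝟙) ⊗ y ⊜ (3 ⊙ 𝟙) ⊗ (g ⊕ 2 ⊙ h) ⊕ (⊝ 𝟙) ⊗ ((3 ⊙ 𝟙) ⊗ g ⊖ (2 ⊙ x ⊕ y))
                ⊕ (⊝ (2 ⊙ 𝟙)) ⊗ ((3 ⊙ 𝟙) ⊗ h ⊖ (y ⊖ x))) x₁ x₂ g h) (absorb₂ 3g≈ 3h≈))

          A≈ : ιA ≈ g ^ 2 + g * h + h ^ 2
          A≈ = *-cancel 3≉0 (trans
            (solve 5 (λ A x y g h → (3 ⊙ 𝟙) ⊗ A ⊜ (3 ⊙ 𝟙) ⊗ (g ↑ 2 ⊕ g ⊗ h ⊕ h ↑ 2)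
                ⊕ (⊝ 𝟙) ⊗ ((x ↑ 2 ⊖ 3 ⊙ A ⊕ y ⊗ (x ⊕ y ⊗ (𝟙 ⊕ y ⊗ 𝟘))) ⊖ 𝟘)
                ⊕ (x ⊕ (g ⊖ h) ⊕ y) ⊗ (x ⊖ (g ⊖ h)) ⊕ (y ⊕ (g ⊕ 2 ⊙ h) ⊕ (g ⊖ h)) ⊗ (y ⊖ (g ⊕ 2 ⊙ h))) ιA x₁ x₂ g h)
            (absorb₃ (proj₂ x₂-root) x₁≈ x₂≈))

          B≈ : ιB ≈ (g - h) * (g + 2 · h) * - (2 · g + h)
          B≈ = trans
            (solve 5 (λ A B x g h → B ⊜ (g ⊖ h) ⊗ (g ⊕ 2 ⊙ h) ⊗ ⊝ (2 ⊙ g ⊕ h)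
                ⊕ (⊝ 𝟙) ⊗ ((⊝ B ⊕ x ⊗ (⊝ (3 ⊙ A) ⊕ x ⊗ (𝟘 ⊕ x ⊗ (𝟙 ⊕ x ⊗ 𝟘)))) ⊖ 𝟘)
                ⊕ (x ↑ 2 ⊕ x ⊗ (g ⊖ h) ⊕ (g ⊖ h) ↑ 2 ⊖ 3 ⊙ A) ⊗ (x ⊖ (g ⊖ h))
                ⊕ (⊝ (3 ⊙ (g ⊖ h))) ⊗ (A ⊖ (g ↑ 2 ⊕ g ⊗ h ⊕ h ↑ 2))) ιA ιB x₁ g h)
            (absorb₃ (proj₂ x₁-root) x₁≈ A≈)

          Δ≉0 : ¬ g * h * (g + h) ≈ 0#
          Δ≉0 Δ≈0 = D≉0 (27·-cancel (trans 27D-identity (trans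
            (solve-given 2 (var 0 ↑ 2 ⊕ var 0 ⊗ var 1 ⊕ var 1 ↑ 2
                             ∷ (var 0 ⊖ var 1) ⊗ (var 0 ⊕ 2 ⊙ var 1) ⊗ ⊝ (2 ⊙ var 0 ⊕ var 1) ∷ [])
              (λ g h A B → let Δ = g ⊗ h ⊗ (g ⊕ h) in 4 ⊙ A ↑ 3 ⊖ B ↑ 2 ⊜ 𝟘 ⊕ (27 ⊙ Δ) ⊗ (Δ ⊖ 𝟘))
              (g ∷ h ∷ []) (A≈ ∷ B≈ ∷ []))
            (absorb Δ≈0))))

        roots : Roots ιA ιB
        roots = record { g = g ; h = h ; A≈ = A≈ ; B≈ = B≈ ; Δ≉0 = Δ≉0 }

        module _ (N : Intermediate) where
          splitting : Intermediate
          splitting = record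
            { subfield = Spl (Intermediate.Contains N) (Mᵈ.f₃ a)
            ; base⊆    = λ x∈M → generator (inj₁ (base⊆ N x∈M))
            }

          N⊑splitting : N ⊑ splitting
          N⊑splitting x∈N = generator (inj₁ x∈N)

          root-∈ : ∀ {x} → cubic (- (3 · ιA)) (- ιB) x ≈ 0# → x ∈ splitting
          root-∈ {x} root = ∈-resp splitting
            (trans (solve 3 (λ α a x → 3 ⊙ α ⊖ a ⊜ x ⊕ 𝟙 ⊗ ((3 ⊙ 𝟙) ⊗ α ⊖ (x ⊕ a))) α (ι a₁) x) (absorb 3α≈))
            (closed splitting 2 (λ α a → 3 ⊙ α ⊖ a) (generator (inj₂ α-root) ∷ ι-∈ splitting a₁ ∷ []))
            where
            α : Carrier
            α = proj₁ (divide 3≉0 (x + ι a₁))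

            3α≈ : 3 · 1# * α ≈ x + ι a₁
            3α≈ = proj₂ (divide 3≉0 (x + ι a₁))

            x≈ : 3 · α - ι a₁ ≈ x
            x≈ = trans (solve 3 (λ α a x → 3 ⊙ α ⊖ a ⊜ x ⊕ 𝟙 ⊗ ((3 ⊙ 𝟙) ⊗ α ⊖ (x ⊕ a))) α (ι a₁) x) (absorb 3α≈)

            α-root : Root (Mᵈ.f₃ a) α
            α-root = 27·-cancel (trans (depressed α) (trans (+-congʳ (+-cong (^-cong 3 x≈) (*-congˡ x≈))) root))

          splitting-least : (ρ : Roots ιA ιB) → ∀ K → N ⊑ K → Roots.x₁ ρ ∈ K → Roots.x₂ ρ ∈ K → splitting ⊑ K
          splitting-least ρ K N⊑K x₁∈ x₂∈ = generated-⊑ K [ N⊑K , root ]′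
            where
            module r = Roots ρ

            root : ∀ {α} → Root (Mᵈ.f₃ a) α → α ∈ K
            root {α} α-root = quotient-∈ K 3≉0
              (solve 2 (λ α a → (3 ⊙ 𝟙) ⊗ α ⊜ (3 ⊙ α ⊖ a) ⊕ a) α (ι a₁)) (closed K 0 (3 ⊙ 𝟙) [])
              (Intermediate.+-closed K
                ([ (λ p → ∈-resp K (sym p) x₁∈) , [ (λ p → ∈-resp K (sym p) x₂∈)
                 , (λ p → ∈-resp K (trans (sym r.third-root) (sym p)) (closed K 2 (λ x y → ⊝ x ⊖ y) (x₁∈ ∷ x₂∈ ∷ []))) ]′ ]′
                 (r.root-cases (trans (sym (depressed α))
                   (trans (solve 1 (λ x → 27 ⊙ x ⊜ 𝟘 ⊕ (27 ⊙ 𝟙) ⊗ (x ⊖ 𝟘)) (evalᴹ (Mᵈ.f₃ a) α)) (absorb α-root)))))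
                (ι-∈ K a₁))

        splittingField : SplittingField ιA ιB (splitting base-field)
        splittingField = record
          { roots = roots
          ; A∈M   = ι-∈ base-field (Mᵈ.A a)
          ; B∈M   = ι-∈ base-field (Mᵈ.B a)
          ; x₁∈L  = root-∈ base-field (Roots.root₁ roots)
          ; x₂∈L  = root-∈ base-field (Roots.root₂ roots)
          ; least = λ K → splitting-least base-field roots K (base⊆ K)
          }

      -- A rational root x of the depressed cubic gives the rational root `(x + a₁) / 3` and so a
      -- factorisation. Both factors have roots in the closure, so neither is a unit.
      irreducible⇒NoRoot : Mᵈ.Irreducible (Mᵈ.f₃ a) → NoRoot base-field (- (3 · ιA)) (- ιB)
      irreducible⇒NoRoot irreducible x x∈M x-root =
        [ root⇒∤1 {linear} linear-root , root⇒∤1 {quadratic} (proj₂ quadratic-root) ]′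
          (SemiringDefinitions.Irreducible.split-∣1 irreducible factorised)
        where
        α : Carrier
        α = proj₁ (divide 3≉0 (x + ι a₁))

        3α≈ : 3 · 1# * α ≈ x + ι a₁
        3α≈ = proj₂ (divide 3≉0 (x + ι a₁))

        α∈M : α ∈ base-field
        α∈M = quotient-∈ base-field 3≉0 3α≈ (closed base-field 0 (3 ⊙ 𝟙) [])
          (Intermediate.+-closed base-field x∈M (ι-∈ base-field a₁))

        m : M.Carrier
        m = proj₁ α∈M

        α-root : evalᴹ (Mᵈ.f₃ a) α ≈ 0#
        α-root = 27·-cancel (trans (depressed α) (trans (+-congʳ (+-cong (^-cong 3 x≈) (*-congˡ x≈))) x-root))
          where
          x≈ : 3 · α - ι a₁ ≈ x
          x≈ = trans (solve 3 (λ α a x → 3 ⊙ α ⊖ a ⊜ x ⊕ 𝟙 ⊗ ((3 ⊙ 𝟙) ⊗ α ⊖ (x ⊕ a))) α (ι a₁) x) (absorb 3α≈)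

        fE : Expr → Expr → Expr → Expr → Expr
        fE m a₁ a₂ a₃ = m ↑ 3 ⊖ a₁ ⊗ m ↑ 2 ⊕ a₂ ⊗ m ⊖ a₃

        m-root : Mᵖ.⟦ fE (var 0) (var 1) (var 2) (var 3) ⟧ (m ∷ a₁ ∷ a₂ ∷ a₃ ∷ []) M.≈ M.0#
        m-root = ι-injective (trans (ι-⟦⟧ (fE (var 0) (var 1) (var 2) (var 3)) (m ∷ a₁ ∷ a₂ ∷ a₃ ∷ []))
          (trans (solve-given 4 (⊝ var 3 ∷ ⊝ var 1 ∷ 𝟙 ∷ var 0 ∷ [])
            (λ α a₁ a₂ a₃ -a₃ -a₁ one m → fE m a₁ a₂ a₃ ⊜ -a₃ ⊕ α ⊗ (a₂ ⊕ α ⊗ (-a₁ ⊕ α ⊗ (one ⊕ α ⊗ 𝟘))))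
            (α ∷ ι a₁ ∷ ι a₂ ∷ ι a₃ ∷ []) (ι-neg a₃ ∷ ι-neg a₁ ∷ ι-1 ∷ proj₂ α∈M ∷ []))
          (trans α-root (sym ι-0))))

        linear quadratic : Mᵈ.Poly
        linear = M.- m ∷ M.1# ∷ []
        quadratic = a₂ M.+ m M.* (m M.- a₁) ∷ m M.- a₁ ∷ M.1# ∷ []

        linear-root : evalᴹ linear (ι m) ≈ 0#
        linear-root = solve-given 1 (⊝ var 0 ∷ 𝟙 ∷ []) (λ m -m one → -m ⊕ m ⊗ (one ⊕ m ⊗ 𝟘) ⊜ 𝟘)
          (ι m ∷ []) (ι-neg m ∷ ι-1 ∷ [])

        quadratic-root : ∃ λ t → evalᴹ quadratic t ≈ 0#
        quadratic-root = algebraicallyClosed (List.map ι quadratic) 1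
          (≉⇒# (λ ι1≈0 → 1≉0 (trans (sym ι-1) ι1≈0)) , coeff-beyond _)

        factorised : Mᵈ.f₃ a Mᵈ.≈ₚ linear Mᵈ.*ₚ quadratic
        factorised 0 = M.trans
          (Mᵖ.solve 4 (λ m a₁ a₂ a₃ → ⊝ a₃ ⊜ ((⊝ m) ⊗ (a₂ ⊕ m ⊗ (m ⊖ a₁)) ⊕ 𝟘) ⊕ 𝟙 ⊗ (fE m a₁ a₂ a₃ ⊖ 𝟘)) m a₁ a₂ a₃)
          (Mᵖ.absorb m-root)
        factorised 1 = Mᵖ.solve 3 (λ m a₁ a₂ → a₂ ⊜ (⊝ m) ⊗ (m ⊖ a₁) ⊕ (𝟙 ⊗ (a₂ ⊕ m ⊗ (m ⊖ a₁)) ⊕ 𝟘)) m a₁ a₂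
        factorised 2 = Mᵖ.solve 2 (λ m a₁ → ⊝ a₁ ⊜ (⊝ m) ⊗ 𝟙 ⊕ 𝟙 ⊗ (m ⊖ a₁)) m a₁
        factorised 3 = Mᵖ.solve 0 (𝟙 ⊜ 𝟙 ⊗ 𝟙)
        factorised (suc (suc (suc (suc n)))) = M.refl

    -- The sextic as a quadratic in Y

    module Factorisation (a b : Mᵈ.Triple) (DaDb#0 : Mᵈ.D a M.* Mᵈ.D b M.# M.0#)
      (f₃-irreducible : Mᵈ.Irreducible (Mᵈ.f₃ a))
      (AaAb#0 : Mᵈ.A a M.* Mᵈ.A b M.# M.0#)
      (nondegenerate# : Mᵈ.A a Mᵈ.^ 3 M.* Mᵈ.B b Mᵈ.^ 2 M.- 27 Mᵈ.· (Mᵈ.A b Mᵈ.^ 3 M.* Mᵈ.D a) M.# M.0#) where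

      Da#0 : Mᵈ.D a M.# M.0#
      Da#0 = Mᵈ.xy#0→x#0 DaDb#0

      dᴹ : M.Carrier
      dᴹ = Mᵈ.recip Da#0

      private
        factorˡ≉0 : ∀ {x y} → x M.* y M.# M.0# → ¬ x M.≈ M.0#
        factorˡ≉0 {y = y} xy#0 x≈0 = Mᵖ.#⇒≉ xy#0 (M.trans (M.*-congʳ x≈0) (M.zeroˡ y))

        factorʳ≉0 : ∀ {x y} → x M.* y M.# M.0# → ¬ y M.≈ M.0#
        factorʳ≉0 {x} xy#0 y≈0 = Mᵖ.#⇒≉ xy#0 (M.trans (M.*-congˡ y≈0) (M.zeroʳ x))

      Da≉0 : ¬ ιD a ≈ 0#
      Da≉0 = ι-nonzero (factorˡ≉0 DaDb#0)

      Db≉0 : ¬ ιD b ≈ 0#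
      Db≉0 = ι-nonzero (factorʳ≉0 DaDb#0)

      Laᴵ Lbᴵ : Intermediate
      Laᴵ = splitting a Da≉0 base-field
      Lbᴵ = splitting b Db≉0 base-field

      opaque
        A B C′ G D E d : Carrier
        A  = ιA a
        B  = ιB a
        C′ = ιA b
        G  = ιB b
        D  = ιD a
        E  = ιD b
        d  = ι dᴹ

      opaque
        unfolding A B C′ G D E d

        Sa : SplittingField A B Laᴵ
        Sa = splittingField a Da≉0

        Sb₀ : SplittingField C′ G Lbᴵ
        Sb₀ = splittingField b Db≉0

        irreducible : SplittingField.Irreducibleᶜ Sa base-field
        irreducible = irreducible⇒NoRoot a f₃-irreducible

        nondegenerate : ¬ A ^ 3 * G ^ 2 - 27 · (C′ ^ 3 * D) ≈ 0#
        nondegenerate p = Mᵖ.#⇒≉ nondegenerate# (ι-injective (trans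
          (ι-⟦⟧ (var 0 ↑ 3 ⊗ var 1 ↑ 2 ⊖ 27 ⊙ (var 2 ↑ 3 ⊗ var 3)) (Mᵈ.A a ∷ Mᵈ.B b ∷ Mᵈ.A b ∷ Mᵈ.D a ∷ []))
          (trans p (sym ι-0))))

        D∈M : D ∈ base-field
        D∈M = ι-∈ base-field (Mᵈ.D a)

        E∈M : E ∈ base-field
        E∈M = ι-∈ base-field (Mᵈ.D b)

        d∈M : d ∈ base-field
        d∈M = ι-∈ base-field dᴹ

        27D≈ : 27 · D ≈ 4 · A ^ 3 - B ^ 2
        27D≈ = 27D-identity a

        27E≈ : 27 · E ≈ 4 · C′ ^ 3 - G ^ 2
        27E≈ = 27D-identity b

        Dd≈1 : D * d ≈ 1#
        Dd≈1 = trans (sym (ι-* (Mᵈ.D a) dᴹ)) (trans (ι-cong (Mᵈ.recip-inverseʳ Da#0)) ι-1)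

        E≉0 : ¬ E ≈ 0#
        E≉0 = Db≉0

        A≉0 : ¬ A ≈ 0#
        A≉0 = ι-nonzero (factorˡ≉0 AaAb#0)

        C≉0 : ¬ C′ ≈ 0#
        C≉0 = ι-nonzero (factorʳ≉0 AaAb#0)

      private module a = SplittingField Sa

      p r s : Carrier
      p = - (A * C′ * d)
      s = G * d
      r = (C′ ^ 3 * D - A ^ 3 * E) * d ^ 3

      Y : Carrier → Carrier
      Y θ = θ ^ 3 + p * θ

      F : Carrier → Carrier
      F θ = Y θ ^ 2 + s * Y θ + r

      D≉0 : ¬ D ≈ 0#
      D≉0 D≈0 = 1≉0 (trans (sym Dd≈1) (trans (*-congʳ D≈0) (zeroˡ d)))

      d≉0 : ¬ d ≈ 0#
      d≉0 d≈0 = 1≉0 (trans (sym Dd≈1) (trans (*-congˡ d≈0) (zeroʳ D)))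

      -- Otherwise 0 would be a rational root of `X³ - 3AX - B`.
      B≉0 : ¬ B ≈ 0#
      B≉0 B≈0 = irreducible 0# (Intermediate.0-closed base-field) (trans
        (solve 2 (λ A B → 𝟘 ↑ 3 ⊕ ⊝ (3 ⊙ A) ⊗ 𝟘 ⊕ ⊝ B ⊜ 𝟘 ⊕ (⊝ 𝟙) ⊗ (B ⊖ 𝟘)) A B) (absorb B≈0))

      disc-y≉0 : ¬ 4 · C′ ^ 3 - G ^ 2 ≈ 0#
      disc-y≉0 p = E≉0 (27·-cancel (trans 27E≈ p))

      nondegenerate′ : ¬ A ^ 3 * G ^ 2 - C′ ^ 3 * (4 · A ^ 3 - B ^ 2) ≈ 0#
      nondegenerate′ p = nondegenerate (trans
        (solve 5 (λ A B C′ G D → A ↑ 3 ⊗ G ↑ 2 ⊖ 27 ⊙ (C′ ↑ 3 ⊗ D) ⊜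
            (A ↑ 3 ⊗ G ↑ 2 ⊖ C′ ↑ 3 ⊗ (4 ⊙ A ↑ 3 ⊖ B ↑ 2)) ⊕ (⊝ (C′ ↑ 3)) ⊗ (27 ⊙ D ⊖ (4 ⊙ A ↑ 3 ⊖ B ↑ 2))) A B C′ G D)
        (trans (absorb 27D≈) p))

      A∈ : ∀ K → A ∈ K
      A∈ = a.A∈

      B∈ : ∀ K → B ∈ K
      B∈ = a.B∈

      C∈ : ∀ K → C′ ∈ K
      C∈ = SplittingField.A∈ Sb₀

      G∈ : ∀ K → G ∈ K
      G∈ = SplittingField.B∈ Sb₀

      d∈ : ∀ K → d ∈ K
      d∈ K = base⊆ K d∈M

      p∈ : ∀ K → p ∈ K
      p∈ K = closed K 3 (λ A C′ d → ⊝ (A ⊗ C′ ⊗ d)) (A∈ K ∷ C∈ K ∷ d∈ K ∷ [])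

      s∈ : ∀ K → s ∈ K
      s∈ K = Intermediate.*-closed K (G∈ K) (d∈ K)

      r∈ : ∀ K → r ∈ K
      r∈ K = closed K 5 (λ A C′ D E d → (C′ ↑ 3 ⊗ D ⊖ A ↑ 3 ⊗ E) ⊗ d ↑ 3)
        (A∈ K ∷ C∈ K ∷ base⊆ K D∈M ∷ base⊆ K E∈M ∷ d∈ K ∷ [])

      Y-∈ : ∀ K {θ} → θ ∈ K → Y θ ∈ K
      Y-∈ K θ∈ = closed K 2 (λ p θ → θ ↑ 3 ⊕ p ⊗ θ) (p∈ K ∷ θ∈ ∷ [])

      -- 27 D³ F(3w) is the eliminant of the equations for v and w.
      μ≈ : ∀ w → μ A B C′ w ≈ D * Y (3 · w)
      μ≈ w = trans
        (solve 6 (λ A B C′ D d w → let θ = 3 ⊙ w in (4 ⊙ A ↑ 3 ⊖ B ↑ 2) ⊗ w ↑ 3 ⊖ 3 ⊙ (A ⊗ C′ ⊗ w) ⊜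
            D ⊗ (θ ↑ 3 ⊕ ⊝ (A ⊗ C′ ⊗ d) ⊗ θ)
              ⊕ (A ⊗ C′ ⊗ θ) ⊗ (D ⊗ d ⊖ 𝟙) ⊕ (⊝ (w ↑ 3)) ⊗ (27 ⊙ D ⊖ (4 ⊙ A ↑ 3 ⊖ B ↑ 2))) A B C′ D d w)
        (absorb₂ Dd≈1 27D≈)

      eliminant : ∀ w → let m = μ A B C′ w in
        A ^ 3 * (2 · m + G) ^ 2 - B ^ 2 * (m ^ 2 + G * m + C′ ^ 3) ≈ 27 · (D ^ 3 * F (3 · w))
      eliminant w = trans
        (trans (+-cong (*-congˡ (^-cong 2 (+-congʳ (·-cong 2 (μ≈ w)))))
                       (-‿cong (*-congˡ (+-congʳ (+-cong (^-cong 2 (μ≈ w)) (*-congˡ (μ≈ w)))))))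
          (solve 8 (λ A B C′ G D E d Y → let m = D ⊗ Y; u = D ⊗ d in
            A ↑ 3 ⊗ (2 ⊙ m ⊕ G) ↑ 2 ⊖ B ↑ 2 ⊗ (m ↑ 2 ⊕ G ⊗ m ⊕ C′ ↑ 3) ⊜
            27 ⊙ (D ↑ 3 ⊗ (Y ↑ 2 ⊕ G ⊗ d ⊗ Y ⊕ (C′ ↑ 3 ⊗ D ⊖ A ↑ 3 ⊗ E) ⊗ d ↑ 3))
              ⊕ (⊝ (27 ⊙ (D ↑ 2 ⊗ G ⊗ Y ⊕ (C′ ↑ 3 ⊗ D ⊖ A ↑ 3 ⊗ E) ⊗ (u ↑ 2 ⊕ u ⊕ 𝟙)))) ⊗ (D ⊗ d ⊖ 𝟙)
              ⊕ (⊝ (m ↑ 2 ⊕ G ⊗ m ⊕ C′ ↑ 3)) ⊗ (27 ⊙ D ⊖ (4 ⊙ A ↑ 3 ⊖ B ↑ 2))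
              ⊕ A ↑ 3 ⊗ (27 ⊙ E ⊖ (4 ⊙ C′ ↑ 3 ⊖ G ↑ 2)))
            A B C′ G D E d (Y (3 · w))))
        (absorb₃ Dd≈1 27D≈ 27E≈)
        where
        ·-cong : ∀ n {x y} → x ≈ y → n · x ≈ n · y
        ·-cong zero    x≈y = refl
        ·-cong (suc n) x≈y = +-cong x≈y (·-cong n x≈y)

      F-cong : ∀ {θ θ′} → θ ≈ θ′ → F θ ≈ F θ′
      F-cong θ≈ = +-congʳ (+-cong (^-cong 2 Y≈) (*-congˡ Y≈))
        where
        Y≈ = +-cong (^-cong 3 θ≈) (*-congˡ θ≈)

      solution⇒root : ∀ {v w} → Solution A B C′ G v w → F (3 · w) ≈ 0#
      solution⇒root {v} {w} sol = zero-product
        (27·-cancel (trans (sym (eliminant w)) (trans (+-congʳ (Solution.resolvent sol)) (-‿inverseʳ _))))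
        (nonzero-* D≉0 (nonzero-* D≉0 (nonzero-* D≉0 1≉0)))

      opaque
        root⇒solution : ∀ {θ} → F θ ≈ 0# →
          ∃₂ λ v w → 3 · w ≈ θ × Solution A B C′ G v w × (∀ K → θ ∈ K → v ∈ K × w ∈ K)
        root⇒solution {θ} Fθ≈0 = v , w , 3w≈θ , proj₁ (proj₂ sol) ,
          λ K θ∈ → let w∈ = quotient-∈ K 3≉0 3w≈θ′ (closed K 0 (3 ⊙ 𝟙) []) θ∈
                   in proj₂ (proj₂ sol) K (A∈ K) (B∈ K) (C∈ K) (G∈ K) w∈ , w∈
          where
          w : Carrier
          w = proj₁ (divide 3≉0 θ)

          3w≈θ′ : 3 · 1# * w ≈ θ
          3w≈θ′ = proj₂ (divide 3≉0 θ)

          3w≈θ : 3 · w ≈ θ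
          3w≈θ = trans (solve 1 (λ w → 3 ⊙ w ⊜ (3 ⊙ 𝟙) ⊗ w) w) 3w≈θ′

          F3w≈0 : F (3 · w) ≈ 0#
          F3w≈0 = trans (F-cong 3w≈θ) Fθ≈0

          sol : ∃ λ v → Solution A B C′ G v w × (∀ E → A ∈ E → B ∈ E → C′ ∈ E → G ∈ E → w ∈ E → v ∈ E)
          sol = solution {A} {B} {C′} {G} {w} B≉0 A≉0 nondegenerate′ (difference-zero
            (trans (eliminant w) (trans (solve 2 (λ D F → 27 ⊙ (D ↑ 3 ⊗ F) ⊜ 𝟘 ⊕ (27 ⊙ D ↑ 3) ⊗ (F ⊖ 𝟘)) D (F (3 · w)))
              (absorb F3w≈0))))

          v : Carrier
          v = proj₁ sol

      solution-unique : ∀ {v v′ w} → Solution A B C′ G v w → Solution A B C′ G v′ w → v ≈ v′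
      solution-unique {w = w} sol = unique {A} {B} {C′} {G} {w} B≉0 A≉0 nondegenerate′ (Solution.resolvent sol) sol

      -- A root of F is simple within its cubic factor.
      derivative≉0′ : ∀ {θ} → F θ ≈ 0# → ¬ 3 · θ ^ 2 + p ≈ 0#
      derivative≉0′ {θ} Fθ≈0 p≈0 with root⇒solution Fθ≈0
      ... | v , w , 3w≈θ , sol , _ = derivative≉0 {A} {B} {C′} {G} {w} B≉0 A≉0 nondegenerate′ (Solution.resolvent sol) (trans
        (solve 7 (λ A B C′ D d w θ → A ⊗ C′ ⊖ (4 ⊙ A ↑ 3 ⊖ B ↑ 2) ⊗ w ↑ 2 ⊜
            𝟘 ⊕ (⊝ D) ⊗ ((3 ⊙ θ ↑ 2 ⊕ ⊝ (A ⊗ C′ ⊗ d)) ⊖ 𝟘)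
              ⊕ (⊝ (3 ⊙ (D ⊗ (3 ⊙ w ⊕ θ)))) ⊗ (3 ⊙ w ⊖ θ)
              ⊕ w ↑ 2 ⊗ (27 ⊙ D ⊖ (4 ⊙ A ↑ 3 ⊖ B ↑ 2))
              ⊕ (⊝ (A ⊗ C′)) ⊗ (D ⊗ d ⊖ 𝟙)) A B C′ D d w θ)
        (trans (absorb Dd≈1) (absorb₃ p≈0 3w≈θ 27D≈)))

      T-closed : ∀ K {v w x} → v ∈ K → w ∈ K → x ∈ K → T A v w x ∈ K
      T-closed K v∈ w∈ x∈ = closed K 4 (λ A v w x → v ⊗ x ⊕ w ⊗ (x ↑ 2 ⊖ 2 ⊙ A)) (A∈ K ∷ v∈ ∷ w∈ ∷ x∈ ∷ [])

      module WithSolution {v w} (sol : Solution A B C′ G v w) where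
        open Transform a.roots sol disc-y≉0 public

        δ≉0 : ¬ δ A B v w ≈ 0#
        δ≉0 δ≈0 = disc-y≉0 (trans (Solution.discriminant sol) (trans (*-congˡ (*-congʳ δ≈0))
          (trans (*-congˡ (zeroˡ _)) (zeroʳ _))))

        -- A root t in K is one of the `T(xᵢ)`. This is a relation over K between the powers of
        -- `xᵢ`, so v and w vanish, and with them `C′`.
        NoRoot-y : ∀ K → v ∈ K → w ∈ K → a.Irreducibleᶜ K → NoRoot K (- (3 · C′)) (- G)
        NoRoot-y K v∈ w∈ noRoot t t∈ t-root =
          [ (λ t≈ → image a.root₁ (trans t≈ y₁≈))
          , [ (λ t≈ → image a.root₂ (trans t≈ y₂≈)) , (λ t≈ → image a.root₃ (trans t≈ y₃≈)) ]′ ]′ (y.root-cases t-root)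
          where
          image : ∀ {x} → cubic (- (3 · A)) (- B) x ≈ 0# → ¬ t ≈ T A v w x
          image {x} x-root t≈ with powers-independent K (a.P∈ K) (a.Q∈ K) noRoot x-root
            (closed K 3 (λ A w t → ⊝ (2 ⊙ (A ⊗ w)) ⊖ t) (A∈ K ∷ w∈ ∷ t∈ ∷ [])) v∈ w∈
            (trans (solve 5 (λ A v w x t → (⊝ (2 ⊙ (A ⊗ w)) ⊖ t) ⊕ v ⊗ x ⊕ w ⊗ x ↑ 2 ⊜
                      𝟘 ⊕ (⊝ 𝟙) ⊗ (t ⊖ (v ⊗ x ⊕ w ⊗ (x ↑ 2 ⊖ 2 ⊙ A)))) A v w x t) (absorb t≈))
          ... | _ , v≈0 , w≈0 = C≉0 (trans (Solution.C≈ sol) (trans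
            (solve 4 (λ A B v w → A ⊗ v ↑ 2 ⊕ B ⊗ v ⊗ w ⊕ A ↑ 2 ⊗ w ↑ 2 ⊜
                𝟘 ⊕ (A ⊗ v ⊕ B ⊗ w) ⊗ (v ⊖ 𝟘) ⊕ (A ↑ 2 ⊗ w) ⊗ (w ⊖ 𝟘)) A B v w)
            (absorb₂ v≈0 w≈0)))

        y₁∈ : ∀ K → v ∈ K → w ∈ K → a.x₁ ∈ K → y.x₁ ∈ K
        y₁∈ K v∈ w∈ x∈ = ∈-resp K (sym y₁≈) (T-closed K v∈ w∈ x∈)

        y₂∈ : ∀ K → v ∈ K → w ∈ K → a.x₂ ∈ K → y.x₂ ∈ K
        y₂∈ K v∈ w∈ x∈ = ∈-resp K (sym y₂≈) (T-closed K v∈ w∈ x∈)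

        preimage-∈ : ∀ K {x y} → v ∈ K → w ∈ K → cubic (- (3 · A)) (- B) x ≈ 0# → y ≈ T A v w x → y ∈ K → x ∈ K
        preimage-∈ K {x} {y} v∈ w∈ root y≈ y∈ = quotient-∈ K δ≉0 (Solution.inverse-T sol x root)
          (closed K 4 (λ A B v w → v ↑ 3 ⊖ 3 ⊙ (A ⊗ v ⊗ w ↑ 2) ⊖ B ⊗ w ↑ 3) (A∈ K ∷ B∈ K ∷ v∈ ∷ w∈ ∷ []))
          (closed K 5 (λ A C′ v w y → (v ↑ 2 ⊖ A ⊗ w ↑ 2) ⊗ y ⊖ w ⊗ (y ↑ 2 ⊖ 2 ⊙ C′))
            (A∈ K ∷ C∈ K ∷ v∈ ∷ w∈ ∷ ∈-resp K y≈ y∈ ∷ []))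

      roots-among : (ρ ρ′ : Roots C′ G) → ∀ K → Roots.x₁ ρ ∈ K → Roots.x₂ ρ ∈ K →
        ∀ {t} → cubic (- (3 · C′)) (- G) t ≈ 0# → t ∈ K
      roots-among ρ ρ′ K y₁∈ y₂∈ t-root =
        [ (λ t≈ → ∈-resp K (sym t≈) y₁∈)
        , [ (λ t≈ → ∈-resp K (sym t≈) y₂∈)
          , (λ t≈ → ∈-resp K (trans (sym ρ.third-root) (sym t≈))
              (closed K 2 (λ x y → ⊝ x ⊖ y) (y₁∈ ∷ y₂∈ ∷ []))) ]′ ]′ (ρ.root-cases t-root)
        where module ρ = Roots ρ

      module _ {θ} (Fθ≈0 : F θ ≈ 0#) (K : Intermediate) (θ∈ : θ ∈ K) where
        private
          solution′ = root⇒solution Fθ≈0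
          v∈ = proj₁ (proj₂ (proj₂ (proj₂ (proj₂ solution′))) K θ∈)
          w∈ = proj₂ (proj₂ (proj₂ (proj₂ (proj₂ solution′))) K θ∈)
          open WithSolution (proj₁ (proj₂ (proj₂ (proj₂ solution′))))

        y-roots-∈ : a.x₁ ∈ K → a.x₂ ∈ K → ∀ {t} → cubic (- (3 · C′)) (- G) t ≈ 0# → t ∈ K
        y-roots-∈ x₁∈ x₂∈ = roots-among y-roots y-roots K (y₁∈ K v∈ w∈ x₁∈) (y₂∈ K v∈ w∈ x₂∈)

        x-roots-∈ : (ρ : Roots C′ G) → Roots.x₁ ρ ∈ K → Roots.x₂ ρ ∈ K → a.x₁ ∈ K × a.x₂ ∈ K
        x-roots-∈ ρ t₁∈ t₂∈ =
          preimage-∈ K v∈ w∈ a.root₁ y₁≈ (roots-among ρ ρ K t₁∈ t₂∈ y.root₁) ,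
          preimage-∈ K v∈ w∈ a.root₂ y₂≈ (roots-among ρ ρ K t₁∈ t₂∈ y.root₂)

        NoRoot-x⇒NoRoot-y : a.Irreducibleᶜ K → NoRoot K (- (3 · C′)) (- G)
        NoRoot-x⇒NoRoot-y = NoRoot-y K v∈ w∈

      -- Two different values of Y are the two roots of `Y² + sY + r`, whose sum is `- s`.
      conjugate-roots : ∀ {θ θ′} → F θ ≈ 0# → F θ′ ≈ 0# → ¬ Y θ - Y θ′ ≈ 0# → Y θ + Y θ′ + s ≈ 0#
      conjugate-roots {θ} {θ′} Fθ≈0 Fθ′≈0 = zero-product (trans
        (solve 4 (λ s r Y Y′ → (Y ⊖ Y′) ⊗ (Y ⊕ Y′ ⊕ s) ⊜
            𝟘 ⊕ 𝟙 ⊗ ((Y ↑ 2 ⊕ s ⊗ Y ⊕ r) ⊖ 𝟘) ⊕ (⊝ 𝟙) ⊗ ((Y′ ↑ 2 ⊕ s ⊗ Y′ ⊕ r) ⊖ 𝟘)) s r (Y θ) (Y θ′))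
        (absorb₂ Fθ≈0 Fθ′≈0))

      -- From now on the roots of the second cubic are numbered by those of the first,
      -- through the substitution belonging to a root θ₀ of F.
      module _ {θ₀} (Fθ₀≈0 : F θ₀ ≈ 0#) where
        private
          solution₀ = root⇒solution Fθ₀≈0
          v₀ w₀ δ₀ m₀ : Carrier
          v₀ = proj₁ solution₀
          w₀ = proj₁ (proj₂ solution₀)
          δ₀ = δ A B v₀ w₀
          m₀ = μ A B C′ w₀

          sol₀ : Solution A B C′ G v₀ w₀
          sol₀ = proj₁ (proj₂ (proj₂ (proj₂ solution₀)))

          open WithSolution sol₀

        Sb : SplittingField C′ G Lbᴵ
        Sb = record
          { roots = y-roots
          ; A∈M   = SplittingField.A∈M Sb₀
          ; B∈M   = SplittingField.B∈M Sb₀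
          ; x₁∈L  = roots-among b.roots b.roots Lbᴵ b.x₁∈L b.x₂∈L y.root₁
          ; x₂∈L  = roots-among b.roots b.roots Lbᴵ b.x₁∈L b.x₂∈L y.root₂
          ; least = λ K y₁∈ y₂∈ → b.least K
              (roots-among y-roots y-roots K y₁∈ y₂∈ b.root₁) (roots-among y-roots y-roots K y₁∈ y₂∈ b.root₂)
          }
          where module b = SplittingField Sb₀

        private module b = SplittingField Sb

        Y₀ : Carrier
        Y₀ = Y θ₀

        private
          m₀≈DY₀ : m₀ ≈ D * Y₀
          m₀≈DY₀ = trans (μ≈ w₀) (*-congˡ (+-cong (^-cong 3 3w≈θ) (*-congˡ 3w≈θ)))
            where
            3w≈θ : 3 · w₀ ≈ θ₀
            3w≈θ = proj₁ (proj₂ (proj₂ solution₀))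

          m₀∈ : ∀ K → Y₀ ∈ K → m₀ ∈ K
          m₀∈ K Y₀∈ = ∈-resp K (sym m₀≈DY₀) (Intermediate.*-closed K (base⊆ K D∈M) Y₀∈)

          δ₀∈ : ∀ K → Y₀ ∈ K → δ₀ ∈ K
          δ₀∈ K Y₀∈ = quotient-∈ K B≉0 (sym (Solution.2μ+G sol₀)) (B∈ K)
            (closed K 2 (λ m G → 2 ⊙ m ⊕ G) (m₀∈ K Y₀∈ ∷ G∈ K ∷ []))

          Y₀∈ : ∀ K → m₀ ∈ K → Y₀ ∈ K
          Y₀∈ K m₀∈ = quotient-∈ K D≉0 (sym m₀≈DY₀) (base⊆ K D∈M) m₀∈

        -- Since `m₀ = D Y₀` and `B δ₀ = 2 m₀ + G`, the affine map from one `ω` to the other is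
        -- defined over every field containing `Y₀`.
        Y₀∈⇒ω-y∈ : ∀ K → Y₀ ∈ K → a.ω ∈ K → b.ω ∈ K
        Y₀∈⇒ω-y∈ K Y₀∈ ω∈ = ∈-resp K (sym ω-transform)
          (closed K 3 (λ δ ω m → δ ⊗ ω ⊕ m) (δ₀∈ K Y₀∈ ∷ ω∈ ∷ m₀∈ K Y₀∈ ∷ []))

        Y₀∈⇒ω-x∈ : ∀ K → Y₀ ∈ K → b.ω ∈ K → a.ω ∈ K
        Y₀∈⇒ω-x∈ K Y₀∈ ω∈ = solution-∈ K a.ω δ≉0
          (trans (solve 4 (λ δ ω m ω′ → (m ⊖ ω′) ⊕ δ ⊗ ω ⊜ 𝟘 ⊕ (⊝ 𝟙) ⊗ (ω′ ⊖ (δ ⊗ ω ⊕ m))) δ₀ a.ω m₀ b.ω)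
                 (absorb ω-transform))
          (δ₀∈ K Y₀∈) (closed K 2 (λ m ω → m ⊖ ω) (m₀∈ K Y₀∈ ∷ ω∈ ∷ []))

        private
          δ-difference : (a.ω - a.ω′) * δ₀ ≈ b.ω - b.ω′
          δ-difference = trans
            (solve 6 (λ δ m ω ω′ u u′ → (ω ⊖ ω′) ⊗ δ ⊜ (u ⊖ u′) ⊕ (⊝ 𝟙) ⊗ (u ⊖ (δ ⊗ ω ⊕ m)) ⊕ 𝟙 ⊗ (u′ ⊖ (δ ⊗ ω′ ⊕ m)))
              δ₀ m₀ a.ω a.ω′ b.ω b.ω′)
            (absorb₂ ω-transform ω′-transform)

          ω-ω′≉0 : ¬ a.ω - a.ω′ ≈ 0#
          ω-ω′≉0 = difference-nonzero a.ω≉ω′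

          Y₀-from-δ : ∀ K → δ₀ ∈ K → b.ω - δ₀ * a.ω ∈ K → Y₀ ∈ K
          Y₀-from-δ K δ∈ m∈ = Y₀∈ K (∈-resp K (trans
            (solve 4 (λ δ m ω u → u ⊖ δ ⊗ ω ⊜ m ⊕ 𝟙 ⊗ (u ⊖ (δ ⊗ ω ⊕ m))) δ₀ m₀ a.ω b.ω) (absorb ω-transform)) m∈)

        -- The factor `δ₀` is the quotient of the differences `ω - ω′` of the two cubics, and `ω′`
        -- is rational along with `ω`; the translation `m₀` and `Y₀` follow.
        ω∈⇒Y₀∈ : a.ω ∈ base-field → b.ω ∈ base-field → Y₀ ∈ base-field
        ω∈⇒Y₀∈ ω∈ ω-y∈ = Y₀-from-δ base-field δ∈ (closed base-field 3 (λ δ ω u → u ⊖ δ ⊗ ω) (δ∈ ∷ ω∈ ∷ ω-y∈ ∷ []))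
          where
          conjugate-∈ : ∀ {A B} (ρ : Roots A B) → B ∈ base-field → Roots.ω ρ ∈ base-field → Roots.ω ρ - Roots.ω′ ρ ∈ base-field
          conjugate-∈ ρ B∈ ω∈ = ∈-resp base-field (+-congˡ (-‿cong (sym (Roots.ω+ω′ ρ))))
            (closed base-field 2 (λ B ω → ω ⊖ (⊝ B ⊖ ω)) (B∈ ∷ ω∈ ∷ []))

          δ∈ : δ₀ ∈ base-field
          δ∈ = quotient-∈ base-field ω-ω′≉0 δ-difference
            (conjugate-∈ a.roots a.B∈M ω∈) (conjugate-∈ b.roots b.B∈M ω-y∈)

        -- Let `t + u * ω` be the second `ω`. Matching traces shows that its conjugate is
        -- `t + u * ω′`, so the affine map has `δ₀ = u` and `m₀ = t`, both rational.
        ω-y∈M⟨ω⟩⇒Y₀∈ : a.ω ∉ base-field → b.ω ∉ base-field → b.ω ∈ base-field ⟨ a.ω ⟩ → Y₀ ∈ base-field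
        ω-y∈M⟨ω⟩⇒Y₀∈ ω∉ ω-y∉ ω-y∈ with quadratic-member {base-field} (a.ω-quadratic base-field) ω-y∈
        ... | t , u , t∈ , u∈ , ω-y≈ = Y₀-from-δ base-field (∈-resp base-field (sym δ≈u) u∈)
          (∈-resp base-field (trans
            (solve 5 (λ t u δ ω ω-y → t ⊜ (ω-y ⊖ δ ⊗ ω) ⊕ (⊝ 𝟙) ⊗ (ω-y ⊖ (t ⊕ u ⊗ ω)) ⊕ ω ⊗ (δ ⊖ u)) t u δ₀ a.ω b.ω)
            (absorb₂ ω-y≈ δ≈u)) t∈)
          where
          u≉0 : ¬ u ≈ 0#
          u≉0 u≈0 = ω-y∉ (∈-resp base-field (sym (trans ω-y≈ (trans (+-congˡ (trans (*-congʳ u≈0) (zeroˡ _))) (+-identityʳ t)))) t∈)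

          -- ω satisfies a quadratic equation over M, of which that of t + uω is a multiple.
          trace : 2 · t - u * B + G ≈ 0#
          trace = decidable-stable (zero? _) λ k≉0 → ω∉ (solution-∈ base-field a.ω (nonzero-* u≉0 k≉0)
            (trans (solve 8 (λ A B C′ G t u ω ω-y →
                (t ↑ 2 ⊕ u ↑ 2 ⊗ (3 ⊙ A ↑ 3 ⊖ B ↑ 2) ⊕ G ⊗ t ⊖ (3 ⊙ C′ ↑ 3 ⊖ G ↑ 2)) ⊕ u ⊗ (2 ⊙ t ⊖ u ⊗ B ⊕ G) ⊗ ω ⊜
                𝟘 ⊕ 𝟙 ⊗ (ω-y ↑ 2 ⊖ (⊝ G ⊗ ω-y ⊕ (3 ⊙ C′ ↑ 3 ⊖ G ↑ 2)))
                  ⊕ (⊝ (u ↑ 2)) ⊗ (ω ↑ 2 ⊖ (⊝ B ⊗ ω ⊕ (3 ⊙ A ↑ 3 ⊖ B ↑ 2)))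
                  ⊕ (⊝ (ω-y ⊕ t ⊕ u ⊗ ω ⊕ G)) ⊗ (ω-y ⊖ (t ⊕ u ⊗ ω)))
                A B C′ G t u a.ω b.ω)
              (absorb₃ b.ω² a.ω² ω-y≈))
            (closed base-field 4 (λ t u B G → u ⊗ (2 ⊙ t ⊖ u ⊗ B ⊕ G)) (t∈ ∷ u∈ ∷ B∈ base-field ∷ G∈ base-field ∷ []))
            (closed base-field 6 (λ t u A B C′ G → t ↑ 2 ⊕ u ↑ 2 ⊗ (3 ⊙ A ↑ 3 ⊖ B ↑ 2) ⊕ G ⊗ t ⊖ (3 ⊙ C′ ↑ 3 ⊖ G ↑ 2))
              (t∈ ∷ u∈ ∷ A∈ base-field ∷ B∈ base-field ∷ C∈ base-field ∷ G∈ base-field ∷ [])))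

          δ≈u : δ₀ ≈ u
          δ≈u = *-cancel ω-ω′≉0 (trans δ-difference (trans
            (solve 8 (λ B G t u ω ω′ w w′ → w ⊖ w′ ⊜
                (ω ⊖ ω′) ⊗ u ⊕ 𝟚 ⊗ (w ⊖ (t ⊕ u ⊗ ω)) ⊕ (⊝ 𝟙) ⊗ (w′ ⊖ (⊝ G ⊖ w))
                  ⊕ u ⊗ (ω′ ⊖ (⊝ B ⊖ ω)) ⊕ 𝟙 ⊗ ((2 ⊙ t ⊖ u ⊗ B ⊕ G) ⊖ 𝟘))
              B G t u a.ω a.ω′ b.ω b.ω′)
            (trans (absorb trace) (absorb₃ ω-y≈ b.ω+ω′ a.ω+ω′))))
            where
            𝟚 : Expr
            𝟚 = 𝟙 ⊕ 𝟙

        Y₀-quadratic : ∀ K → Quadratic K Y₀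
        Y₀-quadratic K = - s , - r , Intermediate.-‿closed K (s∈ K) , Intermediate.-‿closed K (r∈ K) , trans
          (solve 3 (λ s r Y → Y ↑ 2 ⊜ (⊝ s ⊗ Y ⊕ ⊝ r) ⊕ 𝟙 ⊗ ((Y ↑ 2 ⊕ s ⊗ Y ⊕ r) ⊖ 𝟘)) s r Y₀) (absorb Fθ₀≈0)

        rational-root⇒Y₀∈M : ∀ {θ} → F θ ≈ 0# → θ ∈ base-field → Y₀ ∈ base-field
        rational-root⇒Y₀∈M {θ} Fθ≈0 θ∈ with zero? (Y₀ - Y θ)
        ... | yes p = ∈-resp base-field (sym (difference-zero p)) (Y-∈ base-field θ∈)
        ... | no  p = ∈-resp base-field
          (sym (trans (solve 3 (λ s Y Y′ → Y ⊜ (⊝ s ⊖ Y′) ⊕ 𝟙 ⊗ ((Y ⊕ Y′ ⊕ s) ⊖ 𝟘)) s Y₀ (Y θ))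
            (absorb (conjugate-roots Fθ₀≈0 Fθ≈0 p))))
          (closed base-field 2 (λ s Y → ⊝ s ⊖ Y) (s∈ base-field ∷ Y-∈ base-field θ∈ ∷ []))

        -- Multiplied by D this is `2 m₀ + G = B δ₀`, so the two values of Y are distinct.
        2Y₀+s≉0 : ¬ 2 · Y₀ + s ≈ 0#
        2Y₀+s≉0 p = nonzero-* B≉0 δ≉0 (trans (sym (Solution.2μ+G sol₀)) (trans
          (solve 5 (λ G D d m Y → 2 ⊙ m ⊕ G ⊜
              𝟘 ⊕ D ⊗ ((2 ⊙ Y ⊕ G ⊗ d) ⊖ 𝟘) ⊕ (⊝ G) ⊗ (D ⊗ d ⊖ 𝟙) ⊕ (2 ⊙ 𝟙) ⊗ (m ⊖ D ⊗ Y)) G D d m₀ Y₀)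
          (absorb₃ p Dd≈1 m₀≈DY₀)))

        Y-on-cubic : ∀ {z y} → cubic p (- y) z ≈ 0# → Y z ≈ y
        Y-on-cubic {z} {y} root = trans
          (solve 3 (λ p y z → z ↑ 3 ⊕ p ⊗ z ⊜ y ⊕ 𝟙 ⊗ ((z ↑ 3 ⊕ p ⊗ z ⊕ ⊝ y) ⊖ 𝟘)) p y z) (absorb root)

        F-on-cubic : ∀ {z y} → y ^ 2 + s * y + r ≈ 0# → cubic p (- y) z ≈ 0# → F z ≈ 0#
        F-on-cubic y² root = trans (+-congʳ (+-cong (^-cong 2 Y≈) (*-congˡ Y≈))) y²
          where
          Y≈ = Y-on-cubic root

        -- A root z in `K = M⟨Y₀⟩` would put the root `T(x₁)` of the second cubic into `M⟨x₁⟩⟨Y₀⟩`.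
        -- But `M⟨x₁⟩` has no such root: the second cubic is irreducible over M, by z itself, so one
        -- would come from a rational root of F and make `Y₀` rational. The quadratic step to `Y₀`
        -- adds none.
        cubic-factor-irreducible : Y₀ ∉ base-field → NoRoot (base-field ⟨ Y₀ ⟩) p (- Y₀)
        cubic-factor-irreducible Y₀∉ z z∈ root =
          NoRoot-quadratic {M⟨x₁⟩} (P∈ M⟨x₁⟩) (Q∈ M⟨x₁⟩) noRoot₁ (Y₀-quadratic M⟨x₁⟩) y₁ y₁∈′ y-root
          where
          K M⟨x₁⟩ : Intermediate
          K = base-field ⟨ Y₀ ⟩
          M⟨x₁⟩ = base-field ⟨ a.x₁ ⟩

          P∈ : ∀ K → - (3 · C′) ∈ K
          P∈ = b.P∈

          Q∈ : ∀ K → - G ∈ K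
          Q∈ = b.Q∈

          noRootᴷ : a.Irreducibleᶜ K
          noRootᴷ = NoRoot-quadratic {base-field} (a.P∈ base-field) (a.Q∈ base-field) irreducible (Y₀-quadratic base-field)

          Fz≈0 : F z ≈ 0#
          Fz≈0 = F-on-cubic Fθ₀≈0 root

          noRoot-y : NoRoot K (- (3 · C′)) (- G)
          noRoot-y = NoRoot-x⇒NoRoot-y Fz≈0 K z∈ noRootᴷ

          noRoot₁ : NoRoot M⟨x₁⟩ (- (3 · C′)) (- G)
          noRoot₁ t t∈ t-root =
            let v , w , v∈ , w∈ , sol , _ = solution-from-root base-field a.roots (A∈ base-field) (B∈ base-field)
                  (C∈ base-field) (G∈ base-field) irreducible (λ u u∈ → noRoot-y u (base⊆ K u∈)) t∈ t-root
            in Y₀∉ (rational-root⇒Y₀∈M (solution⇒root sol) (closed base-field 1 (λ w → 3 ⊙ w) (w∈ ∷ [])))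

          solutionᶻ = root⇒solution Fz≈0
          module W = WithSolution (proj₁ (proj₂ (proj₂ (proj₂ solutionᶻ))))

          y₁ : Carrier
          y₁ = W.y.x₁

          y-root : cubic (- (3 · C′)) (- G) y₁ ≈ 0#
          y-root = W.y.root₁

          K′ : Intermediate
          K′ = M⟨x₁⟩ ⟨ Y₀ ⟩

          K⊑K′ : K ⊑ K′
          K⊑K′ = ⟨⟩-least {base-field} {K′} (base⊆ K′) (⟨⟩-generator {M⟨x₁⟩})

          y₁∈′ : y₁ ∈ K′
          y₁∈′ = W.y₁∈ K′ (K⊑K′ (proj₁ vw∈)) (K⊑K′ (proj₂ vw∈)) (⟨⟩-base {M⟨x₁⟩} (⟨⟩-generator {base-field}))
            where
            vw∈ = proj₂ (proj₂ (proj₂ (proj₂ solutionᶻ))) K z∈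

      -- Factorisations of the sextic over M

      sextic : Mᵈ.Poly
      sextic = Mᵈ.F₂ a b Da#0

      private
        c₀ c₁ c₂ c₃ c₄ : Expr → Expr → Expr → Expr → Expr → Expr → Expr
        c₀ A C′ G D E d = (C′ ↑ 3 ⊗ D ⊖ A ↑ 3 ⊗ E) ⊗ d ↑ 3
        c₁ A C′ G D E d = ⊝ (A ⊗ C′ ⊗ G ⊗ d ↑ 2)
        c₂ A C′ G D E d = A ↑ 2 ⊗ C′ ↑ 2 ⊗ d ↑ 2
        c₃ A C′ G D E d = G ⊗ d
        c₄ A C′ G D E d = ⊝ (2 ⊙ (A ⊗ C′) ⊗ d)

        -- The remaining coefficients are 0 and 1.
        coefficient : (Expr → Expr → Expr → Expr → Expr → Expr → Expr) → Expr
        coefficient f = f (var 0) (var 1) (var 2) (var 3) (var 4) (var 5)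

        lift₇ : (Expr → Expr → Expr → Expr → Expr → Expr → Expr) → Expr
        lift₇ f = f (var 0) (var 1) (var 2) (var 3) (var 4) (var 5)

        ρᴹ : Vec M.Carrier 6
        ρᴹ = Mᵈ.A a ∷ Mᵈ.A b ∷ Mᵈ.B b ∷ Mᵈ.D a ∷ Mᵈ.D b ∷ dᴹ ∷ []

      opaque
        unfolding A B C′ G D E d

        sextic-value : ∀ θ → evalᴹ sextic θ ≈ F θ
        sextic-value θ = solve-given 7 (lift₇ c₀ ∷ lift₇ c₁ ∷ lift₇ c₂ ∷ lift₇ c₃ ∷ lift₇ c₄ ∷ 𝟘 ∷ 𝟙 ∷ [])
          (λ A C′ G D E d θ k₀ k₁ k₂ k₃ k₄ k₅ k₆ → let Y = θ ↑ 3 ⊕ ⊝ (A ⊗ C′ ⊗ d) ⊗ θ in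
            k₀ ⊕ θ ⊗ (k₁ ⊕ θ ⊗ (k₂ ⊕ θ ⊗ (k₃ ⊕ θ ⊗ (k₄ ⊕ θ ⊗ (k₅ ⊕ θ ⊗ (k₆ ⊕ θ ⊗ 𝟘)))))) ⊜
            Y ↑ 2 ⊕ G ⊗ d ⊗ Y ⊕ (C′ ↑ 3 ⊗ D ⊖ A ↑ 3 ⊗ E) ⊗ d ↑ 3)
          (A ∷ C′ ∷ G ∷ D ∷ E ∷ d ∷ θ ∷ [])
          (ι-⟦⟧ (coefficient c₀) ρᴹ ∷ ι-⟦⟧ (coefficient c₁) ρᴹ ∷ ι-⟦⟧ (coefficient c₂) ρᴹ
            ∷ ι-⟦⟧ (coefficient c₃) ρᴹ ∷ ι-⟦⟧ (coefficient c₄) ρᴹ ∷ ι-0 ∷ ι-1 ∷ [])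

      opaque
        θ₀-root : ∃ λ θ → evalᴹ sextic θ ≈ 0#
        θ₀-root = algebraicallyClosed (List.map ι sextic) 5 (≉⇒# (λ ι1≈0 → 1≉0 (trans (sym ι-1) ι1≈0)) , coeff-beyond _)

      θ₀ : Carrier
      θ₀ = proj₁ θ₀-root

      Fθ₀≈0 : F θ₀ ≈ 0#
      Fθ₀≈0 = trans (sym (sextic-value θ₀)) (proj₂ θ₀-root)

      private
        pᴹ sᴹ rᴹ : M.Carrier
        pᴹ = M.- (Mᵈ.A a M.* Mᵈ.A b M.* dᴹ)
        sᴹ = Mᵈ.B b M.* dᴹ
        rᴹ = (Mᵈ.A b Mᵈ.^ 3 M.* Mᵈ.D a M.- Mᵈ.A a Mᵈ.^ 3 M.* Mᵈ.D b) M.* dᴹ Mᵈ.^ 3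

        opaque
          unfolding A B C′ G D E d

          ι-p : ι pᴹ ≈ p
          ι-p = ι-⟦⟧ (⊝ (var 0 ⊗ var 1 ⊗ var 2)) (Mᵈ.A a ∷ Mᵈ.A b ∷ dᴹ ∷ [])

          ι-s : ι sᴹ ≈ s
          ι-s = ι-* (Mᵈ.B b) dᴹ

          ι-r : ι rᴹ ≈ r
          ι-r = ι-⟦⟧ (coefficient c₀) ρᴹ

        Resolvent : M.Carrier → Set ℓ₁
        Resolvent y = y Mᵈ.^ 2 M.+ sᴹ M.* y M.+ rᴹ M.≈ M.0#

        ι-resolvent : ∀ y → ι (y Mᵈ.^ 2 M.+ sᴹ M.* y M.+ rᴹ) ≈ ι y ^ 2 + s * ι y + r
        ι-resolvent y = trans (ι-⟦⟧ (var 0 ↑ 2 ⊕ var 1 ⊗ var 0 ⊕ var 2) (y ∷ sᴹ ∷ rᴹ ∷ []))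
          (+-cong (+-congˡ (*-congʳ ι-s)) ι-r)

        resolvent-root : ∀ {y θ} → ι y ≈ Y θ → F θ ≈ 0# → Resolvent y
        resolvent-root {y} ιy≈ Fθ≈0 = ι-injective (trans (ι-resolvent y)
          (trans (+-congʳ (+-cong (^-cong 2 ιy≈) (*-congˡ ιy≈))) (trans Fθ≈0 (sym ι-0))))

        conjugate : M.Carrier → M.Carrier
        conjugate y = M.- sᴹ M.- y

        resolvent-conjugate : ∀ {y} → Resolvent y → Resolvent (conjugate y)
        resolvent-conjugate {y} = M.trans
          (Mᵖ.solve 3 (λ s r y → let y′ = ⊝ s ⊖ y in y′ ↑ 2 ⊕ s ⊗ y′ ⊕ r ⊜ y ↑ 2 ⊕ s ⊗ y ⊕ r) sᴹ rᴹ y)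

        cubicᴹ : M.Carrier → Mᵈ.Poly
        cubicᴹ y = M.- y ∷ pᴹ ∷ M.0# ∷ M.1# ∷ []

        cubicᴹ-value : ∀ y t → evalᴹ (cubicᴹ y) t ≈ cubic p (- ι y) t
        cubicᴹ-value y t = trans
          (solve-given 3 (⊝ var 0 ∷ 𝟘 ∷ 𝟙 ∷ []) (λ y q t -y zero one →
            -y ⊕ t ⊗ (q ⊕ t ⊗ (zero ⊕ t ⊗ (one ⊕ t ⊗ 𝟘))) ⊜ t ↑ 3 ⊕ q ⊗ t ⊕ ⊝ y)
            (ι y ∷ ι pᴹ ∷ t ∷ []) (ι-neg y ∷ ι-0 ∷ ι-1 ∷ []))
          (+-congʳ (+-congˡ (*-congʳ ι-p)))

        cubicᴹ-factor : ∀ y → (∀ m → ¬ cubic p (- ι y) (ι m) ≈ 0#) →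
          Mᵈ.Irreducible (cubicᴹ y) × Mᵈ.HasDegree (cubicᴹ y) 3
        cubicᴹ-factor y noRoot = independent⇒irreducible {cubicᴹ y} {2} {t} Mᵖ.1≉0 (Mᵖ.coeff-beyond (cubicᴹ y)) t-root
            (independent₃ (p∈ base-field) (Intermediate.-‿closed base-field (ι-∈ base-field y))
              (λ { x (m , ιm≈x) root → noRoot m (trans (+-congʳ (+-cong (^-cong 3 ιm≈x) (*-congˡ ιm≈x))) root) })
              (trans (sym (cubicᴹ-value y t)) t-root)) ,
          Mᵖ.≉⇒# Mᵖ.1≉0 , Mᵖ.coeff-beyond (cubicᴹ y)
          where
          root : ∃ λ t → evalᴹ (cubicᴹ y) t ≈ 0#
          root = algebraicallyClosed (List.map ι (cubicᴹ y)) 2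
            (≉⇒# (λ ι1≈0 → 1≉0 (trans (sym ι-1) ι1≈0)) , coeff-beyond _)

          t : Carrier
          t = proj₁ root

          t-root : evalᴹ (cubicᴹ y) t ≈ 0#
          t-root = proj₂ root

        linearᴹ : M.Carrier → Mᵈ.Poly
        linearᴹ z = M.- z ∷ M.1# ∷ []

        linearᴹ-factor : ∀ z → Mᵈ.Irreducible (linearᴹ z) × Mᵈ.HasDegree (linearᴹ z) 1
        linearᴹ-factor z = independent⇒irreducible {linearᴹ z} {0} {ι z} Mᵖ.1≉0 (Mᵖ.coeff-beyond (linearᴹ z))
            (solve-given 1 (⊝ var 0 ∷ 𝟙 ∷ []) (λ z -z one → -z ⊕ z ⊗ (one ⊕ z ⊗ 𝟘) ⊜ 𝟘) (ι z ∷ []) (ι-neg z ∷ ι-1 ∷ []))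
            (independent₁ (ι z)) ,
          Mᵖ.≉⇒# Mᵖ.1≉0 , Mᵖ.coeff-beyond (linearᴹ z)

        -- The expanded product of `X³ + pX - y` and `X³ + pX - y′`.
        product-form : M.Carrier → M.Carrier → Mᵈ.Poly
        product-form y y′ = y M.* y′ ∷ M.- (pᴹ M.* (y M.+ y′)) ∷ pᴹ Mᵈ.^ 2 ∷ M.- (y M.+ y′) ∷ 2 Mᵈ.· pᴹ ∷ M.0# ∷ M.1# ∷ []

        sextic≈product-form : ∀ {y} → Resolvent y → product-form y (conjugate y) Mᵈ.≈ₚ sextic
        sextic≈product-form {y} resolvent = λ where
            0 → M.trans (Mᵖ.solve 3 (λ s r y → y ⊗ (⊝ s ⊖ y) ⊜ r ⊕ (⊝ 𝟙) ⊗ ((y ↑ 2 ⊕ s ⊗ y ⊕ r) ⊖ 𝟘)) sᴹ rᴹ y)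
                  (Mᵖ.absorb resolvent)
            1 → Mᵖ.solve 5 (λ A C′ G d y → ⊝ (⊝ (A ⊗ C′ ⊗ d) ⊗ (y ⊕ (⊝ (G ⊗ d) ⊖ y))) ⊜ ⊝ (A ⊗ C′ ⊗ G ⊗ d ↑ 2)) Aa Ab Bb dᴹ y
            2 → Mᵖ.solve 3 (λ A C′ d → (⊝ (A ⊗ C′ ⊗ d)) ↑ 2 ⊜ A ↑ 2 ⊗ C′ ↑ 2 ⊗ d ↑ 2) Aa Ab dᴹ
            3 → Mᵖ.solve 3 (λ G d y → ⊝ (y ⊕ (⊝ (G ⊗ d) ⊖ y)) ⊜ G ⊗ d) Bb dᴹ y
            4 → Mᵖ.solve 3 (λ A C′ d → 2 ⊙ ⊝ (A ⊗ C′ ⊗ d) ⊜ ⊝ (2 ⊙ (A ⊗ C′) ⊗ d)) Aa Ab dᴹ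
            5 → M.refl
            6 → M.refl
            (suc (suc (suc (suc (suc (suc (suc n))))))) → M.refl
          where
          Aa Ab Bb : M.Carrier
          Aa = Mᵈ.A a
          Ab = Mᵈ.A b
          Bb = Mᵈ.B b

        product-formₚ : Expr → Expr → Expr → List Expr
        product-formₚ p y y′ = y ⊗ y′ ∷ ⊝ (p ⊗ (y ⊕ y′)) ∷ p ↑ 2 ∷ ⊝ (y ⊕ y′) ∷ 2 ⊙ p ∷ 𝟘 ∷ 𝟙 ∷ []

        cubicₚ : Expr → Expr → List Expr
        cubicₚ p y = ⊝ y ∷ p ∷ 𝟘 ∷ 𝟙 ∷ []

        linearₚ : Expr → List Expr
        linearₚ z = ⊝ z ∷ 𝟙 ∷ []

        -- The empty product in which the right-nested `product` ends.
        unitₚ : List Expr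
        unitₚ = 𝟙 ∷ []

        Yᴹ : M.Carrier → M.Carrier
        Yᴹ z = z Mᵈ.^ 3 M.+ pᴹ M.* z

        ι-Y : ∀ z → ι (Yᴹ z) ≈ Y (ι z)
        ι-Y z = trans (ι-⟦⟧ (var 0 ↑ 3 ⊕ var 1 ⊗ var 0) (z ∷ pᴹ ∷ [])) (+-congˡ (*-congʳ ι-p))

        resolvent-Ω : ∀ {y} → Resolvent y → ι y ^ 2 + s * ι y + r ≈ 0#
        resolvent-Ω {y} resolvent = trans (sym (ι-resolvent y)) (trans (ι-cong resolvent) ι-0)

        conjugate≉ : ∀ {z} → F (ι z) ≈ 0# → ¬ ι (conjugate (Yᴹ z)) ≈ Y (ι z)
        conjugate≉ {z} Fz≈0 p = 2Y₀+s≉0 Fz≈0 (trans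
          (solve 3 (λ s y y′ → 2 ⊙ y ⊕ s ⊜ 𝟘 ⊕ (⊝ 𝟙) ⊗ (y′ ⊖ y) ⊕ 𝟙 ⊗ (y′ ⊖ (⊝ s ⊖ y))) s (Y (ι z)) (ι (conjugate (Yᴹ z))))
          (absorb₂ p (trans (ι-⟦⟧ (⊝ var 0 ⊖ var 1) (sᴹ ∷ Yᴹ z ∷ [])) (+-cong (-‿cong ι-s) (-‿cong (ι-Y z))))))

      irreducible-sextic : Y₀ Fθ₀≈0 ∉ base-field → Mᵈ.IrreducibleFactorDegrees sextic (6 ∷ [])
      irreducible-sextic Y₀∉M = (λ _ → sextic) , (λ { 0F →
          independent⇒irreducible {sextic} {5} {θ₀} Mᵖ.1≉0 (Mᵖ.coeff-beyond sextic) (proj₂ θ₀-root)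
            (independent₆ (p∈ base-field) Y₀∉M (cubic-factor-irreducible Fθ₀≈0 Y₀∉M)
              (-‿inverseʳ (Y θ₀))) ,
          Mᵖ.≉⇒# Mᵖ.1≉0 , Mᵖ.coeff-beyond sextic }) ,
        solveₚ [] ((var 0 ∷ var 1 ∷ var 2 ∷ var 3 ∷ var 4 ∷ var 5 ∷ var 6 ∷ []) ⊗ₚ unitₚ)
          (var 0 ∷ var 1 ∷ var 2 ∷ var 3 ∷ var 4 ∷ var 5 ∷ var 6 ∷ [])
          (Mᵈ.coeff sextic 0 ∷ Mᵈ.coeff sextic 1 ∷ Mᵈ.coeff sextic 2 ∷ Mᵈ.coeff sextic 3 ∷ Mᵈ.coeff sextic 4
            ∷ M.0# ∷ M.1# ∷ []) []

      two-cubics : Y₀ Fθ₀≈0 ∈ base-field → (∀ m → ¬ F (ι m) ≈ 0#) → Mᵈ.IrreducibleFactorDegrees sextic (3 ∷ 3 ∷ [])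
      two-cubics (y , ιy≈) noRoot = (λ { 0F → cubicᴹ y ; 1F → cubicᴹ y′ }) ,
        (λ { 0F → cubicᴹ-factor y (λ m root → noRoot m (F-on-cubic Fθ₀≈0 (resolvent-Ω resolvent) root))
           ; 1F → cubicᴹ-factor y′ (λ m root → noRoot m (F-on-cubic Fθ₀≈0 (resolvent-Ω (resolvent-conjugate resolvent)) root)) }) ,
        λ n → M.trans
          (solveₚ [] (cubicₚ (var 0) (var 1) ⊗ₚ (cubicₚ (var 0) (var 2) ⊗ₚ unitₚ)) (product-formₚ (var 0) (var 1) (var 2))
            (pᴹ ∷ y ∷ y′ ∷ []) [] n)
          (sextic≈product-form resolvent n)
        where
        y′ : M.Carrier
        y′ = conjugate y

        resolvent : Resolvent y
        resolvent = resolvent-root ιy≈ Fθ₀≈0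

      -- The cofactor of `X - z` in `X³ + pX - Y(z)` is `X² + zX + z² + p`. The other cubic has no
      -- rational root, because Y takes its other value on the roots of that cubic while z is the
      -- only rational root of F.
      one-root : ∀ z → F (ι z) ≈ 0# → (∀ m → F (ι m) ≈ 0# → ι m ≈ ι z) → Mᵈ.IrreducibleFactorDegrees sextic (1 ∷ 2 ∷ 3 ∷ [])
      one-root z Fz≈0 unique = (λ { 0F → linearᴹ z ; 1F → quadraticᴹ ; 2F → cubicᴹ y′ }) ,
        (λ { 0F → linearᴹ-factor z
           ; 1F → independent⇒irreducible {quadraticᴹ} {1} {t} Mᵖ.1≉0 (Mᵖ.coeff-beyond quadraticᴹ) t-root (independent₂ t∉M) ,
               Mᵖ.≉⇒# Mᵖ.1≉0 , Mᵖ.coeff-beyond quadraticᴹ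
           ; 2F → cubicᴹ-factor y′ (λ m root → conjugate≉ Fz≈0 (trans (sym (Y-on-cubic Fz≈0 root))
               (Y-cong (unique m (F-on-cubic Fz≈0 (resolvent-Ω (resolvent-conjugate resolvent)) root))))) }) ,
        λ n → M.trans
          (solveₚ [] (linearₚ (var 0) ⊗ₚ ((var 1 ⊕ var 0 ↑ 2 ∷ var 0 ∷ 𝟙 ∷ []) ⊗ₚ (cubicₚ (var 1) (var 2) ⊗ₚ unitₚ)))
            (product-formₚ (var 1) (var 0 ↑ 3 ⊕ var 1 ⊗ var 0) (var 2)) (z ∷ pᴹ ∷ y′ ∷ []) [] n)
          (sextic≈product-form resolvent n)
        where
        y′ : M.Carrier
        y′ = conjugate (Yᴹ z)

        Y-cong : ∀ {s t} → s ≈ t → Y s ≈ Y t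
        Y-cong s≈t = +-cong (^-cong 3 s≈t) (*-congˡ s≈t)

        resolvent : Resolvent (Yᴹ z)
        resolvent = resolvent-root (ι-Y z) Fz≈0

        quadraticᴹ : Mᵈ.Poly
        quadraticᴹ = pᴹ M.+ z Mᵈ.^ 2 ∷ z ∷ M.1# ∷ []

        root : ∃ λ t → evalᴹ quadraticᴹ t ≈ 0#
        root = algebraicallyClosed (List.map ι quadraticᴹ) 1
          (≉⇒# (λ ι1≈0 → 1≉0 (trans (sym ι-1) ι1≈0)) , coeff-beyond _)

        t : Carrier
        t = proj₁ root

        t-root : evalᴹ quadraticᴹ t ≈ 0#
        t-root = proj₂ root

        t-equation : p + ι z ^ 2 + ι z * t + t ^ 2 ≈ 0#
        t-equation = trans
          (solve-given 3 (var 0 ⊕ var 1 ↑ 2 ∷ 𝟙 ∷ []) (λ q z t k one →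
            q ⊕ z ↑ 2 ⊕ z ⊗ t ⊕ t ↑ 2 ⊜ k ⊕ t ⊗ (z ⊕ t ⊗ (one ⊕ t ⊗ 𝟘)))
            (p ∷ ι z ∷ t ∷ [])
            (trans (ι-⟦⟧ (var 0 ⊕ var 1 ↑ 2) (pᴹ ∷ z ∷ [])) (+-congʳ ι-p) ∷ ι-1 ∷ []))
          t-root

        -- A rational root of the quadratic factor would be z itself, a double root.
        t∉M : t ∉ base-field
        t∉M (m , ιm≈t) = derivative≉0′ Fz≈0 (trans
          (solve 3 (λ p z t → 3 ⊙ z ↑ 2 ⊕ p ⊜ (p ⊕ z ↑ 2 ⊕ z ⊗ t ⊕ t ↑ 2) ⊕ (⊝ (2 ⊙ z ⊕ t)) ⊗ (t ⊖ z)) p (ι z) t)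
          (trans (absorb (trans (sym ιm≈t) (unique m (trans (F-cong ιm≈t) Ft≈0)))) t-equation))
          where
          Ft≈0 : F t ≈ 0#
          Ft≈0 = trans (+-congʳ (+-cong (^-cong 2 Yt≈) (*-congˡ Yt≈))) Fz≈0
            where
            Yt≈ : Y t ≈ Y (ι z)
            Yt≈ = trans (solve 3 (λ p z t → t ↑ 3 ⊕ p ⊗ t ⊜ (z ↑ 3 ⊕ p ⊗ z)
                ⊕ (t ⊖ z) ⊗ ((p ⊕ z ↑ 2 ⊕ z ⊗ t ⊕ t ↑ 2) ⊖ 𝟘)) p (ι z) t) (absorb t-equation)

      -- Equal values of Y at distinct z and z′ force `p = - (z² + zz′ + z′²)`. Hence `- z - z′` is
      -- the third root of the same cubic, which splits.
      three-roots : ∀ z z′ → ¬ ι z ≈ ι z′ → F (ι z) ≈ 0# → Y (ι z) ≈ Y (ι z′) →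
        (∀ m → F (ι m) ≈ 0# → ι m ≈ ι z ⊎ ι m ≈ ι z′ ⊎ ι m ≈ - ι z - ι z′) →
        Mᵈ.IrreducibleFactorDegrees sextic (1 ∷ 1 ∷ 1 ∷ 3 ∷ [])
      three-roots z z′ z≉z′ Fz≈0 Y≈ cases =
        (λ { 0F → linearᴹ z ; 1F → linearᴹ z′ ; 2F → linearᴹ (M.- z M.- z′) ; 3F → cubicᴹ y′ }) ,
        (λ { 0F → linearᴹ-factor z ; 1F → linearᴹ-factor z′ ; 2F → linearᴹ-factor (M.- z M.- z′)
           ; 3F → cubicᴹ-factor y′ (λ m root → conjugate≉ Fz≈0 (trans (sym (Y-on-cubic Fz≈0 root))
               (same-Y (cases m (F-on-cubic Fz≈0 (resolvent-Ω (resolvent-conjugate resolvent)) root))))) }) ,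
        λ n → M.trans
          (solveₚ {3} (⊝ (var 0 ↑ 2 ⊕ var 0 ⊗ var 1 ⊕ var 1 ↑ 2) ∷ [])
            (linearₚ (var 0) ⊗ₚ (linearₚ (var 1) ⊗ₚ (linearₚ (⊝ var 0 ⊖ var 1) ⊗ₚ (cubicₚ (var 3) (var 2) ⊗ₚ unitₚ))))
            (product-formₚ (var 3) (var 0 ↑ 3 ⊕ var 3 ⊗ var 0) (var 2)) (z ∷ z′ ∷ y′ ∷ []) (pᴹ≈ ∷ []) n)
          (sextic≈product-form resolvent n)
        where
        y′ : M.Carrier
        y′ = conjugate (Yᴹ z)

        resolvent : Resolvent (Yᴹ z)
        resolvent = resolvent-root (ι-Y z) Fz≈0

        p≈ : p ≈ - (ι z ^ 2 + ι z * ι z′ + ι z′ ^ 2)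
        p≈ = *-cancel (difference-nonzero z≉z′) (trans
          (solve 3 (λ p z w → (z ⊖ w) ⊗ p ⊜ (z ⊖ w) ⊗ ⊝ (z ↑ 2 ⊕ z ⊗ w ⊕ w ↑ 2)
              ⊕ 𝟙 ⊗ ((z ↑ 3 ⊕ p ⊗ z) ⊖ (w ↑ 3 ⊕ p ⊗ w))) p (ι z) (ι z′)) (absorb Y≈))

        pᴹ≈ : pᴹ M.≈ M.- (z Mᵈ.^ 2 M.+ z M.* z′ M.+ z′ Mᵈ.^ 2)
        pᴹ≈ = ι-injective (trans ι-p (trans p≈ (sym (ι-⟦⟧ (⊝ (var 0 ↑ 2 ⊕ var 0 ⊗ var 1 ⊕ var 1 ↑ 2)) (z ∷ z′ ∷ [])))))

        Y-cong : ∀ {s t} → s ≈ t → Y s ≈ Y t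
        Y-cong s≈t = +-cong (^-cong 3 s≈t) (*-congˡ s≈t)

        third : Y (- ι z - ι z′) ≈ Y (ι z)
        third = trans (solve 3 (λ p z w → let t = ⊝ z ⊖ w in t ↑ 3 ⊕ p ⊗ t ⊜ (z ↑ 3 ⊕ p ⊗ z)
            ⊕ (⊝ (2 ⊙ z ⊕ w)) ⊗ (p ⊖ ⊝ (z ↑ 2 ⊕ z ⊗ w ⊕ w ↑ 2))) p (ι z) (ι z′)) (absorb p≈)

        same-Y : ∀ {t} → t ≈ ι z ⊎ t ≈ ι z′ ⊎ t ≈ - ι z - ι z′ → Y t ≈ Y (ι z)
        same-Y = [ Y-cong , [ (λ t≈ → trans (Y-cong t≈) (sym Y≈)) , (λ t≈ → trans (Y-cong t≈) third) ]′ ]′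

      La Lb : Subfield
      La = Spl base (Mᵈ.f₃ a)
      Lb = Spl base (Mᵈ.f₃ b)

      Sᵇ : SplittingField C′ G Lbᴵ
      Sᵇ = Sb Fθ₀≈0

      private
        module b₀ = SplittingField Sb₀
        module b = SplittingField Sᵇ

        y₀ : Carrier
        y₀ = Y₀ Fθ₀≈0

        M⟨x₁⟩ M⟨ω⟩ : Intermediate
        M⟨x₁⟩ = base-field ⟨ a.x₁ ⟩
        M⟨ω⟩ = base-field ⟨ a.ω ⟩

        x₁∈M⟨x₁⟩ : a.x₁ ∈ M⟨x₁⟩
        x₁∈M⟨x₁⟩ = ⟨⟩-generator {base-field}

        IrreducibleB : Set _
        IrreducibleB = b.Irreducibleᶜ base-field

      -- Rational roots of the sextic

      opaque
        unfolding A B C′ G D E d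

        same-splitting : ∀ {θ} → F θ ≈ 0# → (N : Intermediate) → θ ∈ N →
          Member (Spl (Intermediate.Contains N) (Mᵈ.f₃ a)) ≐ Member (Spl (Intermediate.Contains N) (Mᵈ.f₃ b))
        same-splitting Fθ≈0 N θ∈N =
          (λ x∈ → splitting-least a Da≉0 N a.roots Nb (N⊑splitting b Db≉0 N) (proj₁ x-roots) (proj₂ x-roots) x∈) ,
          (λ x∈ → splitting-least b Db≉0 N b₀.roots Na (N⊑splitting a Da≉0 N) (y-root b₀.root₁) (y-root b₀.root₂) x∈)
          where
          Na Nb : Intermediate
          Na = splitting a Da≉0 N
          Nb = splitting b Db≉0 N

          x-roots : a.x₁ ∈ Nb × a.x₂ ∈ Nb
          x-roots = x-roots-∈ Fθ≈0 Nb (N⊑splitting b Db≉0 N θ∈N) b₀.roots (root-∈ b Db≉0 N b₀.root₁) (root-∈ b Db≉0 N b₀.root₂)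

          y-root : ∀ {t} → cubic (- (3 · C′)) (- G) t ≈ 0# → t ∈ Na
          y-root = y-roots-∈ Fθ≈0 Na (N⊑splitting a Da≉0 N θ∈N) (root-∈ a Da≉0 N a.root₁) (root-∈ a Da≉0 N a.root₂)

      private
        rational-root⇒same : ∀ m → F (ι m) ≈ 0# → Member La ≐ Member Lb
        rational-root⇒same m Fm≈0 = same-splitting Fm≈0 base-field (ι-∈ base-field m)

        rational-root⇒irreducible : ∀ m → F (ι m) ≈ 0# → IrreducibleB
        rational-root⇒irreducible m Fm≈0 = NoRoot-x⇒NoRoot-y Fm≈0 base-field (ι-∈ base-field m) irreducible

        ω-x∈⇒ω-y∈ : ∀ K → y₀ ∈ base-field → a.ω ∈ K → b.ω ∈ K
        ω-x∈⇒ω-y∈ K Y∈ = Y₀∈⇒ω-y∈ Fθ₀≈0 K (base⊆ K Y∈)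

        ω-x∈La : a.ω ∈ Laᴵ
        ω-x∈La = a.ω∈ Laᴵ a.x₁∈L a.x₂∈L

        ω-y∈Lb : b.ω ∈ Lbᴵ
        ω-y∈Lb = b.ω∈ Lbᴵ b.x₁∈L b.x₂∈L

        Lb⊑La⇒Y∈M : a.ω ∉ base-field → b.ω ∉ base-field → b.ω ∈ Laᴵ → y₀ ∈ base-field
        Lb⊑La⇒Y∈M ω∉ ω-y∉ ω-y∈ = ω-y∈M⟨ω⟩⇒Y₀∈ Fθ₀≈0 ω∉ ω-y∉
          (quadratic-subfield Sa irreducible ω-y∈ (b.ω-quadratic base-field))

        La⊑M⟨x₁⟩ : a.ω ∈ base-field → Laᴵ ⊑ M⟨x₁⟩
        La⊑M⟨x₁⟩ ω∈ = a.least M⟨x₁⟩ x₁∈M⟨x₁⟩ (a.x₂∈ M⟨x₁⟩ x₁∈M⟨x₁⟩ (base⊆ M⟨x₁⟩ ω∈))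

        La⊑M⟨x₁⟩⟨ω⟩ : Laᴵ ⊑ M⟨x₁⟩ ⟨ a.ω ⟩
        La⊑M⟨x₁⟩⟨ω⟩ = a.least K x₁∈K (a.x₂∈ K x₁∈K (⟨⟩-generator {M⟨x₁⟩}))
          where
          K : Intermediate
          K = M⟨x₁⟩ ⟨ a.ω ⟩

          x₁∈K : a.x₁ ∈ K
          x₁∈K = ⟨⟩-base {M⟨x₁⟩} x₁∈M⟨x₁⟩

        -- A root of the second cubic in M⟨x₁⟩ yields a rational root of the sextic.
        record RationalRoot (y : Carrier) : Set (c ⊔ ℓ₁) where
          field
            z           : M.Carrier
            v w         : Carrier
            v∈M         : v ∈ base-field
            w∈M         : w ∈ base-field
            3w≈z        : 3 · w ≈ ι z
            sol         : Solution A B C′ G v w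
            y≈          : y ≈ T A v w a.x₁

          root : F (ι z) ≈ 0#
          root = trans (F-cong (sym 3w≈z)) (solution⇒root sol)

        rational-root-from : IrreducibleB → ∀ {y} → y ∈ M⟨x₁⟩ → cubic (- (3 · C′)) (- G) y ≈ 0# → RationalRoot y
        rational-root-from irreducibleB y∈ y-root with solution-from-root base-field a.roots (A∈ base-field) (B∈ base-field)
          (C∈ base-field) (G∈ base-field) irreducible irreducibleB y∈ y-root
        ... | v , w , v∈ , (m , ιm≈w) , sol , y≈ = record
          { z = 3 Mᵈ.· m ; v = v ; w = w ; v∈M = v∈ ; w∈M = m , ιm≈w
          ; 3w≈z = trans (+-cong (sym ιm≈w) (+-cong (sym ιm≈w) (+-congʳ (sym ιm≈w)))) (sym (ι-· 3 m))
          ; sol = sol ; y≈ = y≈ }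

        rational-root-of : ∀ m → F (ι m) ≈ 0# → ∃ λ y → cubic (- (3 · C′)) (- G) y ≈ 0# × y ∈ M⟨x₁⟩ ×
          ∃₂ λ v w → v ∈ base-field × w ∈ base-field × 3 · w ≈ ι m × y ≈ T A v w a.x₁
        rational-root-of m Fm≈0 = W.y.x₁ , W.y.root₁ , W.y₁∈ M⟨x₁⟩ (base⊆ M⟨x₁⟩ v∈M) (base⊆ M⟨x₁⟩ w∈M) x₁∈M⟨x₁⟩ ,
          v , w , v∈M , w∈M , proj₁ (proj₂ (proj₂ solution′)) , W.y₁≈
          where
          solution′ : ∃₂ λ v w → 3 · w ≈ ι m × Solution A B C′ G v w × (∀ K → ι m ∈ K → v ∈ K × w ∈ K)
          solution′ = root⇒solution Fm≈0

          v w : Carrier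
          v = proj₁ solution′
          w = proj₁ (proj₂ solution′)

          v∈M : v ∈ base-field
          v∈M = proj₁ (proj₂ (proj₂ (proj₂ (proj₂ solution′))) base-field (ι-∈ base-field m))

          w∈M : w ∈ base-field
          w∈M = proj₂ (proj₂ (proj₂ (proj₂ (proj₂ solution′))) base-field (ι-∈ base-field m))

          sol : Solution A B C′ G v w
          sol = proj₁ (proj₂ (proj₂ (proj₂ solution′)))

          module W = WithSolution sol

        T-injective : ∀ {v w v′ w′} → v ∈ base-field → w ∈ base-field → v′ ∈ base-field → w′ ∈ base-field →
          T A v w a.x₁ ≈ T A v′ w′ a.x₁ → v ≈ v′ × w ≈ w′
        T-injective {v} {w} {v′} {w′} v∈ w∈ v′∈ w′∈ eq =
          let _ , v≈ , w≈ = powers-independent base-field (a.P∈ base-field) (a.Q∈ base-field) irreducible a.root₁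
                (closed base-field 3 (λ A w w′ → ⊝ (2 ⊙ (A ⊗ (w ⊖ w′)))) (A∈ base-field ∷ w∈ ∷ w′∈ ∷ []))
                (closed base-field 2 (λ v v′ → v ⊖ v′) (v∈ ∷ v′∈ ∷ [])) (closed base-field 2 (λ v v′ → v ⊖ v′) (w∈ ∷ w′∈ ∷ []))
                (trans (solve 6 (λ A v w v′ w′ x → ⊝ (2 ⊙ (A ⊗ (w ⊖ w′))) ⊕ (v ⊖ v′) ⊗ x ⊕ (w ⊖ w′) ⊗ x ↑ 2 ⊜
                   𝟘 ⊕ 𝟙 ⊗ ((v ⊗ x ⊕ w ⊗ (x ↑ 2 ⊖ 2 ⊙ A)) ⊖ (v′ ⊗ x ⊕ w′ ⊗ (x ↑ 2 ⊖ 2 ⊙ A))))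
                   A v w v′ w′ a.x₁) (absorb eq))
          in difference-zero v≈ , difference-zero w≈

        3·-cong : ∀ {s t} → s ≈ t → 3 · s ≈ 3 · t
        3·-cong s≈t = +-cong s≈t (+-cong s≈t (+-congʳ s≈t))

        3·-cancel : ∀ {s t} → 3 · s ≈ 3 · t → s ≈ t
        3·-cancel {s} {t} p = *-cancel 3≉0 (trans (solve 1 (λ s → (3 ⊙ 𝟙) ⊗ s ⊜ 3 ⊙ s) s)
          (trans p (solve 1 (λ s → 3 ⊙ s ⊜ (3 ⊙ 𝟙) ⊗ s) t)))

        -- The root z determines w, and w determines v, so `y = T(x₁)` can be recovered.
        rational-root-injective : ∀ {y y′} (r : RationalRoot y) (r′ : RationalRoot y′) →
          ι (RationalRoot.z r) ≈ ι (RationalRoot.z r′) → y ≈ y′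
        rational-root-injective {y} {y′} r r′ z≈ = trans r.y≈ (trans (+-cong (*-congʳ v≈) (*-congʳ w≈)) (sym r′.y≈))
          where
          module r = RationalRoot r
          module r′ = RationalRoot r′

          w≈ : r.w ≈ r′.w
          w≈ = 3·-cancel (trans r.3w≈z (trans z≈ (sym r′.3w≈z)))

          v≈ : r.v ≈ r′.v
          v≈ = solution-unique (Solution-resp w≈ r.sol) r′.sol

      -- Degrees of the irreducible factors

      private
        six : (y₀ ∈ base-field → ⊥) → Mᵈ.IrreducibleFactorDegrees sextic (6 ∷ [])
        six = irreducible-sextic

        two-cubics-reducible : y₀ ∈ base-field → ¬ IrreducibleB → Mᵈ.IrreducibleFactorDegrees sextic (3 ∷ 3 ∷ [])
        two-cubics-reducible Y∈ reducible = two-cubics Y∈ λ m root → reducible (rational-root⇒irreducible m root)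

        two-cubics-different : y₀ ∈ base-field → ¬ (Member La ≐ Member Lb) → Mᵈ.IrreducibleFactorDegrees sextic (3 ∷ 3 ∷ [])
        two-cubics-different Y∈ different = two-cubics Y∈ λ m root → different (rational-root⇒same m root)

        relabelled-x₂∈ : (S : Relabelling Sᵇ) → ∀ K → b.ω ∈ K → SplittingField.x₂ (Relabelling.relabelled S) ∈ K
        relabelled-x₂∈ S K ω∈ = SplittingField.x₂∈ relabelled K (base⊆ K rational) (∈-resp K (sym ω-same) ω∈)
          where open Relabelling S

        relabelled-reducible : Relabelling Sᵇ → ¬ IrreducibleB
        relabelled-reducible S irreducibleB = irreducibleB (SplittingField.x₁ relabelled) rational (SplittingField.root₁ relabelled)
          where open Relabelling S

      module _ (ω∉ : a.ω ∉ base-field) where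
        module _ (irreducibleB : IrreducibleB) (ω-y∉ : b.ω ∉ base-field) where

          𝔖₃-𝔖₃-disjoint : Member La ∩ Member Lb ≐ base → Mᵈ.IrreducibleFactorDegrees sextic (6 ∷ [])
          𝔖₃-𝔖₃-disjoint (La∩Lb⊆M , _) = six λ Y∈ → ω-y∉ (La∩Lb⊆M (ω-x∈⇒ω-y∈ Laᴵ Y∈ ω-x∈La , ω-y∈Lb))

          -- The intersection contains an irrational x, quadratic over M, which lies in the fields
          -- of both `ω`. It generates the second `ω`, so that one lies in `M⟨ω⟩` and `Y₀` is
          -- rational. The fields differ, since otherwise `x₁` would be rational or quadratic.
          𝔖₃-𝔖₃-quadratic : HasDegreeOverBase (Member La ∩ Member Lb) 2 → Mᵈ.IrreducibleFactorDegrees sextic (3 ∷ 3 ∷ [])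
          𝔖₃-𝔖₃-quadratic degree-two = two-cubics-different Y∈ λ (La⊆Lb , _) →
            [ (λ x₁∈M → irreducible a.x₁ x₁∈M a.root₁)
            , NoRoot⇒¬Quadratic {base-field} (a.P∈ base-field) (a.Q∈ base-field) irreducible a.root₁ ]′
            (rational-or-quadratic (a.x₁∈L , La⊆Lb a.x₁∈L))
            where
            open TwoDimensional (Laᴵ ∩ᴵ Lbᴵ) degree-two

            Y∈ : y₀ ∈ base-field
            Y∈ = decidable-stable (holds? _) λ Y∉ → ¬⊑base λ {x} x∈ →
              [ id , (λ x-quadratic → decidable-stable (holds? _) λ x∉M → Y∉ (y₀-from x∉M x∈ x-quadratic)) ]′
              (rational-or-quadratic x∈)
              where
              y₀-from : ∀ {x} → x ∉ base-field → (Member La ∩ Member Lb) x → Quadratic base-field x → y₀ ∈ base-field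
              y₀-from {x} x∉M (x∈La , x∈Lb) x-quadratic =
                let t , u , t∈ , u∈ , x≈ = quadratic-member {base-field} (b.ω-quadratic base-field)
                      (quadratic-subfield Sᵇ irreducibleB x∈Lb x-quadratic)
                    u≉0 = λ u≈0 → x∉M (∈-resp base-field
                      (sym (trans x≈ (trans (+-congˡ (trans (*-congʳ u≈0) (zeroˡ _))) (+-identityʳ t)))) t∈)
                in ω-y∈M⟨ω⟩⇒Y₀∈ Fθ₀≈0 ω∉ ω-y∉ (solution-∈ M⟨ω⟩ b.ω u≉0
                  (trans (solve 4 (λ t u ω x → (t ⊖ x) ⊕ u ⊗ ω ⊜ 𝟘 ⊕ (⊝ 𝟙) ⊗ (x ⊖ (t ⊕ u ⊗ ω))) t u b.ω x) (absorb x≈))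
                  (base⊆ M⟨ω⟩ u∈)
                  (closed M⟨ω⟩ 2 (λ t x → t ⊖ x) (base⊆ M⟨ω⟩ t∈ ∷ quadratic-subfield Sa irreducible x∈La x-quadratic ∷ [])))

          𝔖₃-𝔖₃-equal : Member La ≐ Member Lb → Mᵈ.IrreducibleFactorDegrees sextic (1 ∷ 2 ∷ 3 ∷ [])
          𝔖₃-𝔖₃-equal (La⊆Lb , Lb⊆La) = one-root z₁.z z₁.root unique-root
            where
            -- Without a root in `M⟨x₁⟩` the second cubic would have none after adjoining `ω`
            -- either, although that field contains `La = Lb`.
            some-root : ∃ λ t → t ∈ M⟨x₁⟩ × cubic (- (3 · C′)) (- G) t ≈ 0#
            some-root = decidable-stable (holds? _) λ none →
              NoRoot-quadratic {M⟨x₁⟩} (b.P∈ M⟨x₁⟩) (b.Q∈ M⟨x₁⟩) (λ t t∈ t-root → none (t , t∈ , t-root))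
                (a.ω-quadratic M⟨x₁⟩) b.x₁ (La⊑M⟨x₁⟩⟨ω⟩ (Lb⊆La b.x₁∈L)) b.root₁

            z₁ : RationalRoot (proj₁ some-root)
            z₁ = rational-root-from irreducibleB (proj₁ (proj₂ some-root)) (proj₂ (proj₂ some-root))

            module z₁ = RationalRoot z₁

            -- With two of the roots, M⟨x₁⟩ would contain all three, and ω.
            at-most-one : ∀ {t t′} → t ∈ M⟨x₁⟩ → t′ ∈ M⟨x₁⟩ → cubic (- (3 · C′)) (- G) t ≈ 0# →
              cubic (- (3 · C′)) (- G) t′ ≈ 0# → t ≈ t′
            at-most-one {t} {t′} t∈ t′∈ t-root t′-root = difference-zero (decidable-stable (zero? _) λ t≉t′ →
              let b₁∈ , b₂∈ = two-roots Sᵇ M⟨x₁⟩ t∈ t′∈ t-root t′-root (λ t≈t′ → t≉t′ (trans (+-congʳ t≈t′) (-‿inverseʳ _)))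
              in ω-y∉ (quadratic∩cubic {base-field} (a.P∈ base-field) (a.Q∈ base-field) irreducible a.root₁
                   (b.ω-quadratic base-field) (b.ω∈ M⟨x₁⟩ b₁∈ b₂∈)))

            unique-root : ∀ m → F (ι m) ≈ 0# → ι m ≈ ι z₁.z
            unique-root m Fm≈0 =
              let y , y-root , y∈ , v , w , v∈ , w∈ , 3w≈m , y≈ = rational-root-of m Fm≈0
                  y≈t = at-most-one y∈ (proj₁ (proj₂ some-root)) y-root (proj₂ (proj₂ some-root))
                  _ , w≈ = T-injective v∈ w∈ z₁.v∈M z₁.w∈M (trans (sym y≈) (trans y≈t z₁.y≈))
              in trans (sym 3w≈m) (trans (3·-cong w≈) z₁.3w≈z)

        module _ (irreducibleB : IrreducibleB) (ω-y∈ : b.ω ∈ base-field) where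
          private
            Y∉ : y₀ ∉ base-field
            Y∉ Y∈ = ω∉ (Y₀∈⇒ω-x∈ Fθ₀≈0 base-field Y∈ ω-y∈)

          -- An irrational common element generates a root of the second cubic, as `Lb` is cubic
          -- over M. That root lies in `M⟨x₁⟩⟨ω⟩`, so some root lies in `M⟨x₁⟩`, giving a rational
          -- root of F and a rational `Y₀`, which is impossible when exactly one `ω` is rational.
          𝔖₃-C₃-disjoint : Member La ∩ Member Lb ≐ base
          𝔖₃-C₃-disjoint = (λ {t} (t∈La , t∈Lb) → decidable-stable (holds? _) λ t∉M →
              let y₁∈La = ⟨⟩-least {base-field} {Laᴵ} (base⊆ Laᴵ) t∈La (cubic-generator {base-field} (b.P∈ base-field) (b.Q∈ base-field)
                    irreducibleB b.root₁ (Lb⊑ t∈Lb) t∉M)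
              in NoRoot-quadratic {M⟨x₁⟩} (b.P∈ M⟨x₁⟩) (b.Q∈ M⟨x₁⟩)
                   (λ y y∈ y-root → let z = rational-root-from irreducibleB y∈ y-root in
                     Y∉ (rational-root⇒Y₀∈M Fθ₀≈0 (RationalRoot.root z) (ι-∈ base-field (RationalRoot.z z))))
                   (a.ω-quadratic M⟨x₁⟩) b.x₁ (La⊑M⟨x₁⟩⟨ω⟩ y₁∈La) b.root₁) ,
            λ x∈M → base⊆ Laᴵ x∈M , base⊆ Lbᴵ x∈M
            where
            Lb⊑ : Lbᴵ ⊑ base-field ⟨ b.x₁ ⟩
            Lb⊑ = b.least (base-field ⟨ b.x₁ ⟩) (⟨⟩-generator {base-field})
              (b.x₂∈ (base-field ⟨ b.x₁ ⟩) (⟨⟩-generator {base-field}) (base⊆ (base-field ⟨ b.x₁ ⟩) ω-y∈))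

          𝔖₃-C₃ : Mᵈ.IrreducibleFactorDegrees sextic (6 ∷ [])
          𝔖₃-C₃ = six Y∉

        module _ (S : Relabelling Sᵇ) (x₂∉M : SplittingField.x₂ (Relabelling.relabelled S) ∉ base-field) where

          -- Once one root of the second cubic is rational, its `ω` generates `Lb`; a rational `Y₀`
          -- would put this `ω` into `La`.
          𝔖₃-C₂-not-contained : ¬ (Member Lb ⊆ Member La) → Mᵈ.IrreducibleFactorDegrees sextic (6 ∷ [])
          𝔖₃-C₂-not-contained Lb⊈La = six λ Y∈ → Lb⊈La (SplittingField.least relabelled Laᴵ (base⊆ Laᴵ rational)
            (relabelled-x₂∈ S Laᴵ (ω-x∈⇒ω-y∈ Laᴵ Y∈ ω-x∈La)))
            where open Relabelling S

          𝔖₃-C₂-contained : Member Lb ⊆ Member La → Mᵈ.IrreducibleFactorDegrees sextic (3 ∷ 3 ∷ [])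
          𝔖₃-C₂-contained Lb⊆La = two-cubics-reducible
            (Lb⊑La⇒Y∈M ω∉ (λ ω-y∈ → x₂∉M (relabelled-x₂∈ S base-field ω-y∈)) (Lb⊆La ω-y∈Lb))
            (relabelled-reducible S)

        𝔖₃-trivial : b.x₁ ∈ base-field → b.x₂ ∈ base-field → Mᵈ.IrreducibleFactorDegrees sextic (6 ∷ [])
        𝔖₃-trivial x₁∈ x₂∈ = six λ Y∈ → ω∉ (Y₀∈⇒ω-x∈ Fθ₀≈0 base-field Y∈ (b.ω∈ base-field x₁∈ x₂∈))

      module _ (ω∈ : a.ω ∈ base-field) where
        C₃-C₃-different : b.ω ∈ base-field → ¬ (Member La ≐ Member Lb) → Mᵈ.IrreducibleFactorDegrees sextic (3 ∷ 3 ∷ [])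
        C₃-C₃-different ω-y∈ = two-cubics-different (ω∈⇒Y₀∈ Fθ₀≈0 ω∈ ω-y∈)

        C₃-C₃-equal : IrreducibleB → Member La ≐ Member Lb → Mᵈ.IrreducibleFactorDegrees sextic (1 ∷ 1 ∷ 1 ∷ 3 ∷ [])
        C₃-C₃-equal irreducibleB (_ , Lb⊆La) = by-coset (zero? _) (zero? _)
          where
          rational : ∀ {y} → y ∈ Lbᴵ → cubic (- (3 · C′)) (- G) y ≈ 0# → RationalRoot y
          rational y∈ = rational-root-from irreducibleB (La⊑M⟨x₁⟩ ω∈ (Lb⊆La y∈))

          z₁ : RationalRoot b.x₁
          z₁ = rational b.x₁∈L b.root₁

          z₂ : RationalRoot b.x₂
          z₂ = rational b.x₂∈L b.root₂

          z₃ : RationalRoot b.x₃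
          z₃ = rational b.x₃∈L b.root₃

          module z₁ = RationalRoot z₁
          module z₂ = RationalRoot z₂
          module z₃ = RationalRoot z₃

          -- The three roots of the second cubic sum to 0. Written as `T` at the same `x₁`, this is
          -- a relation over M between its powers, so the w sum to 0 as well.
          sum : ι z₁.z + ι z₂.z + ι z₃.z ≈ 0#
          sum = trans (+-cong (+-cong (sym z₁.3w≈z) (sym z₂.3w≈z)) (sym z₃.3w≈z))
            (trans (solve 3 (λ u v w → 3 ⊙ u ⊕ 3 ⊙ v ⊕ 3 ⊙ w ⊜ 𝟘 ⊕ (3 ⊙ 𝟙) ⊗ ((u ⊕ v ⊕ w) ⊖ 𝟘)) z₁.w z₂.w z₃.w)
              (absorb (proj₂ (T-injective
                (closed base-field 3 (λ u v w → u ⊕ v ⊕ w) (z₁.v∈M ∷ z₂.v∈M ∷ z₃.v∈M ∷ []))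
                (closed base-field 3 (λ u v w → u ⊕ v ⊕ w) (z₁.w∈M ∷ z₂.w∈M ∷ z₃.w∈M ∷ []))
                (Intermediate.0-closed base-field) (Intermediate.0-closed base-field)
                (trans (solve 8 (λ A x v₁ v₂ v₃ w₁ w₂ w₃ → let u = x ↑ 2 ⊖ 2 ⊙ A in
                    (v₁ ⊕ v₂ ⊕ v₃) ⊗ x ⊕ (w₁ ⊕ w₂ ⊕ w₃) ⊗ u ⊜
                    (v₁ ⊗ x ⊕ w₁ ⊗ u) ⊕ (v₂ ⊗ x ⊕ w₂ ⊗ u) ⊕ (v₃ ⊗ x ⊕ w₃ ⊗ u)) A a.x₁ z₁.v z₂.v z₃.v z₁.w z₂.w z₃.w)
                  (trans (+-cong (+-cong (sym z₁.y≈) (sym z₂.y≈)) (sym z₃.y≈))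
                    (trans b.sum-zero (solve 2 (λ A x → 𝟘 ⊜ 𝟘 ⊗ x ⊕ 𝟘 ⊗ (x ↑ 2 ⊖ 2 ⊙ A)) A a.x₁))))))))

          complete : ∀ m → F (ι m) ≈ 0# → ι m ≈ ι z₁.z ⊎ ι m ≈ ι z₂.z ⊎ ι m ≈ ι z₃.z
          complete m Fm≈0 =
            let y , y-root , _ , v , w , v∈ , w∈ , 3w≈m , y≈ = rational-root-of m Fm≈0
                compare : ∀ {y′} (r : RationalRoot y′) → y ≈ y′ → ι m ≈ ι (RationalRoot.z r)
                compare r y≈y′ = let module r = RationalRoot r in trans (sym 3w≈m) (trans (3·-cong (proj₂
                  (T-injective v∈ w∈ r.v∈M r.w∈M (trans (sym y≈) (trans y≈y′ r.y≈))))) r.3w≈z)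
            in Sum.map (compare z₁) (Sum.map (compare z₂) (compare z₃)) (b.root-cases y-root)

          -- Two of the three roots belong to the same cubic factor.
          by-coset : Dec (Y (ι z₁.z) - Y (ι z₂.z) ≈ 0#) → Dec (Y (ι z₁.z) - Y (ι z₃.z) ≈ 0#) →
            Mᵈ.IrreducibleFactorDegrees sextic (1 ∷ 1 ∷ 1 ∷ 3 ∷ [])
          by-coset (yes p) _ = three-roots z₁.z z₂.z (b.x₁≉x₂ ∘ rational-root-injective z₁ z₂) z₁.root (difference-zero p)
            λ m Fm≈0 → Sum.map id (Sum.map id (λ m≈ → trans m≈ (trans
              (solve 3 (λ u v w → w ⊜ (⊝ u ⊖ v) ⊕ 𝟙 ⊗ ((u ⊕ v ⊕ w) ⊖ 𝟘)) (ι z₁.z) (ι z₂.z) (ι z₃.z)) (absorb sum)))) (complete m Fm≈0)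
          by-coset (no _) (yes p) = three-roots z₁.z z₃.z (b.x₁≉x₃ ∘ rational-root-injective z₁ z₃) z₁.root (difference-zero p)
            λ m Fm≈0 → Sum.map id (Sum.swap ∘ Sum.map (λ m≈ → trans m≈ (trans
              (solve 3 (λ u v w → v ⊜ (⊝ u ⊖ w) ⊕ 𝟙 ⊗ ((u ⊕ v ⊕ w) ⊖ 𝟘)) (ι z₁.z) (ι z₂.z) (ι z₃.z)) (absorb sum))) id) (complete m Fm≈0)
          -- Both `z₂` and `z₃` miss the value of Y at `z₁`, so they share the other one.
          by-coset (no p) (no q) = three-roots z₂.z z₃.z (b.x₂≉x₃ ∘ rational-root-injective z₂ z₃) z₂.root
            (trans (opposite p z₂.root) (sym (opposite q z₃.root)))
            λ m Fm≈0 → [ (λ m≈ → inj₂ (inj₂ (trans m≈ (trans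
                (solve 3 (λ u v w → u ⊜ (⊝ v ⊖ w) ⊕ 𝟙 ⊗ ((u ⊕ v ⊕ w) ⊖ 𝟘)) (ι z₁.z) (ι z₂.z) (ι z₃.z)) (absorb sum)))))
              , Sum.map id inj₁ ]′ (complete m Fm≈0)
            where
            opposite : ∀ {θ} → ¬ Y (ι z₁.z) - Y θ ≈ 0# → F θ ≈ 0# → Y θ ≈ - s - Y (ι z₁.z)
            opposite {θ} p Fθ≈0 = trans
              (solve 3 (λ s y y′ → y′ ⊜ (⊝ s ⊖ y) ⊕ 𝟙 ⊗ ((y ⊕ y′ ⊕ s) ⊖ 𝟘)) s (Y (ι z₁.z)) (Y θ))
              (absorb (conjugate-roots z₁.root Fθ≈0 p))

        -- With one root rational, the others generate an extension whose elements are all quadratic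
        -- over M. An element of that kind inside `La`, which lies in the cubic extension `M⟨x₁⟩`,
        -- is rational.
        C₃-C₂-disjoint : (S : Relabelling Sᵇ) → Member La ∩ Member Lb ≐ base
        C₃-C₂-disjoint S = (λ {t} (t∈La , t∈Lb) → quadratic∩cubic {base-field} (a.P∈ base-field) (a.Q∈ base-field) irreducible a.root₁
            (quadratic-element {base-field} x₂-is-quadratic (Lb⊑ t∈Lb)) (La⊑M⟨x₁⟩ ω∈ t∈La)) ,
          λ x∈M → base⊆ Laᴵ x∈M , base⊆ Lbᴵ x∈M
          where
          open Relabelling S
          module b′ = SplittingField relabelled

          x₂-is-quadratic : Quadratic base-field b′.x₂
          x₂-is-quadratic = - b′.x₁ , 3 · C′ - b′.x₁ ^ 2 , Intermediate.-‿closed base-field rational ,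
            closed base-field 2 (λ A x → 3 ⊙ A ⊖ x ↑ 2) (b′.A∈M ∷ rational ∷ []) , b′.x₂-quadratic

          Lb⊑ : Lbᴵ ⊑ base-field ⟨ b′.x₂ ⟩
          Lb⊑ = b′.least (base-field ⟨ b′.x₂ ⟩) (base⊆ (base-field ⟨ b′.x₂ ⟩) rational) (⟨⟩-generator {base-field})

        C₃-C₂ : (S : Relabelling Sᵇ) → SplittingField.x₂ (Relabelling.relabelled S) ∉ base-field →
          Mᵈ.IrreducibleFactorDegrees sextic (6 ∷ [])
        C₃-C₂ S x₂∉M = six λ Y∈ → x₂∉M (relabelled-x₂∈ S base-field (ω-x∈⇒ω-y∈ base-field Y∈ ω∈))

        C₃-trivial : b.x₁ ∈ base-field → b.x₂ ∈ base-field → Mᵈ.IrreducibleFactorDegrees sextic (3 ∷ 3 ∷ [])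
        C₃-trivial x₁∈ x₂∈ = two-cubics-reducible (ω∈⇒Y₀∈ Fθ₀≈0 ω∈ (b.ω∈ base-field x₁∈ x₂∈))
          (λ irreducibleB → irreducibleB b.x₁ x₁∈ b.root₁)

theorem4p5 :
    ∀ {c ℓ₁ ℓ₂} → ExcludedMiddle (c ⊔ ℓ₁ ⊔ ℓ₂) →
    (k M : HeytingField c ℓ₁ ℓ₂)
    (κ : HeytingField.Carrier k → HeytingField.Carrier M) → IsExtension k M κ →
    ¬ FieldDefinitions.Characteristic k 3 →
    Infinite (HeytingField.setoid M) →
    (closure : AlgebraicClosure M) →
    let open HeytingField M
        open FieldDefinitions M
        open InClosure M closure
    in
    (a b : Triple) (DaDb#0 : D a * D b # 0#) →
    let La = Spl base (f₃ a)
        Lb = Spl base (f₃ b)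
        Ga = Gal La
        Gb = Gal Lb
        F  = F₂ a b (xy#0→x#0 DaDb#0)
    in
    Ga #≥# Gb →
    Irreducible (f₃ a) →
    A a * A b # 0# →
    A a ^ 3 * B b ^ 2 - 27 · (A b ^ 3 * D a) # 0# →
      (Ga ≅ 𝔖 3 →
          (Gb ≅ 𝔖 3 →
              (Member La ∩ Member Lb ≐ base → IrreducibleFactorDegrees F (6 ∷ []))
            × (HasDegreeOverBase (Member La ∩ Member Lb) 2 → IrreducibleFactorDegrees F (3 ∷ 3 ∷ []))
            × (Member La ≐ Member Lb → IrreducibleFactorDegrees F (1 ∷ 2 ∷ 3 ∷ [])))
        × (Gb ≅ C 3 →
              (Member La ∩ Member Lb ≐ base) × IrreducibleFactorDegrees F (6 ∷ []))
        × (Gb ≅ C 2 →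
              (¬ (Member Lb ⊆ Member La) → IrreducibleFactorDegrees F (6 ∷ []))
            × (Member Lb ⊆ Member La → IrreducibleFactorDegrees F (3 ∷ 3 ∷ [])))
        × (Trivial Gb → IrreducibleFactorDegrees F (6 ∷ [])))
    × (Ga ≅ C 3 →
          (Gb ≅ C 3 →
              (¬ (Member La ≐ Member Lb) → IrreducibleFactorDegrees F (3 ∷ 3 ∷ []))
            × (Member La ≐ Member Lb → IrreducibleFactorDegrees F (1 ∷ 1 ∷ 1 ∷ 3 ∷ [])))
        × (Gb ≅ C 2 →
              (Member La ∩ Member Lb ≐ base) × IrreducibleFactorDegrees F (6 ∷ []))
        × (Trivial Gb → IrreducibleFactorDegrees F (3 ∷ 3 ∷ [])))
    × (∀ h → Irreducible h → h ∣ₚ F → ∀ θ → Root h θ →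
          Member (Spl (Member base⟨ θ ⟩) (f₃ a)) ≐ Member (Spl (Member base⟨ θ ⟩) (f₃ b)))
theorem4p5 em k M κ extension ¬char3 _ closure a b DaDb#0 _ f₃-irreducible AaAb#0 nondegenerate =
  (λ Ga≅𝔖₃ → let _ , ω∉ = 𝔖₃⇒ Sa Ga≅𝔖₃ in
    (λ Gb≅𝔖₃ → let irreducibleB , ω-y∉ = 𝔖₃⇒ Sᵇ Gb≅𝔖₃ in
        𝔖₃-𝔖₃-disjoint ω∉ irreducibleB ω-y∉
      , 𝔖₃-𝔖₃-quadratic ω∉ irreducibleB ω-y∉
      , 𝔖₃-𝔖₃-equal ω∉ irreducibleB ω-y∉)
    , (λ Gb≅C₃ → let irreducibleB , ω-y∈ = C₃⇒ Sᵇ Gb≅C₃ in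
        𝔖₃-C₃-disjoint ω∉ irreducibleB ω-y∈ , 𝔖₃-C₃ ω∉ irreducibleB ω-y∈)
    , (λ Gb≅C₂ → let S , x₂∉M = C₂⇒ Sᵇ Gb≅C₂ in
        𝔖₃-C₂-not-contained ω∉ S x₂∉M , 𝔖₃-C₂-contained ω∉ S x₂∉M)
    , (λ trivial → let x₁∈M , x₂∈M = trivial⇒ Sᵇ trivial in 𝔖₃-trivial ω∉ x₁∈M x₂∈M))
  , (λ Ga≅C₃ → let _ , ω∈ = C₃⇒ Sa Ga≅C₃ in
    (λ Gb≅C₃ → let irreducibleB , ω-y∈ = C₃⇒ Sᵇ Gb≅C₃ in
        C₃-C₃-different ω∈ ω-y∈ , C₃-C₃-equal ω∈ irreducibleB)
    , (λ Gb≅C₂ → let S , x₂∉M = C₂⇒ Sᵇ Gb≅C₂ in C₃-C₂-disjoint ω∈ S , C₃-C₂ ω∈ S x₂∉M)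
    , (λ trivial → let x₁∈M , x₂∈M = trivial⇒ Sᵇ trivial in C₃-trivial ω∈ x₁∈M x₂∈M))
  -- A root of a factor is a root of the sextic, so both splitting fields can be compared over
  -- `base⟨ θ ⟩`, which contains it.
  , λ { h _ (q RawMagma., qh≈F) θ hθ≈0 → same-splitting
          (trans (sym (sextic-value θ)) (trans (sym (evalᴹ-≈ₚ (q Mᵈ.*ₚ h) sextic θ qh≈F))
            (trans (evalᴹ-*ₚ q h θ) (trans (*-congˡ hθ≈0) (zeroʳ _)))))
          (record { subfield = base⟨ θ ⟩ ; base⊆ = λ x∈M → generator (inj₁ x∈M) })
          (generator (inj₂ refl)) }
  where
  open Extension em M closure

  3≉0 : ¬ 3 · 1# ≈ 0#
  3≉0 = extension-3≉0 M Ω ι isExtension (extension-3≉0 k M κ extension (¬char3 ∘ Characteristic-3 em k))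

  open WithoutCharacteristic3 3≉0
  open Factorisation a b DaDb#0 f₃-irreducible AaAb#0 nondegenerate
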